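{- Let $v>k$ be positive integers and let $W$ be a balanced weighing matrix with parameters $(v,k,\lambda)$ (a balanced generalized weighing matrix over $\{1,-1\}$). Write $W=W_1-W_2$ with $W_1,W_2$ disjoint $(0,1)$-matrices, let $S=\begin{bmatrix}0&1\\1&0\end{bmatrix}$, and define the following $4v\times4v$ matrices: \begin{align*} A_0&=\begin{bmatrix}I_2\otimes I_v&0\\0&I_2\otimes I_v\end{bmatrix},\quad A_1=\begin{bmatrix}S\otimes I_v&0\\0&S\otimes I_v\end{bmatrix},\quad A_2=\begin{bmatrix}J_2\otimes(J_v-I_v)&0\\0&J_2\otimes(J_v-I_v)\end{bmatrix},\\ A_3&=\begin{bmatrix}0&I_2\otimes W_1+S\otimes W_2\\ I_2\otimes W_1^\top+S\otimes W_2^\top&0\end{bmatrix},\quad A_4=\begin{bmatrix}0&I_2\otimes W_2+S\otimes W_1\\ I_2\otimes W_2^\top+S\otimes W_1^\top&0\end{bmatrix},\\ A_5&=\begin{bmatrix}0&J_2\otimes(J_v-W_1-W_2)\\ J_2\otimes(J_v-W_1^\top-W_2^\top)&0\end{bmatrix}. \end{align*} Then $\{A_i\}_{i=0}^5$ is a (symmetric) association scheme with $5$ classes, and for a suitable ordering $E_0=\frac{1}{4v}J_{4v},E_1,\ldots,E_5$ of its primitive idempotents its first and second eigenmatrices are $$P=\left[\begin{array}{cccccc} 1&1&2(v-1)&k&k&2(v-k)\\ 1&-1&0&\sqrt{k}&-\sqrt{k}&0\\ 1&-1&0&-\sqrt{k}&\sqrt{k}&0\\ 1&1&2(v-1)&-k&-k&-2(v-k)\\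 1&1&-2&-\sqrt{\frac{(v-k)k}{v-1}}&-\sqrt{\frac{(v-k)k}{v-1}}&2\sqrt{\frac{(v-k)k}{v-1}}\\ 1&1&-2&\sqrt{\frac{(v-k)k}{v-1}}&\sqrt{\frac{(v-k)k}{v-1}}&-2\sqrt{\frac{(v-k)k}{v-1}} \end{array}\right],$$ $$Q=\left[\begin{array}{cccccc} 1&v&v&1&v-1&v-1\\ 1&-v&-v&1&v-1&v-1\\ 1&0&0&1&-1&-1\\ 1&\frac{v}{\sqrt{k}}&-\frac{v}{\sqrt{k}}&-1&-\sqrt{\frac{(v-1)(v-k)}{k}}&\sqrt{\frac{(v-1)(v-k)}{k}}\\ 1&-\frac{v}{\sqrt{k}}&\frac{v}{\sqrt{k}}&-1&-\sqrt{\frac{(v-1)(v-k)}{k}}&\sqrt{\frac{(v-1)(v-k)}{k}}\\ 1&0&0&-1&\sqrt{\frac{(v-1)k}{v-k}}&-\sqrt{\frac{(v-1)k}{v-k}} \end{array}\right].$$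
   Context: A balanced weighing matrix with parameters $(v,k,\lambda)$ is a $v\times v$ matrix $W$ over $\{0,1,-1\}$ with $WW^\top=kI_v$, exactly $k$ nonzero entries in each row, and such that for any two distinct rows $i\neq j$ the multiset $\{w_{il}w_{jl}: w_{il}\neq0\neq w_{jl}\}$ contains each of $1$ and $-1$ exactly $\lambda/2$ times (so the support of $W$ is a symmetric $(v,k,\lambda)$ design). A symmetric association scheme with $n$ classes on a finite set $X$ is a family of nonzero $(0,1)$-matrices $A_0,\ldots,A_n$ indexed by $X$ with $A_0=I_{|X|}$, $\sum_iA_i=J_{|X|}$, $A_i^\top=A_i$ for all $i$, and $A_iA_j=\sum_kp_{ij}^kA_k$ for some integers $p_{ij}^k$. Their span (the Bose–Mesner algebra) has a basis of primitive idempotents $E_0=\frac{1}{|X|}J_{|X|},E_1,\ldots,E_n$; the first eigenmatrix $P=(p_{ij})$ and second eigenmatrix $Q=(q_{ij})$ are defined by $A_j=\sum_ip_{ij}E_i$ and $E_j=\frac{1}{|X|}\sum_iq_{ij}A_i$. $I_m$, $J_m$ denote the identity and all-one matrices of order $m$, and $\otimes$ the Kronecker product. -}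

module Defs where

open import Level using (Level; _⊔_) renaming (suc to lsuc)
open import Data.Nat as ℕ using (ℕ; _∸_)
open import Data.Integer as ℤ using (ℤ; +_; -[1+_]; 0ℤ; 1ℤ)
open import Data.Fin using (Fin; zero; suc; remQuot)
open import Data.Vec using (Vec; []; _∷_; lookup)
open import Data.Product using (Σ; _×_; _,_; ∃; ∃₂)
open import Data.Sum using (_⊎_)
open import Data.Bool using (Bool; true; false; if_then_else_; not)
open import Relation.Nullary using (¬_)
open import Relation.Nullary.Decidable using (⌊_⌋)
open import Relation.Binary.PropositionalEquality using (_≡_; _≢_)
open import Relation.Binary.Structures using (IsTotalOrder)
open import Algebra.Bundles using (CommutativeRing)
import Data.Fin as F

∑ : ∀ {a} {A : Set a} → (A → A → A) → A → ∀ n → (Fin n → A) → A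
∑ _+_ e ℕ.zero    f = e
∑ _+_ e (ℕ.suc n) f = f zero + ∑ _+_ e n (λ i → f (suc i))

Mat : ∀ {a} → Set a → ℕ → ℕ → Set a
Mat A m n = Fin m → Fin n → A

_ᵀ : ∀ {a} {A : Set a} {m n} → Mat A m n → Mat A n m
(M ᵀ) i j = M j i

-- Kronecker product  (M ⊗ N) with row index  i*|N| + i'  (Data.Fin.combine)
kron : ∀ {a} {A : Set a} → (A → A → A) → ∀ {m n p q} →
       Mat A m n → Mat A p q → Mat A (m ℕ.* p) (n ℕ.* q)
kron _*_ {m} {n} {p} {q} M N x y with remQuot {m} p x | remQuot {n} q y
... | i , i' | j , j' = M i j * N i' j'

block : ∀ {a} {A : Set a} {n} → Mat A n n → Mat A n n → Mat A n n → Mat A n n →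
        Mat A (2 ℕ.* n) (2 ℕ.* n)
block {n = n} X₁₁ X₁₂ X₂₁ X₂₂ x y with remQuot {2} n x | remQuot {2} n y
... | zero , i     | zero , j     = X₁₁ i j
... | zero , i     | suc zero , j = X₁₂ i j
... | suc zero , i | zero , j     = X₂₁ i j
... | suc zero , i | suc zero , j = X₂₂ i j

module ZMat where
  open import Data.Integer using (_+_; _*_; _-_; -_)

  ∑ℤ : ∀ n → (Fin n → ℤ) → ℤ
  ∑ℤ = ∑ _+_ 0ℤ

  Id : ∀ n → Mat ℤ n n
  Id n i j = if ⌊ i F.≟ j ⌋ then 1ℤ else 0ℤ

  Jm : ∀ m n → Mat ℤ m n
  Jm m n i j = 1ℤ

  _⊕_ : ∀ {m n} → Mat ℤ m n → Mat ℤ m n → Mat ℤ m n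
  (M ⊕ N) i j = M i j + N i j

  _⊖_ : ∀ {m n} → Mat ℤ m n → Mat ℤ m n → Mat ℤ m n
  (M ⊖ N) i j = M i j - N i j

  _⊗_ : ∀ {m n p q} → Mat ℤ m n → Mat ℤ p q → Mat ℤ (m ℕ.* p) (n ℕ.* q)
  _⊗_ = kron _*_

  _·_ : ∀ {m n p} → Mat ℤ m n → Mat ℤ n p → Mat ℤ m p
  (M · N) i j = ∑ℤ _ (λ l → M i l * N l j)

  Zero : ∀ m n → Mat ℤ m n
  Zero m n i j = 0ℤ

  S : Mat ℤ 2 2
  S i j = if ⌊ i F.≟ j ⌋ then 0ℤ else 1ℤ

open ZMat public

count : ∀ n → (Fin n → Bool) → ℕ
count n P = ∑ ℕ._+_ 0 n (λ l → if P l then 1 else 0)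

record IsBalancedWeighing (v k lam : ℕ) (W : Mat ℤ v v) : Set where
  field
    entries   : ∀ i j → W i j ≡ 0ℤ ⊎ W i j ≡ 1ℤ ⊎ W i j ≡ ℤ.- 1ℤ
    orthogonal : ∀ i j → (W · (W ᵀ)) i j ≡ ℤ.+ k ℤ.* Id v i j
    rowWeight : ∀ i → count v (λ l → not ⌊ ℤ._≟_ (W i l) 0ℤ ⌋) ≡ k
    balancedPlus  : ∀ i j → i ≢ j →
      count v (λ l → ⌊ ℤ._≟_ (W i l ℤ.* W j l) 1ℤ ⌋) ℕ.* 2 ≡ lam
    balancedMinus : ∀ i j → i ≢ j →
      count v (λ l → ⌊ ℤ._≟_ (W i l ℤ.* W j l) (ℤ.- 1ℤ) ⌋) ℕ.* 2 ≡ lam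

W₁ : ∀ {v} → Mat ℤ v v → Mat ℤ v v
W₁ W i j = if ⌊ ℤ._≟_ (W i j) 1ℤ ⌋ then 1ℤ else 0ℤ

W₂ : ∀ {v} → Mat ℤ v v → Mat ℤ v v
W₂ W i j = if ⌊ ℤ._≟_ (W i j) (ℤ.- 1ℤ) ⌋ then 1ℤ else 0ℤ

schemeA : ∀ v → Mat ℤ v v → Fin 6 → Mat ℤ (2 ℕ.* (2 ℕ.* v)) (2 ℕ.* (2 ℕ.* v))
schemeA v W i = lookup mats i
  where
  I₂ = Id 2
  J₂ = Jm 2 2
  Iv = Id v
  Jv = Jm v v
  O  = Zero (2 ℕ.* v) (2 ℕ.* v)
  X₁ = W₁ W
  X₂ = W₂ W
  mats : Vec (Mat ℤ (2 ℕ.* (2 ℕ.* v)) (2 ℕ.* (2 ℕ.* v))) 6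
  mats =
      block (I₂ ⊗ Iv) O O (I₂ ⊗ Iv)
    ∷ block (S ⊗ Iv) O O (S ⊗ Iv)
    ∷ block (J₂ ⊗ (Jv ⊖ Iv)) O O (J₂ ⊗ (Jv ⊖ Iv))
    ∷ block O ((I₂ ⊗ X₁) ⊕ (S ⊗ X₂)) ((I₂ ⊗ (X₁ ᵀ)) ⊕ (S ⊗ (X₂ ᵀ))) O
    ∷ block O ((I₂ ⊗ X₂) ⊕ (S ⊗ X₁)) ((I₂ ⊗ (X₂ ᵀ)) ⊕ (S ⊗ (X₁ ᵀ))) O
    ∷ block O (J₂ ⊗ ((Jv ⊖ X₁) ⊖ X₂)) (J₂ ⊗ ((Jv ⊖ (X₁ ᵀ)) ⊖ (X₂ ᵀ))) O
    ∷ []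

record IsSymAssocScheme (N n : ℕ) (A : Fin (ℕ.suc n) → Mat ℤ N N) : Set where
  field
    zeroOne  : ∀ i x y → A i x y ≡ 0ℤ ⊎ A i x y ≡ 1ℤ
    nonzero  : ∀ i → ∃₂ λ x y → A i x y ≢ 0ℤ
    A₀≡I     : ∀ x y → A zero x y ≡ Id N x y
    sum≡J    : ∀ x y → ∑ℤ (ℕ.suc n) (λ i → A i x y) ≡ 1ℤ
    symmetric : ∀ i x y → A i x y ≡ A i y x
    closed   : ∃ λ (p : Fin (ℕ.suc n) → Fin (ℕ.suc n) → Fin (ℕ.suc n) → ℤ) →
               ∀ i j x y → (A i · A j) x y ≡ ∑ℤ (ℕ.suc n) (λ k → p i j k ℤ.* A k x y)

-- Scalars: an ordered field with square roots of non-negative elements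
-- (an abstract stand-in for ℝ, which is a model; agda-stdlib has no ℝ).

record OrderedFieldWithSqrt (c ℓ ℓ' : Level) : Set (lsuc (c ⊔ ℓ ⊔ ℓ')) where
  field
    commRing : CommutativeRing c ℓ
  open CommutativeRing commRing public using (Carrier; _≈_; _+_; _*_; -_; 0#; 1#)
  field
    _≤_          : Carrier → Carrier → Set ℓ'
    isTotalOrder : IsTotalOrder _≈_ _≤_
    +-mono-≤     : ∀ {x y} z → x ≤ y → (x + z) ≤ (y + z)
    *-nonneg     : ∀ {x y} → 0# ≤ x → 0# ≤ y → 0# ≤ (x * y)
    0≉1          : ¬ (0# ≈ 1#)
    _⁻¹          : Carrier → Carrier
    ⁻¹-inverse   : ∀ x → ¬ (x ≈ 0#) → (x * (x ⁻¹)) ≈ 1#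
    √            : Carrier → Carrier
    √-nonneg     : ∀ x → 0# ≤ √ x
    √-square     : ∀ x → 0# ≤ x → (√ x * √ x) ≈ x

module OverField {c ℓ ℓ'} (F : OrderedFieldWithSqrt c ℓ ℓ') where
  open OrderedFieldWithSqrt F

  natF : ℕ → Carrier
  natF ℕ.zero    = 0#
  natF (ℕ.suc n) = 1# + natF n

  intF : ℤ → Carrier
  intF (+ n)      = natF n
  intF -[1+ n ]   = - natF (ℕ.suc n)

  _/ₙ_ : ℕ → ℕ → Carrier
  a /ₙ b = natF a * (natF b) ⁻¹

  MatF : ℕ → Set c
  MatF N = Mat Carrier N N

  _≋_ : ∀ {N} → MatF N → MatF N → Set ℓ
  M ≋ M' = ∀ x y → M x y ≈ M' x y

  _×ₘ_ : ∀ {N} → MatF N → MatF N → MatF N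
  (M ×ₘ M') x y = ∑ _+_ 0# _ (λ l → M x l * M' l y)

  _•_ : ∀ {N} → Carrier → MatF N → MatF N
  (a • M) x y = a * M x y

  ∑ₘ : ∀ {N} m → (Fin m → MatF N) → MatF N
  ∑ₘ m Ms x y = ∑ _+_ 0# m (λ i → Ms i x y)

  0ₘ : ∀ {N} → MatF N
  0ₘ x y = 0#

  liftₘ : ∀ {N} → Mat ℤ N N → MatF N
  liftₘ M x y = intF (M x y)

  InBM : ∀ {N n} → (Fin (ℕ.suc n) → Mat ℤ N N) → MatF N → Set (c ⊔ ℓ)
  InBM {n = n} A M = ∃ λ (γ : Fin (ℕ.suc n) → Carrier) →
                      M ≋ ∑ₘ (ℕ.suc n) (λ j → γ j • liftₘ (A j))

  record IsPrimitiveIdempotent {N n} (A : Fin (ℕ.suc n) → Mat ℤ N N) (E : MatF N)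
         : Set (c ⊔ ℓ) where
    field
      inBM       : InBM A E
      idempotent : (E ×ₘ E) ≋ E
      nonzero    : ¬ (E ≋ 0ₘ)
      isPrimitive : ∀ G → InBM A G → (G ×ₘ G) ≋ G → (G ×ₘ E) ≋ G →
                   G ≋ 0ₘ ⊎ G ≋ E

  record AreEigenmatrices {N n} (A : Fin (ℕ.suc n) → Mat ℤ N N)
         (E : Fin (ℕ.suc n) → MatF N) (P Q : Mat Carrier (ℕ.suc n) (ℕ.suc n))
         : Set (c ⊔ ℓ) where
    field
      primitiveIdem : ∀ i → IsPrimitiveIdempotent A (E i)
      orthogonal    : ∀ i j → i ≢ j → (E i ×ₘ E j) ≋ 0ₘ
      sum≡I         : ∑ₘ (ℕ.suc n) E ≋ liftₘ (Id N)
      E₀≡J/N        : E zero ≋ ((1 /ₙ N) • liftₘ (Jm N N))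
      firstEigen    : ∀ j → liftₘ (A j) ≋ ∑ₘ (ℕ.suc n) (λ i → P i j • E i)
      secondEigen   : ∀ j → E j ≋ ((1 /ₙ N) • ∑ₘ (ℕ.suc n) (λ i → Q i j • liftₘ (A i)))

  module _ (v k : ℕ) where
    private
      n : ℕ → Carrier
      n = natF
      sk = √ (n k)
      r₁ = √ (((v ∸ k) ℕ.* k) /ₙ (v ∸ 1))
      r₂ = √ (((v ∸ 1) ℕ.* (v ∸ k)) /ₙ k)
      r₃ = √ (((v ∸ 1) ℕ.* k) /ₙ (v ∸ k))
      vk = n v * sk ⁻¹
      m2 = 1# + 1#

    Pmat : Mat Carrier 6 6
    Pmat i j = lookup (lookup rows i) j
      where
      rows : Vec (Vec Carrier 6) 6
      rows =
          (1# ∷ 1#   ∷ n (2 ℕ.* (v ∸ 1)) ∷ n k    ∷ n k    ∷ n (2 ℕ.* (v ∸ k)) ∷ [])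
        ∷ (1# ∷ - 1# ∷ 0#               ∷ sk     ∷ - sk   ∷ 0# ∷ [])
        ∷ (1# ∷ - 1# ∷ 0#               ∷ - sk   ∷ sk     ∷ 0# ∷ [])
        ∷ (1# ∷ 1#   ∷ n (2 ℕ.* (v ∸ 1)) ∷ - n k  ∷ - n k  ∷ - n (2 ℕ.* (v ∸ k)) ∷ [])
        ∷ (1# ∷ 1#   ∷ - m2             ∷ - r₁   ∷ - r₁   ∷ m2 * r₁ ∷ [])
        ∷ (1# ∷ 1#   ∷ - m2             ∷ r₁     ∷ r₁     ∷ - (m2 * r₁) ∷ [])
        ∷ []

    Qmat : Mat Carrier 6 6
    Qmat i j = lookup (lookup rows i) j
      where
      rows : Vec (Vec Carrier 6) 6
      rows =
          (1# ∷ n v    ∷ n v    ∷ 1#   ∷ n (v ∸ 1) ∷ n (v ∸ 1) ∷ [])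
        ∷ (1# ∷ - n v  ∷ - n v  ∷ 1#   ∷ n (v ∸ 1) ∷ n (v ∸ 1) ∷ [])
        ∷ (1# ∷ 0#     ∷ 0#     ∷ 1#   ∷ - 1#      ∷ - 1#      ∷ [])
        ∷ (1# ∷ vk     ∷ - vk   ∷ - 1# ∷ - r₂      ∷ r₂        ∷ [])
        ∷ (1# ∷ - vk   ∷ vk     ∷ - 1# ∷ - r₂      ∷ r₂        ∷ [])
        ∷ (1# ∷ 0#     ∷ 0#     ∷ - 1# ∷ r₃        ∷ - r₃      ∷ [])
        ∷ []

{-# OPTIONS --safe #-}

-- Write N = W₁ + W₂ and λ = 2μ.  Since NᵀN − NNᵀ has Frobenius norm 0, the Gram
-- relations of the rows of W and of N pass to the columns.  Then A₁ permutes the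
-- Aⱼ, A₃² = kA₀ + μA₂, and multiplication by the block matrices
-- K = A₀ + A₁ + A₂ and K′ = A₃ + A₄ + A₅ is computed by row sums; as A₄ = A₁A₃,
-- these products determine all others, whence the closure of the span.
-- Over the field, A₃ acts on each of the pairs (K, K′), (A₀ − A₁, A₃ − A₄) and
-- (v(A₀ + A₁) − K, v(A₃ + A₄) − kK′) with square k², k and k − λ respectively;
-- diagonalising it gives the six columns of Q as common eigenvectors of all Aⱼ with
-- the rows of P as eigenvalues.  Distinct eigenvalues force orthogonality, and
-- idempotency follows from ΣEⱼ = I.
module Submission where

open import Defs
open import Data.Nat as ℕ using (ℕ; _∸_)
import Data.Nat.Properties as ℕ
open import Data.Integer as ℤ using (ℤ; +_; -[1+_]; 0ℤ; 1ℤ)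
import Data.Integer.Properties as ℤ
open import Data.Integer.Tactic.RingSolver using (solve-∀)
open import Data.Bool using (Bool; true; false; if_then_else_; not)
open import Data.Fin as Fin using (Fin; zero; suc; combine; remQuot; quotRem; _↑ˡ_; _↑ʳ_; opposite)
open import Data.Fin.Patterns using (0F; 1F; 2F; 3F; 4F; 5F)
import Data.Fin.Properties as Fin
open import Data.Maybe using (Maybe; just; nothing)
open import Data.Product using (Σ; _×_; _,_; ∃; ∃₂; proj₁; proj₂; swap)
open import Data.Sum using (_⊎_; inj₁; inj₂)
open import Data.Empty using (⊥-elim)
open import Relation.Nullary using (¬_; yes; no)
open import Relation.Nullary.Decidable using (⌊_⌋; from-yes; _⊎-dec_; ¬?)
open import Relation.Binary.PropositionalEquality as ≡ using (_≡_; _≢_)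
open import Relation.Binary.Structures using (IsTotalOrder)
open import Algebra.Bundles using (CommutativeRing)
import Algebra.Properties.CommutativeSemigroup as CommutativeSemigroupProperties
import Algebra.Properties.Group as GroupProperties
import Algebra.Properties.Ring as RingProperties
import Algebra.Properties.Semiring.Sum as SemiringSum
import Algebra.Solver.Ring as RingSolver
open import Algebra.Solver.Ring.AlmostCommutativeRing using (fromCommutativeRing; _-Raw-AlmostCommutative⟶_)
import Relation.Binary.Reasoning.Setoid as SetoidReasoning

-- Every hypothesis concerns the rows of W, whereas the lower right block of A₃² consists of
-- products of columns; hence the detour through transposition. Inverting W or N would leave ℤ; the
-- Frobenius norm only uses that a vanishing sum of integer squares vanishes term by term.
--
-- Behind A₃² = kA₀ + μA₂ stands a polarisation: WWᵀ and NNᵀ together determine in how many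
-- positions two distinct rows agree in sign and in how many they disagree, and both numbers are μ.
--
-- The three radicals of the design part come from one number. Double counting gives k² = (k - λ) +
-- vλ, that is (k - λ)(v - 1) = (v - k)k, so with r = √(k - λ) they are r, (v - k)/r and k/r.
--
-- Equality in the abstract field need not be decidable. That something is nonzero is therefore
-- derived from the order, and primitivity is reduced to a scalar z with z² = z, for which the
-- comparison of z with 1 - z decides between 0 and 1.

module Matrices {c ℓ} (R : CommutativeRing c ℓ) where
  open CommutativeRing R hiding (zero)
  open SemiringSum semiring using (sum; *-distribˡ-sum; *-distribʳ-sum; ∑-distrib-+; ∑-comm)
  open CommutativeSemigroupProperties *-commutativeSemigroup using (x∙yz≈y∙xz)
  open SetoidReasoning setoid

  -- Sums and matrix products over a commutative ring

  ∑ᵣ : ∀ n → (Fin n → Carrier) → Carrier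
  ∑ᵣ = ∑ _+_ 0#

  -- Both are the same right fold, so the library's results on `sum` carry over to the `∑` of the
  -- definitions.
  ∑≡sum : ∀ n f → ∑ᵣ n f ≡ sum f
  ∑≡sum ℕ.zero    f = ≡.refl
  ∑≡sum (ℕ.suc n) f = ≡.cong (_+_ (f zero)) (∑≡sum n (λ i → f (suc i)))

  ∑-cong : ∀ n {f g : Fin n → Carrier} → (∀ i → f i ≈ g i) → ∑ᵣ n f ≈ ∑ᵣ n g
  ∑-cong ℕ.zero    f≈g = refl
  ∑-cong (ℕ.suc n) f≈g = +-cong (f≈g zero) (∑-cong n (λ i → f≈g (suc i)))

  ∑-+ : ∀ n f g → ∑ᵣ n (λ i → f i + g i) ≈ ∑ᵣ n f + ∑ᵣ n g
  ∑-+ n f g rewrite ∑≡sum n (λ i → f i + g i) | ∑≡sum n f | ∑≡sum n g = ∑-distrib-+ f g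

  ∑-*ˡ : ∀ n x f → x * ∑ᵣ n f ≈ ∑ᵣ n (λ i → x * f i)
  ∑-*ˡ n x f rewrite ∑≡sum n f | ∑≡sum n (λ i → x * f i) = *-distribˡ-sum x f

  ∑-*ʳ : ∀ n x f → ∑ᵣ n f * x ≈ ∑ᵣ n (λ i → f i * x)
  ∑-*ʳ n x f rewrite ∑≡sum n f | ∑≡sum n (λ i → f i * x) = *-distribʳ-sum x f

  ∑-swap : ∀ m n (f : Fin m → Fin n → Carrier) →
           ∑ᵣ m (λ i → ∑ᵣ n (f i)) ≈ ∑ᵣ n (λ j → ∑ᵣ m (λ i → f i j))
  ∑-swap m n f = begin
    ∑ᵣ m (λ i → ∑ᵣ n (f i))           ≈⟨ ∑-cong _ (λ i → reflexive (∑≡sum n (f i))) ⟩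
    ∑ᵣ m (λ i → sum (f i))            ≡⟨ ∑≡sum m _ ⟩
    sum (λ i → sum (f i))             ≈⟨ ∑-comm f ⟩
    sum (λ j → sum (λ i → f i j))     ≡⟨ ∑≡sum n _ ⟨
    ∑ᵣ n (λ j → sum (λ i → f i j))    ≈⟨ ∑-cong _ (λ j → reflexive (∑≡sum m (λ i → f i j))) ⟨
    ∑ᵣ n (λ j → ∑ᵣ m (λ i → f i j))   ∎

  ∑-zero : ∀ n {f : Fin n → Carrier} → (∀ i → f i ≈ 0#) → ∑ᵣ n f ≈ 0#
  ∑-zero ℕ.zero    f≈0 = refl
  ∑-zero (ℕ.suc n) f≈0 = trans (+-cong (f≈0 zero) (∑-zero n (λ i → f≈0 (suc i)))) (+-identityˡ 0#)

  ∑-lin : ∀ n x y f g → ∑ᵣ n (λ i → x * f i + y * g i) ≈ x * ∑ᵣ n f + y * ∑ᵣ n g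
  ∑-lin n x y f g = trans (∑-+ n _ _) (sym (+-cong (∑-*ˡ n x f) (∑-*ˡ n y g)))

  infixl 7 _⊡_
  _⊡_ : ∀ {m n p} → Mat Carrier m n → Mat Carrier n p → Mat Carrier m p
  (M ⊡ N) i j = ∑ᵣ _ (λ l → M i l * N l j)

  infix 4 _≑_
  _≑_ : ∀ {m n} → Mat Carrier m n → Mat Carrier m n → Set ℓ
  M ≑ N = ∀ i j → M i j ≈ N i j

  ⊡-congˡ : ∀ {m n p} (M : Mat Carrier m n) {N N′ : Mat Carrier n p} → N ≑ N′ → (M ⊡ N) ≑ (M ⊡ N′)
  ⊡-congˡ M N≑ i j = ∑-cong _ (λ l → *-congˡ (N≑ l j))

  ⊡-congʳ : ∀ {m n p} {M M′ : Mat Carrier m n} (N : Mat Carrier n p) → M ≑ M′ → (M ⊡ N) ≑ (M′ ⊡ N)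
  ⊡-congʳ N M≑ i j = ∑-cong _ (λ l → *-congʳ (M≑ i l))

  ⊡-assoc : ∀ {m n p q} (M : Mat Carrier m n) (N : Mat Carrier n p) (L : Mat Carrier p q) →
            ((M ⊡ N) ⊡ L) ≑ (M ⊡ (N ⊡ L))
  ⊡-assoc {n = n} {p} M N L i j = begin
    ∑ᵣ p (λ b → ∑ᵣ n (λ a → M i a * N a b) * L b j)   ≈⟨ ∑-cong _ (λ b → ∑-*ʳ n (L b j) _) ⟩
    ∑ᵣ p (λ b → ∑ᵣ n (λ a → M i a * N a b * L b j))   ≈⟨ ∑-swap p n _ ⟩
    ∑ᵣ n (λ a → ∑ᵣ p (λ b → M i a * N a b * L b j))   ≈⟨ ∑-cong n (λ a → ∑-cong p (λ b → *-assoc _ _ _)) ⟩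
    ∑ᵣ n (λ a → ∑ᵣ p (λ b → M i a * (N a b * L b j))) ≈⟨ ∑-cong _ (λ a → ∑-*ˡ p (M i a) _) ⟨
    ∑ᵣ n (λ a → M i a * ∑ᵣ p (λ b → N a b * L b j))   ∎

  ⊡-ᵀ : ∀ {m n p} (M : Mat Carrier m n) (N : Mat Carrier n p) i j →
        (M ⊡ N) i j ≈ ((N ᵀ) ⊡ (M ᵀ)) j i
  ⊡-ᵀ M N i j = ∑-cong _ (λ l → *-comm (M i l) (N l j))

  ⊡-linʳ : ∀ {m n p} (M : Mat Carrier m n) (N L : Mat Carrier n p) x y i j →
           (M ⊡ (λ a b → x * N a b + y * L a b)) i j ≈ x * (M ⊡ N) i j + y * (M ⊡ L) i j
  ⊡-linʳ {n = n} M N L x y i j = trans (∑-cong n (λ l → step (M i l) (N l j) (L l j))) (∑-lin n x y _ _)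
    where
    step : ∀ m n l → m * (x * n + y * l) ≈ x * (m * n) + y * (m * l)
    step m n l = trans (distribˡ m _ _) (+-cong (x∙yz≈y∙xz m x n) (x∙yz≈y∙xz m y l))

  ⊡-∑ʳ : ∀ {m n p} r (M : Mat Carrier m n) (γ : Fin r → Carrier) (L : Fin r → Mat Carrier n p) i j →
         (M ⊡ (λ a b → ∑ᵣ r (λ h → γ h * L h a b))) i j ≈ ∑ᵣ r (λ h → γ h * (M ⊡ L h) i j)
  ⊡-∑ʳ {n = n} r M γ L i j = begin
    ∑ᵣ n (λ l → M i l * ∑ᵣ r (λ h → γ h * L h l j))    ≈⟨ ∑-cong n (λ l → ∑-*ˡ r (M i l) _) ⟩
    ∑ᵣ n (λ l → ∑ᵣ r (λ h → M i l * (γ h * L h l j)))  ≈⟨ ∑-swap n r _ ⟩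
    ∑ᵣ r (λ h → ∑ᵣ n (λ l → M i l * (γ h * L h l j)))  ≈⟨ ∑-cong r (λ h → ∑-cong n (λ l → x∙yz≈y∙xz (M i l) (γ h) (L h l j))) ⟩
    ∑ᵣ r (λ h → ∑ᵣ n (λ l → γ h * (M i l * L h l j)))  ≈⟨ ∑-cong r (λ h → ∑-*ˡ n (γ h) _) ⟨
    ∑ᵣ r (λ h → γ h * (M ⊡ L h) i j)                   ∎

  ⊡-∑ˡ : ∀ {m n p} r (γ : Fin r → Carrier) (L : Fin r → Mat Carrier m n) (M : Mat Carrier n p) i j →
         ((λ a b → ∑ᵣ r (λ h → γ h * L h a b)) ⊡ M) i j ≈ ∑ᵣ r (λ h → γ h * (L h ⊡ M) i j)
  ⊡-∑ˡ {n = n} r γ L M i j = begin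
    ∑ᵣ n (λ l → ∑ᵣ r (λ h → γ h * L h i l) * M l j)    ≈⟨ ∑-cong n (λ l → ∑-*ʳ r (M l j) _) ⟩
    ∑ᵣ n (λ l → ∑ᵣ r (λ h → γ h * L h i l * M l j))    ≈⟨ ∑-swap n r _ ⟩
    ∑ᵣ r (λ h → ∑ᵣ n (λ l → γ h * L h i l * M l j))    ≈⟨ ∑-cong r (λ h → ∑-cong n (λ l → *-assoc (γ h) (L h i l) (M l j))) ⟩
    ∑ᵣ r (λ h → ∑ᵣ n (λ l → γ h * (L h i l * M l j)))  ≈⟨ ∑-cong r (λ h → ∑-*ˡ n (γ h) _) ⟨
    ∑ᵣ r (λ h → γ h * (L h ⊡ M) i j)                   ∎

-- Integer matrices: identity, trace and Frobenius product

module IntegerMatrices where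
  open import Data.Integer using (_+_; _*_; _-_; -_; +≤+)
  open import Relation.Binary.PropositionalEquality using (refl; sym; trans; cong; cong₂; subst; module ≡-Reasoning)
  open Matrices ℤ.+-*-commutativeRing

  Id-suc : ∀ n (i j : Fin n) → Id (ℕ.suc n) (suc i) (suc j) ≡ Id n i j
  Id-suc n i j with i Fin.≟ j
  ... | yes _ = refl
  ... | no _  = refl

  ∑-δ : ∀ n (i : Fin n) (f : Fin n → ℤ) → ∑ℤ n (λ l → Id n i l * f l) ≡ f i
  ∑-δ (ℕ.suc n) zero    f = trans (cong₂ _+_ (ℤ.*-identityˡ (f zero)) (∑-zero n (λ _ → refl))) (ℤ.+-identityʳ _)
  ∑-δ (ℕ.suc n) (suc i) f = trans (ℤ.+-identityˡ _)
    (trans (∑-cong n (λ l → cong (_* f (suc l)) (Id-suc n i l))) (∑-δ n i (λ l → f (suc l))))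

  identity-· : ∀ {n} {I : Mat ℤ n n} → (∀ y z → I y z ≡ Id n y z) → ∀ (M : Mat ℤ n n) y z → (I · M) y z ≡ M y z
  identity-· {n} I≡Id M y z = trans (∑-cong n (λ l → cong (_* M l z) (I≡Id y l))) (∑-δ n y (λ l → M l z))

  ∑-const : ∀ n x → ∑ℤ n (λ _ → x) ≡ + n * x
  ∑-const ℕ.zero    x = refl
  ∑-const (ℕ.suc n) x = trans (cong (_+_ x) (∑-const n x)) (sym (ℤ.suc-* (+ n) x))

  ∑-≥0 : ∀ n {f : Fin n → ℤ} → (∀ i → 0ℤ ℤ.≤ f i) → 0ℤ ℤ.≤ ∑ℤ n f
  ∑-≥0 ℕ.zero    0≤f = ℤ.≤-refl
  ∑-≥0 (ℕ.suc n) 0≤f = ℤ.+-mono-≤ (0≤f zero) (∑-≥0 n (λ i → 0≤f (suc i)))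

  ∑≡0⇒≡0 : ∀ n {f : Fin n → ℤ} → (∀ i → 0ℤ ℤ.≤ f i) → ∑ℤ n f ≡ 0ℤ → ∀ i → f i ≡ 0ℤ
  ∑≡0⇒≡0 (ℕ.suc n) {f} 0≤f eq = go
    where
    -- The tail is nonnegative, so `f zero` lies between 0 and the whole sum.
    f₀≡0 : f zero ≡ 0ℤ
    f₀≡0 = ℤ.≤-antisym
      (ℤ.≤-trans (ℤ.≤-reflexive (sym (ℤ.+-identityʳ _)))
        (ℤ.≤-trans (ℤ.+-monoʳ-≤ (f zero) (∑-≥0 n (λ i → 0≤f (suc i)))) (ℤ.≤-reflexive eq)))
      (0≤f zero)
    go : ∀ i → f i ≡ 0ℤ
    go zero    = f₀≡0
    go (suc i) = ∑≡0⇒≡0 n (λ i → 0≤f (suc i)) (trans (sym (ℤ.+-identityˡ _)) (trans (cong (_+ ∑ℤ n (λ i → f (suc i))) (sym f₀≡0)) eq)) i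

  square-≥0 : ∀ x → 0ℤ ℤ.≤ x * x
  square-≥0 (+ n)    = subst (0ℤ ℤ.≤_) (ℤ.pos-* n n) (+≤+ ℕ.z≤n)
  square-≥0 -[1+ n ] = +≤+ ℕ.z≤n

  x²≡0⇒x≡0 : ∀ x → x * x ≡ 0ℤ → x ≡ 0ℤ
  x²≡0⇒x≡0 x eq with ℤ.i*j≡0⇒i≡0∨j≡0 x eq
  ... | inj₁ p = p
  ... | inj₂ p = p

  trace : ∀ {n} → Mat ℤ n n → ℤ
  trace {n} M = ∑ℤ n (λ i → M i i)

  total : ∀ {n} → Mat ℤ n n → ℤ
  total {n} M = ∑ℤ n (λ i → ∑ℤ n (M i))

  -- The Frobenius inner product.
  ⟪_,_⟫ : ∀ {n} → Mat ℤ n n → Mat ℤ n n → ℤ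
  ⟪ M , L ⟫ = total (λ i j → M i j * L i j)

  total-cong : ∀ {n} {M L : Mat ℤ n n} → (∀ i j → M i j ≡ L i j) → total M ≡ total L
  total-cong eq = ∑-cong _ (λ i → ∑-cong _ (eq i))

  total-lin : ∀ {n} x y (M L : Mat ℤ n n) → total (λ i j → x * M i j + y * L i j) ≡ x * total M + y * total L
  total-lin {n} x y M L = trans (∑-cong n (λ i → ∑-lin n x y (M i) (L i))) (∑-lin n x y _ _)

  trace-· : ∀ {n} (M L : Mat ℤ n n) → trace (M · L) ≡ trace (L · M)
  trace-· {n} M L = trans (∑-swap n n _) (∑-cong n (λ i → ∑-cong n (λ j → ℤ.*-comm (M j i) (L i j))))

  ⟪⟫≡trace : ∀ {n} (M L : Mat ℤ n n) → (∀ i j → L i j ≡ L j i) → ⟪ M , L ⟫ ≡ trace (M · L)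
  ⟪⟫≡trace M L L-sym = total-cong (λ i j → cong (M i j *_) (L-sym i j))

  -- Pairing with I reads off the trace and pairing with J the sum of all entries. Hence a matrix of
  -- the form aI + bJ, such as a Gram matrix of a design, sees nothing else of `M`.
  ⟪⟫-aI+bJ : ∀ {n} (M : Mat ℤ n n) a b → ⟪ M , (λ i j → a * Id n i j + b) ⟫ ≡ a * trace M + b * total M
  ⟪⟫-aI+bJ {n} M a b = begin
    total (λ i j → M i j * (a * Id n i j + b))         ≡⟨ total-cong (λ i j → step (M i j) a (Id n i j) b) ⟩
    total (λ i j → a * (Id n i j * M i j) + b * M i j) ≡⟨ total-lin a b _ M ⟩
    a * total (λ i j → Id n i j * M i j) + b * total M ≡⟨ cong (λ t → a * t + b * total M) (∑-cong n (λ i → ∑-δ n i (M i))) ⟩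
    a * trace M + b * total M                          ∎
    where
    open ≡-Reasoning
    step : ∀ m a d b → m * (a * d + b) ≡ a * (d * m) + b * m
    step = solve-∀

  -- NᵀN and NNᵀ have the same trace and the same Frobenius norm, so in
  -- ‖NᵀN − NNᵀ‖² = ‖NᵀN‖² − 2⟪NᵀN, NNᵀ⟫ + ‖NNᵀ‖² everything cancels.
  gram-transpose : ∀ {n} (N : Mat ℤ n n) a b →
    (∀ i j → (N · (N ᵀ)) i j ≡ a * Id n i j + b) →
    b * total ((N ᵀ) · N) ≡ b * total (N · (N ᵀ)) →
    ∀ i j → ((N ᵀ) · N) i j ≡ a * Id n i j + b
  gram-transpose {n} N a b NNᵀ≡ total≡ i j = trans (ℤ.i-j≡0⇒i≡j _ _ (x²≡0⇒x≡0 _ D²≡0)) (NNᵀ≡ i j)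
    where
    open ≡-Reasoning
    G H D² : Mat ℤ n n
    G = (N ᵀ) · N
    H = N · (N ᵀ)
    D² i j = (G i j - H i j) * (G i j - H i j)

    G-sym : ∀ i j → G i j ≡ G j i
    G-sym = ⊡-ᵀ (N ᵀ) N
    H-sym : ∀ i j → H i j ≡ H j i
    H-sym = ⊡-ᵀ N (N ᵀ)

    -- (NᵀN)(NᵀN) becomes (NNᵀ)(NNᵀ) when the first factor Nᵀ moves to the end, which the trace does
    -- not notice.
    ⟪G,G⟫≡⟪H,H⟫ : ⟪ G , G ⟫ ≡ ⟪ H , H ⟫
    ⟪G,G⟫≡⟪H,H⟫ = begin
      ⟪ G , G ⟫                 ≡⟨ ⟪⟫≡trace G G G-sym ⟩
      trace (G · G)             ≡⟨ ∑-cong n (λ i → ⊡-assoc (N ᵀ) N G i i) ⟩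
      trace ((N ᵀ) · (N · G))   ≡⟨ trace-· (N ᵀ) (N · G) ⟩
      trace ((N · G) · (N ᵀ))   ≡⟨ ∑-cong n (λ i → ⊡-congʳ (N ᵀ) (λ i j → sym (⊡-assoc N (N ᵀ) N i j)) i i) ⟩
      trace ((H · N) · (N ᵀ))   ≡⟨ ∑-cong n (λ i → ⊡-assoc H N (N ᵀ) i i) ⟩
      trace (H · H)             ≡⟨ ⟪⟫≡trace H H H-sym ⟨
      ⟪ H , H ⟫                 ∎

    ⟪,H⟫ : ∀ M → ⟪ M , H ⟫ ≡ a * trace M + b * total M
    ⟪,H⟫ M = trans (total-cong (λ i j → cong (M i j *_) (NNᵀ≡ i j))) (⟪⟫-aI+bJ M a b)

    -- As `H` is aI + bJ, only the traces and the totals of `G` and `H` have to be compared: the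
    -- former agree by cyclicity, the latter, multiplied by `b`, by hypothesis.
    ⟪G,H⟫≡⟪H,H⟫ : ⟪ G , H ⟫ ≡ ⟪ H , H ⟫
    ⟪G,H⟫≡⟪H,H⟫ = begin
      ⟪ G , H ⟫                   ≡⟨ ⟪,H⟫ G ⟩
      a * trace G + b * total G   ≡⟨ cong₂ _+_ (cong (a *_) (trace-· (N ᵀ) N)) total≡ ⟩
      a * trace H + b * total H   ≡⟨ ⟪,H⟫ H ⟨
      ⟪ H , H ⟫                   ∎

    expand : ∀ g h → (g - h) * (g - h) ≡ 1ℤ * (1ℤ * (g * g) + - (+ 2) * (g * h)) + 1ℤ * (h * h)
    expand = solve-∀
    cancel : ∀ x → 1ℤ * (1ℤ * x + - (+ 2) * x) + 1ℤ * x ≡ 0ℤ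
    cancel = solve-∀

    total-D² : total D² ≡ 0ℤ
    total-D² = begin
      total D²
        ≡⟨ total-cong (λ i j → expand (G i j) (H i j)) ⟩
      total (λ i j → 1ℤ * (1ℤ * (G i j * G i j) + - (+ 2) * (G i j * H i j)) + 1ℤ * (H i j * H i j))
        ≡⟨ total-lin 1ℤ 1ℤ (λ i j → 1ℤ * (G i j * G i j) + - (+ 2) * (G i j * H i j)) (λ i j → H i j * H i j) ⟩
      1ℤ * total (λ i j → 1ℤ * (G i j * G i j) + - (+ 2) * (G i j * H i j)) + 1ℤ * ⟪ H , H ⟫
        ≡⟨ cong (λ t → 1ℤ * t + 1ℤ * ⟪ H , H ⟫) (total-lin 1ℤ (- (+ 2)) (λ i j → G i j * G i j) (λ i j → G i j * H i j)) ⟩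
      1ℤ * (1ℤ * ⟪ G , G ⟫ + - (+ 2) * ⟪ G , H ⟫) + 1ℤ * ⟪ H , H ⟫
        ≡⟨ cong₂ (λ s t → 1ℤ * (1ℤ * s + - (+ 2) * t) + 1ℤ * ⟪ H , H ⟫) ⟪G,G⟫≡⟪H,H⟫ ⟪G,H⟫≡⟪H,H⟫ ⟩
      1ℤ * (1ℤ * ⟪ H , H ⟫ + - (+ 2) * ⟪ H , H ⟫) + 1ℤ * ⟪ H , H ⟫
        ≡⟨ cancel ⟪ H , H ⟫ ⟩
      0ℤ ∎

    D²≡0 : D² i j ≡ 0ℤ
    D²≡0 = ∑≡0⇒≡0 n (λ j → square-≥0 (G i j - H i j))
      (∑≡0⇒≡0 n (λ i → ∑-≥0 n (λ j → square-≥0 (G i j - H i j))) total-D² i) j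

  -- With the sums over i and j innermost, each l contributes the square of its row sum. Applied to
  -- N and to Nᵀ, this supplies the equality of totals that `gram-transpose` asks for.
  total-NᵀN : ∀ {n} (N : Mat ℤ n n) k → (∀ i → ∑ℤ n (N i) ≡ k) → total ((N ᵀ) · N) ≡ + n * (k * k)
  total-NᵀN {n} N k rows = begin
    ∑ℤ n (λ i → ∑ℤ n (λ j → ∑ℤ n (λ l → N l i * N l j))) ≡⟨ ∑-cong n (λ i → ∑-swap n n _) ⟩
    ∑ℤ n (λ i → ∑ℤ n (λ l → ∑ℤ n (λ j → N l i * N l j))) ≡⟨ ∑-swap n n _ ⟩
    ∑ℤ n (λ l → ∑ℤ n (λ i → ∑ℤ n (λ j → N l i * N l j))) ≡⟨ ∑-cong n (λ l → ∑-cong n (λ i → ∑-*ˡ n (N l i) (N l))) ⟨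
    ∑ℤ n (λ l → ∑ℤ n (λ i → N l i * ∑ℤ n (N l)))         ≡⟨ ∑-cong n (λ l → ∑-*ʳ n (∑ℤ n (N l)) (N l)) ⟨
    ∑ℤ n (λ l → ∑ℤ n (N l) * ∑ℤ n (N l))                 ≡⟨ ∑-cong n (λ l → cong₂ _*_ (rows l) (rows l)) ⟩
    ∑ℤ n (λ l → k * k)                                   ≡⟨ ∑-const n (k * k) ⟩
    + n * (k * k)                                        ∎
    where open ≡-Reasoning

  -- Signed matrices and their Gram relations

  IsSign : ℤ → Set
  IsSign w = w ≡ 0ℤ ⊎ w ≡ 1ℤ ⊎ w ≡ - 1ℤ

  indicator : Bool → ℤ
  indicator b = if b then 1ℤ else 0ℤ

  -- The entrywise form of the splitting of W: `pos (W i j)` unfolds to `W₁ W i j` and `neg (W i j)`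
  -- to `W₂ W i j`.
  pos neg : ℤ → ℤ
  pos w = indicator ⌊ w ℤ.≟ 1ℤ ⌋
  neg w = indicator ⌊ w ℤ.≟ - 1ℤ ⌋

  count≡∑ : ∀ n P → + count n P ≡ ∑ℤ n (λ l → indicator (P l))
  count≡∑ ℕ.zero    P = refl
  count≡∑ (ℕ.suc n) P with P zero
  ... | true  = cong (_+_ 1ℤ) (count≡∑ n (λ l → P (suc l)))
  ... | false = cong (_+_ 0ℤ) (count≡∑ n (λ l → P (suc l)))

  pos+neg : ∀ {w} → IsSign w → pos w + neg w ≡ indicator (not ⌊ w ℤ.≟ 0ℤ ⌋)
  pos+neg (inj₁ refl)        = refl
  pos+neg (inj₂ (inj₁ refl)) = refl
  pos+neg (inj₂ (inj₂ refl)) = refl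

  pos-neg : ∀ {w} → IsSign w → w ≡ pos w - neg w
  pos-neg (inj₁ refl)        = refl
  pos-neg (inj₂ (inj₁ refl)) = refl
  pos-neg (inj₂ (inj₂ refl)) = refl

  square-sign : ∀ {w} → IsSign w → w * w ≡ pos w + neg w
  square-sign (inj₁ refl)        = refl
  square-sign (inj₂ (inj₁ refl)) = refl
  square-sign (inj₂ (inj₂ refl)) = refl

  square-abs : ∀ {w} → IsSign w → (pos w + neg w) * (pos w + neg w) ≡ pos w + neg w
  square-abs (inj₁ refl)        = refl
  square-abs (inj₂ (inj₁ refl)) = refl
  square-abs (inj₂ (inj₂ refl)) = refl

  -- A product of two signs is 1 or -1 exactly when both factors are nonzero. This turns the two
  -- counts of the balance condition into an entry of NNᵀ.
  abs-product : ∀ {w u} → IsSign w → IsSign u →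
    (pos w + neg w) * (pos u + neg u) ≡ indicator ⌊ w * u ℤ.≟ 1ℤ ⌋ + indicator ⌊ w * u ℤ.≟ - 1ℤ ⌋
  abs-product (inj₁ refl)        (inj₁ refl)        = refl
  abs-product (inj₁ refl)        (inj₂ (inj₁ refl)) = refl
  abs-product (inj₁ refl)        (inj₂ (inj₂ refl)) = refl
  abs-product (inj₂ (inj₁ refl)) (inj₁ refl)        = refl
  abs-product (inj₂ (inj₁ refl)) (inj₂ (inj₁ refl)) = refl
  abs-product (inj₂ (inj₁ refl)) (inj₂ (inj₂ refl)) = refl
  abs-product (inj₂ (inj₂ refl)) (inj₁ refl)        = refl
  abs-product (inj₂ (inj₂ refl)) (inj₂ (inj₁ refl)) = refl
  abs-product (inj₂ (inj₂ refl)) (inj₂ (inj₂ refl)) = refl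

  Id-diag : ∀ n (i : Fin n) → Id n i i ≡ 1ℤ
  Id-diag n i with i Fin.≟ i
  ... | yes _  = refl
  ... | no i≢i = ⊥-elim (i≢i refl)

  Id-off : ∀ n {i j : Fin n} → i ≢ j → Id n i j ≡ 0ℤ
  Id-off n {i} {j} i≢j with i Fin.≟ j
  ... | yes i≡j = ⊥-elim (i≢j i≡j)
  ... | no _    = refl

  Id-sym : ∀ n (i j : Fin n) → Id n i j ≡ Id n j i
  Id-sym n i j with i Fin.≟ j | j Fin.≟ i
  ... | yes _   | yes _   = refl
  ... | no _    | no _    = refl
  ... | yes i≡j | no j≢i  = ⊥-elim (j≢i (sym i≡j))
  ... | no i≢j  | yes j≡i = ⊥-elim (i≢j (sym j≡i))

  -- The support of `V`, that is, the incidence matrix N of the design.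
  ∣_∣ₘ : ∀ {v} → Mat ℤ v v → Mat ℤ v v
  ∣ V ∣ₘ i j = pos (V i j) + neg (V i j)

  -- The balance conditions in a form that is stable under transposition, with λ = 2μ. The relation
  -- for `V` is written with a summand `0ℤ` so that both Gram matrices have the shape aI + bJ of
  -- `gram-transpose`.
  record SignedGram {v : ℕ} (k μ : ℤ) (V : Mat ℤ v v) : Set where
    field
      entries : ∀ i j → IsSign (V i j)
      rowSum  : ∀ i → ∑ℤ v (∣ V ∣ₘ i) ≡ k
      gram    : ∀ i j → (V · (V ᵀ)) i j ≡ k * Id v i j + 0ℤ
      absGram : ∀ i j → (∣ V ∣ₘ · (∣ V ∣ₘ ᵀ)) i j ≡ (k - + 2 * μ) * Id v i j + + 2 * μ

    private
      X Y : Mat ℤ v v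
      X i j = pos (V i j)
      Y i j = neg (V i j)

      -- Polarisation: (x + y)(x′ + y′) + (x - y)(x′ - y′) = 2(xx′ + yy′), where x + y is an entry
      -- of N and x - y one of V. The common factor 2 is cancelled afterwards, so everything stays
      -- in ℤ.
      2XX+YY : ∀ i j → + 2 * ((X · (X ᵀ)) i j + (Y · (Y ᵀ)) i j) ≡ + 2 * ((k - μ) * Id v i j + μ)
      2XX+YY i j = begin
        + 2 * ((X · (X ᵀ)) i j + (Y · (Y ᵀ)) i j)
          ≡⟨ cong (+ 2 *_) (sym (∑-+ v (λ l → X i l * X j l) (λ l → Y i l * Y j l))) ⟩
        + 2 * ∑ℤ v (λ l → X i l * X j l + Y i l * Y j l)
          ≡⟨ ∑-*ˡ v (+ 2) (λ l → X i l * X j l + Y i l * Y j l) ⟩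
        ∑ℤ v (λ l → + 2 * (X i l * X j l + Y i l * Y j l))
          ≡⟨ ∑-cong v (λ l → trans (polarise (X i l) (Y i l) (X j l) (Y j l))
               (cong₂ (λ a b → ∣ V ∣ₘ i l * ∣ V ∣ₘ j l + a * b) (sym (pos-neg (entries i l))) (sym (pos-neg (entries j l))))) ⟩
        ∑ℤ v (λ l → ∣ V ∣ₘ i l * ∣ V ∣ₘ j l + V i l * V j l)
          ≡⟨ ∑-+ v (λ l → ∣ V ∣ₘ i l * ∣ V ∣ₘ j l) (λ l → V i l * V j l) ⟩
        (∣ V ∣ₘ · (∣ V ∣ₘ ᵀ)) i j + (V · (V ᵀ)) i j
          ≡⟨ cong₂ _+_ (absGram i j) (gram i j) ⟩
        (k - + 2 * μ) * Id v i j + + 2 * μ + (k * Id v i j + 0ℤ)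
          ≡⟨ arrange k μ (Id v i j) ⟩
        + 2 * ((k - μ) * Id v i j + μ) ∎
        where
        open ≡-Reasoning
        polarise : ∀ x y x′ y′ → + 2 * (x * x′ + y * y′) ≡ (x + y) * (x′ + y′) + (x - y) * (x′ - y′)
        polarise = solve-∀
        arrange : ∀ k μ d → (k - + 2 * μ) * d + + 2 * μ + (k * d + 0ℤ) ≡ + 2 * ((k - μ) * d + μ)
        arrange = solve-∀

    sameSigns : ∀ i j → (X · (X ᵀ)) i j + (Y · (Y ᵀ)) i j ≡ (k - μ) * Id v i j + μ
    sameSigns i j = ℤ.*-cancelˡ-≡ (+ 2) _ _ (2XX+YY i j)

    -- `absGram` counts the positions with equal and with opposite signs together; taking away
    -- `sameSigns` leaves the latter.
    oppositeSigns : ∀ i j → (X · (Y ᵀ)) i j + (Y · (X ᵀ)) i j ≡ - μ * Id v i j + μ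
    oppositeSigns i j = GroupProperties.∙-cancelˡ (CommutativeRing.+-group ℤ.+-*-commutativeRing) ((X · (X ᵀ)) i j + (Y · (Y ᵀ)) i j) _ _ (begin
      (X · (X ᵀ)) i j + (Y · (Y ᵀ)) i j + ((X · (Y ᵀ)) i j + (Y · (X ᵀ)) i j)
        ≡⟨ cong₂ _+_ (∑-+ v (λ l → X i l * X j l) (λ l → Y i l * Y j l)) (∑-+ v (λ l → X i l * Y j l) (λ l → Y i l * X j l)) ⟨
      ∑ℤ v (λ l → X i l * X j l + Y i l * Y j l) + ∑ℤ v (λ l → X i l * Y j l + Y i l * X j l)
        ≡⟨ ∑-+ v (λ l → X i l * X j l + Y i l * Y j l) (λ l → X i l * Y j l + Y i l * X j l) ⟨
      ∑ℤ v (λ l → X i l * X j l + Y i l * Y j l + (X i l * Y j l + Y i l * X j l))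
        ≡⟨ ∑-cong v (λ l → factor (X i l) (Y i l) (X j l) (Y j l)) ⟩
      (∣ V ∣ₘ · (∣ V ∣ₘ ᵀ)) i j
        ≡⟨ absGram i j ⟩
      (k - + 2 * μ) * Id v i j + + 2 * μ
        ≡⟨ arrange k μ (Id v i j) ⟩
      (k - μ) * Id v i j + μ + (- μ * Id v i j + μ)
        ≡⟨ cong (_+ (- μ * Id v i j + μ)) (sameSigns i j) ⟨
      (X · (X ᵀ)) i j + (Y · (Y ᵀ)) i j + (- μ * Id v i j + μ) ∎)
      where
      open ≡-Reasoning
      factor : ∀ x y x′ y′ → x * x′ + y * y′ + (x * y′ + y * x′) ≡ (x + y) * (x′ + y′)
      factor = solve-∀
      arrange : ∀ k μ d → (k - + 2 * μ) * d + + 2 * μ ≡ (k - μ) * d + μ + (- μ * d + μ)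
      arrange = solve-∀

  -- The order is forced. The relation for V passes over first; the diagonal of VᵀV, a sum of
  -- squares of signs, then counts the nonzero entries of each column; and these column sums give
  -- the equality of totals under which the relation for the support passes over as well.
  transpose : ∀ {v k μ} {V : Mat ℤ v v} → SignedGram k μ V → SignedGram k μ (V ᵀ)
  transpose {v} {k} {μ} {V} G = record
    { entries = λ i j → entries j i
    ; rowSum  = colSum
    ; gram    = gramᵀ
    ; absGram = gram-transpose ∣ V ∣ₘ (k - + 2 * μ) (+ 2 * μ) absGram
                  (cong (+ 2 * μ *_) (trans (total-NᵀN ∣ V ∣ₘ k rowSum) (sym (total-NᵀN (∣ V ∣ₘ ᵀ) k colSum))))
    }
    where
    open SignedGram G
    open ≡-Reasoning
    gramᵀ : ∀ i j → ((V ᵀ) · V) i j ≡ k * Id v i j + 0ℤ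
    -- For b = 0 the condition on the totals reads 0 = 0.
    gramᵀ = gram-transpose V k 0ℤ gram refl
    colSum : ∀ j → ∑ℤ v (λ i → ∣ V ∣ₘ i j) ≡ k
    colSum j = begin
      ∑ℤ v (λ i → ∣ V ∣ₘ i j)     ≡⟨ ∑-cong v (λ i → square-sign (entries i j)) ⟨
      ∑ℤ v (λ i → V i j * V i j)  ≡⟨ gramᵀ j j ⟩
      k * Id v j j + 0ℤ           ≡⟨ cong (λ d → k * d + 0ℤ) (Id-diag v j) ⟩
      k * 1ℤ + 0ℤ                 ≡⟨ ℤ.+-identityʳ _ ⟩
      k * 1ℤ                      ≡⟨ ℤ.*-identityʳ k ⟩
      k                           ∎

  -- Row i of NNᵀ is summed in two ways: through the row and column sums of N, and through (k - λ)I
  -- + λJ. This is the design identity k(k - 1) = λ(v - 1).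
  k²-relation : ∀ {v k μ} {V : Mat ℤ v v} → SignedGram k μ V → Fin v → k * k ≡ (k - + 2 * μ) + + v * (+ 2 * μ)
  k²-relation {v} {k} {μ} {V} G i = begin
    k * k
      ≡⟨ cong (_* k) (rowSum i) ⟨
    ∑ℤ v (N i) * k
      ≡⟨ ∑-*ʳ v k (N i) ⟩
    ∑ℤ v (λ l → N i l * k)
      ≡⟨ ∑-cong v (λ l → cong (N i l *_) (SignedGram.rowSum (transpose G) l)) ⟨
    ∑ℤ v (λ l → N i l * ∑ℤ v (λ j → N j l))
      ≡⟨ ∑-cong v (λ l → ∑-*ˡ v (N i l) (λ j → N j l)) ⟩
    ∑ℤ v (λ l → ∑ℤ v (λ j → N i l * N j l))
      ≡⟨ ∑-swap v v _ ⟩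
    ∑ℤ v (λ j → (N · (N ᵀ)) i j)
      ≡⟨ ∑-cong v (λ j → trans (absGram i j) (cong₂ _+_ (ℤ.*-comm (k - + 2 * μ) (Id v i j)) refl)) ⟩
    ∑ℤ v (λ j → Id v i j * (k - + 2 * μ) + + 2 * μ)
      ≡⟨ ∑-+ v (λ j → Id v i j * (k - + 2 * μ)) (λ _ → + 2 * μ) ⟩
    ∑ℤ v (λ j → Id v i j * (k - + 2 * μ)) + ∑ℤ v (λ _ → + 2 * μ)
      ≡⟨ cong₂ _+_ (∑-δ v i (λ _ → k - + 2 * μ)) (∑-const v (+ 2 * μ)) ⟩
    (k - + 2 * μ) + + v * (+ 2 * μ) ∎
    where
    open SignedGram G
    open ≡-Reasoning
    N = ∣ V ∣ₘ

  balanced⇒signedGram : ∀ {v k lam W} → 1 ℕ.< v → IsBalancedWeighing v k lam W → Σ ℤ (λ μ → SignedGram (+ k) μ W)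
  balanced⇒signedGram {ℕ.suc ℕ.zero}    (ℕ.s≤s ())
  balanced⇒signedGram {ℕ.suc (ℕ.suc n)} {k} {lam} {W} _ B = + μ , record
    { entries = entries
    ; rowSum  = rowSum
    ; gram    = λ i j → trans (orthogonal i j) (sym (ℤ.+-identityʳ _))
    ; absGram = absGram
    }
    where
    open IsBalancedWeighing B
    open ≡-Reasoning
    v = ℕ.suc (ℕ.suc n)
    P⁺ P⁻ : Fin v → Fin v → Fin v → Bool
    P⁺ i j l = ⌊ W i l * W j l ℤ.≟ 1ℤ ⌋
    P⁻ i j l = ⌊ W i l * W j l ℤ.≟ - 1ℤ ⌋
    -- λ/2 is taken to be the count for the first two rows, which exist because 1 < v; cancelling
    -- the factor 2 then transfers it to every other pair of rows.
    μ = count v (P⁺ zero (suc zero))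
    lam≡ : μ ℕ.* 2 ≡ lam
    lam≡ = balancedPlus zero (suc zero) (λ ())
    count⁺ : ∀ i j → i ≢ j → count v (P⁺ i j) ≡ μ
    count⁺ i j i≢j = ℕ.*-cancelʳ-≡ _ _ 2 (trans (balancedPlus i j i≢j) (sym lam≡))
    count⁻ : ∀ i j → i ≢ j → count v (P⁻ i j) ≡ μ
    count⁻ i j i≢j = ℕ.*-cancelʳ-≡ _ _ 2 (trans (balancedMinus i j i≢j) (sym lam≡))

    rowSum : ∀ i → ∑ℤ v (∣ W ∣ₘ i) ≡ + k
    rowSum i = begin
      ∑ℤ v (∣ W ∣ₘ i)                                   ≡⟨ ∑-cong v (λ l → pos+neg (entries i l)) ⟩
      ∑ℤ v (λ l → indicator (not ⌊ W i l ℤ.≟ 0ℤ ⌋))     ≡⟨ count≡∑ v (λ l → not ⌊ W i l ℤ.≟ 0ℤ ⌋) ⟨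
      + count v (λ l → not ⌊ W i l ℤ.≟ 0ℤ ⌋)            ≡⟨ cong +_ (rowWeight i) ⟩
      + k                                               ∎

    diagonal : ∀ k m → k ≡ (k - + 2 * m) * 1ℤ + + 2 * m
    diagonal = solve-∀
    off-diagonal : ∀ k m → m + m ≡ (k - + 2 * m) * 0ℤ + + 2 * m
    off-diagonal = solve-∀

    absGram : ∀ i j → (∣ W ∣ₘ · (∣ W ∣ₘ ᵀ)) i j ≡ (+ k - + 2 * + μ) * Id v i j + + 2 * + μ
    absGram i j with i Fin.≟ j
    ... | yes refl = trans (∑-cong v (λ l → square-abs (entries i l))) (trans (rowSum i) (diagonal (+ k) (+ μ)))
    ... | no i≢j = begin
      (∣ W ∣ₘ · (∣ W ∣ₘ ᵀ)) i j
        ≡⟨ ∑-cong v (λ l → abs-product (entries i l) (entries j l)) ⟩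
      ∑ℤ v (λ l → indicator (P⁺ i j l) + indicator (P⁻ i j l))
        ≡⟨ ∑-+ v (λ l → indicator (P⁺ i j l)) (λ l → indicator (P⁻ i j l)) ⟩
      ∑ℤ v (λ l → indicator (P⁺ i j l)) + ∑ℤ v (λ l → indicator (P⁻ i j l))
        ≡⟨ cong₂ _+_ (count≡∑ v (P⁺ i j)) (count≡∑ v (P⁻ i j)) ⟨
      + count v (P⁺ i j) + + count v (P⁻ i j)
        ≡⟨ cong₂ (λ a b → + a + + b) (count⁺ i j i≢j) (count⁻ i j i≢j) ⟩
      + μ + + μ
        ≡⟨ off-diagonal (+ k) (+ μ) ⟩
      (+ k - + 2 * + μ) * 0ℤ + + 2 * + μ ∎

  -- Indices of Kronecker products and block matrices

  ∑-split : ∀ m n (f : Fin (m ℕ.+ n) → ℤ) → ∑ℤ (m ℕ.+ n) f ≡ ∑ℤ m (λ i → f (i ↑ˡ n)) + ∑ℤ n (λ j → f (m ↑ʳ j))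
  ∑-split ℕ.zero    n f = sym (ℤ.+-identityˡ _)
  ∑-split (ℕ.suc m) n f = trans (cong (_+_ (f zero)) (∑-split m n (λ i → f (suc i)))) (sym (ℤ.+-assoc (f zero) _ _))

  ∑-combine : ∀ m n (f : Fin (m ℕ.* n) → ℤ) → ∑ℤ (m ℕ.* n) f ≡ ∑ℤ m (λ i → ∑ℤ n (λ j → f (combine i j)))
  ∑-combine ℕ.zero    n f = refl
  ∑-combine (ℕ.suc m) n f = trans (∑-split n (m ℕ.* n) f) (cong (_+_ (∑ℤ n (λ j → f (j ↑ˡ (m ℕ.* n))))) (∑-combine m n (λ i → f (n ↑ʳ i))))

  -- `remQuot` unfolds to `quotRem` followed by `swap`, and `rewrite` meets it in this form in the
  -- goals about `kron` and `block`.
  quotRem-combine : ∀ {m n} (i : Fin m) (j : Fin n) → quotRem n (combine i j) ≡ (j , i)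
  quotRem-combine i j = cong swap (Fin.remQuot-combine i j)

  kron-combine : ∀ {m n p q} (M : Mat ℤ m n) (N : Mat ℤ p q) i i′ j j′ →
                 (M ⊗ N) (combine i i′) (combine j j′) ≡ M i j * N i′ j′
  kron-combine {m} {n} {p} {q} M N i i′ j j′
    rewrite quotRem-combine {m} {p} i i′ | quotRem-combine {n} {q} j j′ = refl

  block-combine : ∀ {n} (B : Fin 2 → Fin 2 → Mat ℤ n n) b c i j →
                  block (B 0F 0F) (B 0F 1F) (B 1F 0F) (B 1F 1F) (combine b i) (combine c j) ≡ B b c i j
  block-combine {n} B 0F 0F i j rewrite quotRem-combine {2} {n} 0F i | quotRem-combine {2} {n} 0F j = refl
  block-combine {n} B 0F 1F i j rewrite quotRem-combine {2} {n} 0F i | quotRem-combine {2} {n} 1F j = refl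
  block-combine {n} B 1F 0F i j rewrite quotRem-combine {2} {n} 1F i | quotRem-combine {2} {n} 0F j = refl
  block-combine {n} B 1F 1F i j rewrite quotRem-combine {2} {n} 1F i | quotRem-combine {2} {n} 1F j = refl

  -- Entries of the six matrices

  -- Unsimplified products such as `1ℤ * (1ℤ - δ)` keep the shape of the Kronecker products, so that
  -- `kron-combine` already is the proof of the entry formula. The same holds for `otherHalf`.
  sameHalf : Fin 6 → Fin 2 → Fin 2 → ℤ → ℤ
  sameHalf 0F s t δ = Id 2 s t * δ
  sameHalf 1F s t δ = S s t * δ
  sameHalf 2F s t δ = 1ℤ * (1ℤ - δ)
  sameHalf 3F s t δ = 0ℤ
  sameHalf 4F s t δ = 0ℤ
  sameHalf 5F s t δ = 0ℤ

  otherHalf : Fin 6 → Fin 2 → Fin 2 → ℤ → ℤ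
  otherHalf 0F s t w = 0ℤ
  otherHalf 1F s t w = 0ℤ
  otherHalf 2F s t w = 0ℤ
  otherHalf 3F s t w = Id 2 s t * pos w + S s t * neg w
  otherHalf 4F s t w = Id 2 s t * neg w + S s t * pos w
  otherHalf 5F s t w = 1ℤ * (1ℤ - pos w - neg w)

  -- The positions x and y inside the blocks enter only through δ, an entry of the identity, and w,
  -- an entry of W or Wᵀ. As δ has two possible values and w has three, pointwise statements about
  -- the scheme are finite checks.
  entry : Fin 6 → (b c s t : Fin 2) → ℤ → ℤ → ℤ
  entry i 0F 0F s t δ w = sameHalf i s t δ
  entry i 0F 1F s t δ w = otherHalf i s t w
  entry i 1F 0F s t δ w = otherHalf i s t w
  entry i 1F 1F s t δ w = sameHalf i s t δ

  module Entries {v : ℕ} (W : Mat ℤ v v) where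

    N : ℕ
    N = 2 ℕ.* (2 ℕ.* v)

    A : Fin 6 → Mat ℤ N N
    A = schemeA v W

    -- The b-th half consists of the v points (b = 0) or the v blocks (b = 1) of
    -- the design, each of them doubled by s.
    vertex : Fin 2 → Fin 2 → Fin v → Fin N
    vertex b s x = combine {2} b (combine {2} s x)

    ∀-vertex : ∀ {p} {P : Fin N → Set p} → (∀ b s x → P (vertex b s x)) → ∀ z → P z
    ∀-vertex {P = P} h z = subst P
      (trans (cong (combine {2} b) (Fin.combine-remQuot {2} v z′)) (Fin.combine-remQuot {2} (2 ℕ.* v) z))
      (h b (proj₁ (remQuot {2} v z′)) (proj₂ (remQuot {2} v z′)))
      where
      b  = proj₁ (remQuot {2} (2 ℕ.* v) z)
      z′ = proj₂ (remQuot {2} (2 ℕ.* v) z)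

    ∑-vertex : ∀ f → ∑ℤ N f ≡ ∑ℤ 2 (λ b → ∑ℤ 2 (λ s → ∑ℤ v (λ x → f (vertex b s x))))
    ∑-vertex f = trans (∑-combine 2 (2 ℕ.* v) f) (∑-cong 2 (λ b → ∑-combine 2 v (λ z → f (combine {2} b z))))

    -- Reading W from the half of the row index gives both off-diagonal blocks the same formula.
    orient : Fin 2 → Mat ℤ v v
    orient 0F = W
    orient 1F = W ᵀ

    private
      I₂ J₂ : Mat ℤ 2 2
      I₂ = Id 2
      J₂ = Jm 2 2
      X Y : Fin 2 → Mat ℤ v v
      X b i j = pos (orient b i j)
      Y b i j = neg (orient b i j)
      J-X-Y : Fin 2 → Mat ℤ v v
      J-X-Y b = (Jm v v ⊖ X b) ⊖ Y b

    sameBlock otherBlock : Fin 6 → Fin 2 → Mat ℤ (2 ℕ.* v) (2 ℕ.* v)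
    sameBlock 0F b = I₂ ⊗ Id v
    sameBlock 1F b = S ⊗ Id v
    sameBlock 2F b = J₂ ⊗ (Jm v v ⊖ Id v)
    sameBlock 3F b = Zero _ _
    sameBlock 4F b = Zero _ _
    sameBlock 5F b = Zero _ _
    otherBlock 0F b = Zero _ _
    otherBlock 1F b = Zero _ _
    otherBlock 2F b = Zero _ _
    otherBlock 3F b = (I₂ ⊗ X b) ⊕ (S ⊗ Y b)
    otherBlock 4F b = (I₂ ⊗ Y b) ⊕ (S ⊗ X b)
    otherBlock 5F b = J₂ ⊗ J-X-Y b

    blocks : Fin 6 → Fin 2 → Fin 2 → Mat ℤ (2 ℕ.* v) (2 ℕ.* v)
    blocks i 0F 0F = sameBlock i 0F
    blocks i 0F 1F = otherBlock i 0F
    blocks i 1F 0F = otherBlock i 1F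
    blocks i 1F 1F = sameBlock i 1F

    A≡block : ∀ i y z → A i y z ≡ block (blocks i 0F 0F) (blocks i 0F 1F) (blocks i 1F 0F) (blocks i 1F 1F) y z
    A≡block 0F y z = refl
    A≡block 1F y z = refl
    A≡block 2F y z = refl
    A≡block 3F y z = refl
    A≡block 4F y z = refl
    A≡block 5F y z = refl

    sameBlock-entry : ∀ i b s t x y → sameBlock i b (combine s x) (combine t y) ≡ sameHalf i s t (Id v x y)
    sameBlock-entry 0F b s t x y = kron-combine I₂ (Id v) s x t y
    sameBlock-entry 1F b s t x y = kron-combine S (Id v) s x t y
    sameBlock-entry 2F b s t x y = kron-combine J₂ (Jm v v ⊖ Id v) s x t y
    sameBlock-entry 3F b s t x y = refl
    sameBlock-entry 4F b s t x y = refl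
    sameBlock-entry 5F b s t x y = refl

    otherBlock-entry : ∀ i b s t x y → otherBlock i b (combine s x) (combine t y) ≡ otherHalf i s t (orient b x y)
    otherBlock-entry 0F b s t x y = refl
    otherBlock-entry 1F b s t x y = refl
    otherBlock-entry 2F b s t x y = refl
    otherBlock-entry 3F b s t x y = cong₂ _+_ (kron-combine I₂ (X b) s x t y) (kron-combine S (Y b) s x t y)
    otherBlock-entry 4F b s t x y = cong₂ _+_ (kron-combine I₂ (Y b) s x t y) (kron-combine S (X b) s x t y)
    otherBlock-entry 5F b s t x y = kron-combine J₂ (J-X-Y b) s x t y

    blocks-entry : ∀ i b c s t x y → blocks i b c (combine s x) (combine t y) ≡ entry i b c s t (Id v x y) (orient b x y)
    blocks-entry i 0F 0F = sameBlock-entry i 0F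
    blocks-entry i 0F 1F = otherBlock-entry i 0F
    blocks-entry i 1F 0F = otherBlock-entry i 1F
    blocks-entry i 1F 1F = sameBlock-entry i 1F

    A-entry : ∀ i b c s t x y → A i (vertex b s x) (vertex c t y) ≡ entry i b c s t (Id v x y) (orient b x y)
    A-entry i b c s t x y = trans (A≡block i (vertex b s x) (vertex c t y))
      (trans (block-combine (blocks i) b c (combine {2} s x) (combine {2} t y)) (blocks-entry i b c s t x y))

  -- Multiplication relations and closure of the integer span

  -- A₁ exchanges the two copies of each vertex; this is the permutation it induces on the classes.
  σ : Fin 6 → Fin 6
  σ 0F = 1F
  σ 1F = 0F
  σ 2F = 2F
  σ 3F = 4F
  σ 4F = 3F
  σ 5F = 5F

  -- J on the two diagonal blocks, and J on the two off-diagonal blocks.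
  within across : ∀ {N} → (Fin 6 → Mat ℤ N N) → Mat ℤ N N
  within A y z = A 0F y z + A 1F y z + A 2F y z
  across A y z = A 3F y z + A 4F y z + A 5F y z

  -- The interface between combinatorics and algebra: from here on products of scheme matrices are
  -- computed from these identities alone, for arbitrary matrices `A`.
  record Relations {N : ℕ} (A : Fin 6 → Mat ℤ N N) (v k μ : ℤ) : Set where
    field
      A-sym : ∀ i y z → A i y z ≡ A i z y
      A₀≡Id : ∀ y z → A 0F y z ≡ Id N y z
      A₁·A  : ∀ i y z → (A 1F · A i) y z ≡ A (σ i) y z
      K·K   : ∀ y z → (within A · within A) y z ≡ + 2 * v * within A y z
      K·K′  : ∀ y z → (within A · across A) y z ≡ + 2 * v * across A y z
      K′·K′ : ∀ y z → (across A · across A) y z ≡ + 2 * v * within A y z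
      A₃·K  : ∀ y z → (A 3F · within A) y z ≡ k * across A y z
      A₃·K′ : ∀ y z → (A 3F · across A) y z ≡ k * within A y z
      A₃·A₃ : ∀ y z → (A 3F · A 3F) y z ≡ k * A 0F y z + μ * A 2F y z

  module Closure {N : ℕ} {A : Fin 6 → Mat ℤ N N} {v k μ : ℤ} (R : Relations A v k μ) where
    open Relations R
    open ≡-Reasoning

    K K′ : Mat ℤ N N
    K  = within A
    K′ = across A

    Symmetric : Mat ℤ N N → Set
    Symmetric M = ∀ y z → M y z ≡ M z y

    A₀· : ∀ (M : Mat ℤ N N) y z → (A 0F · M) y z ≡ M y z
    A₀· = identity-· A₀≡Id

    sum₃-sym : ∀ {M L P : Mat ℤ N N} → Symmetric M → Symmetric L → Symmetric P → Symmetric (λ y z → M y z + L y z + P y z)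
    sum₃-sym sM sL sP y z = cong₂ _+_ (cong₂ _+_ (sM y z) (sL y z)) (sP y z)

    K-sym : Symmetric K
    K-sym = sum₃-sym (A-sym 0F) (A-sym 1F) (A-sym 2F)

    K′-sym : Symmetric K′
    K′-sym = sum₃-sym (A-sym 3F) (A-sym 4F) (A-sym 5F)

    ·-swap : ∀ (M L : Mat ℤ N N) → Symmetric M → Symmetric L → ∀ y z → (L · M) y z ≡ (M · L) z y
    ·-swap M L sM sL y z = trans (⊡-ᵀ L M y z) (∑-cong N (λ l → cong₂ _*_ (sM l z) (sL y l)))

    ·-sum₃ : ∀ (M P Q R : Mat ℤ N N) y z →
             (M · (λ y z → P y z + Q y z + R y z)) y z ≡ (M · P) y z + (M · Q) y z + (M · R) y z
    ·-sum₃ M P Q R y z = begin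
      ∑ℤ N (λ l → M y l * (P l z + Q l z + R l z))
        ≡⟨ ∑-cong N (λ l → distrib (M y l) (P l z) (Q l z) (R l z)) ⟩
      ∑ℤ N (λ l → M y l * P l z + M y l * Q l z + M y l * R l z)
        ≡⟨ ∑-+ N (λ l → M y l * P l z + M y l * Q l z) (λ l → M y l * R l z) ⟩
      ∑ℤ N (λ l → M y l * P l z + M y l * Q l z) + (M · R) y z
        ≡⟨ cong (_+ (M · R) y z) (∑-+ N (λ l → M y l * P l z) (λ l → M y l * Q l z)) ⟩
      (M · P) y z + (M · Q) y z + (M · R) y z ∎
      where
      distrib : ∀ m p q r → m * (p + q + r) ≡ m * p + m * q + m * r
      distrib = solve-∀

    -- A record and not a Σ-type, so that the implicit matrix arguments can be recovered by
    -- unification.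
    record Span (M : Mat ℤ N N) : Set where
      constructor _,_
      field
        coeffs : Fin 6 → ℤ
        expand : ∀ y z → M y z ≡ ∑ℤ 6 (λ j → coeffs j * A j y z)

    span-cong : ∀ {M L} → (∀ y z → M y z ≡ L y z) → Span L → Span M
    span-cong M≡L (γ , L≡) = γ , λ y z → trans (M≡L y z) (L≡ y z)

    span-A : ∀ i → Span (A i)
    span-A i = Id 6 i , λ y z → sym (∑-δ 6 i (λ j → A j y z))

    span-lin : ∀ x x′ {M L} → Span M → Span L → Span (λ y z → x * M y z + x′ * L y z)
    span-lin x x′ {M} {L} (γ , M≡) (γ′ , L≡) = (λ j → x * γ j + x′ * γ′ j) , λ y z → begin
      x * M y z + x′ * L y z
        ≡⟨ cong₂ (λ p q → x * p + x′ * q) (M≡ y z) (L≡ y z) ⟩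
      x * ∑ℤ 6 (λ j → γ j * A j y z) + x′ * ∑ℤ 6 (λ j → γ′ j * A j y z)
        ≡⟨ ∑-lin 6 x x′ (λ j → γ j * A j y z) (λ j → γ′ j * A j y z) ⟨
      ∑ℤ 6 (λ j → x * (γ j * A j y z) + x′ * (γ′ j * A j y z))
        ≡⟨ ∑-cong 6 (λ j → factor x (γ j) x′ (γ′ j) (A j y z)) ⟩
      ∑ℤ 6 (λ j → (x * γ j + x′ * γ′ j) * A j y z) ∎
      where
      factor : ∀ x g x′ g′ a → x * (g * a) + x′ * (g′ * a) ≡ (x * g + x′ * g′) * a
      factor = solve-∀

    span-sum₃ : ∀ {P Q R} → Span P → Span Q → Span R → Span (λ y z → P y z + Q y z + R y z)
    span-sum₃ {P} {Q} {R} sP sQ sR = span-cong (λ y z → ones (P y z) (Q y z) (R y z)) (span-lin 1ℤ 1ℤ (span-lin 1ℤ 1ℤ sP sQ) sR)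
      where
      ones : ∀ p q r → p + q + r ≡ 1ℤ * (1ℤ * p + 1ℤ * q) + 1ℤ * r
      ones = solve-∀

    span-scale : ∀ x {M} → Span M → Span (λ y z → x * M y z)
    span-scale x {M} sM = span-cong (λ y z → pad x (M y z)) (span-lin x 0ℤ sM sM)
      where
      pad : ∀ x m → x * m ≡ x * m + 0ℤ * m
      pad = solve-∀

    -- Used with `M` a product with `K` or `K′`: the product with A₂ or A₅ is what remains after two
    -- products that are already known.
    span-rest : ∀ {M P Q R} → (∀ y z → M y z ≡ P y z + Q y z + R y z) → Span M → Span P → Span Q → Span R
    span-rest {M} {P} {Q} {R} M≡ sM sP sQ = span-cong (λ y z → trans (rest (P y z) (Q y z) (R y z))
        (cong (λ m → 1ℤ * (1ℤ * m + - 1ℤ * P y z) + - 1ℤ * Q y z) (sym (M≡ y z))))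
      (span-lin 1ℤ (- 1ℤ) (span-lin 1ℤ (- 1ℤ) sM sP) sQ)
      where
      rest : ∀ p q r → r ≡ 1ℤ * (1ℤ * (p + q + r) + - 1ℤ * p) + - 1ℤ * q
      rest = solve-∀

    -- For symmetric factors LM is the transpose of ML, and a combination of the symmetric A j
    -- equals its transpose, so the same coefficients serve.
    span-swap : ∀ M L → Symmetric M → Symmetric L → Span (M · L) → Span (L · M)
    span-swap M L sM sL (γ , ML≡) = γ , λ y z →
      trans (·-swap M L sM sL y z) (trans (ML≡ z y) (∑-cong 6 (λ j → cong (γ j *_) (A-sym j z y))))

    -- `σ` is an involution, so reindexing the sum moves it from the matrices to the coefficients.
    span-A₁· : ∀ M → Span M → Span (A 1F · M)
    span-A₁· M (γ , M≡) = (λ j → γ (σ j)) , λ y z → begin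
      (A 1F · M) y z                                    ≡⟨ ⊡-congˡ (A 1F) M≡ y z ⟩
      (A 1F · (λ y z → ∑ℤ 6 (λ j → γ j * A j y z))) y z ≡⟨ ⊡-∑ʳ 6 (A 1F) γ A y z ⟩
      ∑ℤ 6 (λ j → γ j * (A 1F · A j) y z)               ≡⟨ ∑-cong 6 (λ j → cong (γ j *_) (A₁·A j y z)) ⟩
      ∑ℤ 6 (λ j → γ j * A (σ j) y z)
        ≡⟨ reorder (γ 0F * A 1F y z) (γ 1F * A 0F y z) (γ 2F * A 2F y z) (γ 3F * A 4F y z) (γ 4F * A 3F y z) (γ 5F * A 5F y z) ⟩
      ∑ℤ 6 (λ j → γ (σ j) * A j y z)                    ∎
      where
      reorder : ∀ a b c d e f → a + (b + (c + (d + (e + (f + 0ℤ))))) ≡ b + (a + (c + (e + (d + (f + 0ℤ)))))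
      reorder = solve-∀

    span-K : Span K
    span-K = span-sum₃ (span-A 0F) (span-A 1F) (span-A 2F)

    span-K′ : Span K′
    span-K′ = span-sum₃ (span-A 3F) (span-A 4F) (span-A 5F)

    span-A₀· : ∀ M → Span M → Span (A 0F · M)
    span-A₀· M = span-cong (A₀· M)

    span-A₄· : ∀ M → Span (A 3F · M) → Span (A 4F · M)
    span-A₄· M sA₃M = span-cong (λ y z → trans (⊡-congʳ M (λ y z → sym (A₁·A 3F y z)) y z) (⊡-assoc (A 1F) (A 3F) M y z))
      (span-A₁· (A 3F · M) sA₃M)

    span-·A₂ : ∀ M → Span (M · K) → Span (M · A 0F) → Span (M · A 1F) → Span (M · A 2F)
    span-·A₂ M = span-rest (·-sum₃ M (A 0F) (A 1F) (A 2F))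

    span-·A₅ : ∀ M → Span (M · K′) → Span (M · A 3F) → Span (M · A 4F) → Span (M · A 5F)
    span-·A₅ M = span-rest (·-sum₃ M (A 3F) (A 4F) (A 5F))

    span-KK : Span (K · K)
    span-KK = span-cong K·K (span-scale (+ 2 * v) span-K)

    span-KK′ : Span (K · K′)
    span-KK′ = span-cong K·K′ (span-scale (+ 2 * v) span-K′)

    span-K′K′ : Span (K′ · K′)
    span-K′K′ = span-cong K′·K′ (span-scale (+ 2 * v) span-K)

    span-A₃K : Span (A 3F · K)
    span-A₃K = span-cong A₃·K (span-scale k span-K′)

    span-A₃K′ : Span (A 3F · K′)
    span-A₃K′ = span-cong A₃·K′ (span-scale k span-K)

    -- KK = KA₀ + KA₁ + KA₂, where KA₀ and KA₁ are transposes of known products; the remainder KA₂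
    -- is transposed in turn. The next two products follow the same pattern.
    span-A₂K : Span (A 2F · K)
    span-A₂K = span-swap K (A 2F) K-sym (A-sym 2F) (span-·A₂ K span-KK
      (span-swap (A 0F) K (A-sym 0F) K-sym (span-A₀· K span-K)) (span-swap (A 1F) K (A-sym 1F) K-sym (span-A₁· K span-K)))

    span-A₂K′ : Span (A 2F · K′)
    span-A₂K′ = span-swap K′ (A 2F) K′-sym (A-sym 2F) (span-·A₂ K′ (span-swap K K′ K-sym K′-sym span-KK′)
      (span-swap (A 0F) K′ (A-sym 0F) K′-sym (span-A₀· K′ span-K′)) (span-swap (A 1F) K′ (A-sym 1F) K′-sym (span-A₁· K′ span-K′)))

    span-A₅K′ : Span (A 5F · K′)
    span-A₅K′ = span-swap K′ (A 5F) K′-sym (A-sym 5F) (span-·A₅ K′ span-K′K′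
      (span-swap (A 3F) K′ (A-sym 3F) K′-sym span-A₃K′) (span-swap (A 4F) K′ (A-sym 4F) K′-sym (span-A₄· K′ span-A₃K′)))

    transposed : ∀ i j → Span (A i · A j) → Span (A j · A i)
    transposed i j = span-swap (A i) (A j) (A-sym i) (A-sym j)

    product₀ : ∀ j → Span (A 0F · A j)
    product₀ j = span-A₀· (A j) (span-A j)

    product₁ : ∀ j → Span (A 1F · A j)
    product₁ j = span-A₁· (A j) (span-A j)

    span-A₃A₃ : Span (A 3F · A 3F)
    span-A₃A₃ = span-cong A₃·A₃ (span-lin k μ (span-A 0F) (span-A 2F))

    span-A₃A₄ : Span (A 3F · A 4F)
    span-A₃A₄ = transposed 4F 3F (span-A₄· (A 3F) span-A₃A₃)

    product₃ : ∀ j → Span (A 3F · A j)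
    product₃ 0F = transposed 0F 3F (product₀ 3F)
    product₃ 1F = transposed 1F 3F (product₁ 3F)
    product₃ 2F = span-·A₂ (A 3F) span-A₃K (product₃ 0F) (product₃ 1F)
    product₃ 3F = span-A₃A₃
    product₃ 4F = span-A₃A₄
    product₃ 5F = span-·A₅ (A 3F) span-A₃K′ span-A₃A₃ span-A₃A₄

    product₄ : ∀ j → Span (A 4F · A j)
    product₄ j = span-A₄· (A j) (product₃ j)

    product₂ : ∀ j → Span (A 2F · A j)
    product₂ 0F = transposed 0F 2F (product₀ 2F)
    product₂ 1F = transposed 1F 2F (product₁ 2F)
    product₂ 2F = span-·A₂ (A 2F) span-A₂K (product₂ 0F) (product₂ 1F)
    product₂ 3F = transposed 3F 2F (product₃ 2F)
    product₂ 4F = transposed 4F 2F (product₄ 2F)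
    product₂ 5F = span-·A₅ (A 2F) span-A₂K′ (product₂ 3F) (product₂ 4F)

    product : ∀ i j → Span (A i · A j)
    product 0F = product₀
    product 1F = product₁
    product 2F = product₂
    product 3F = product₃
    product 4F = product₄
    -- For A₅ no direct computation remains: the earlier rows give its products with A₀ to A₄ by
    -- commutation, and A₅A₅ is the remainder of A₅K′.
    product 5F 0F = transposed 0F 5F (product₀ 5F)
    product 5F 1F = transposed 1F 5F (product₁ 5F)
    product 5F 2F = transposed 2F 5F (product₂ 5F)
    product 5F 3F = transposed 3F 5F (product₃ 5F)
    product 5F 4F = transposed 4F 5F (product₄ 5F)
    product 5F 5F = span-·A₅ (A 5F) span-A₅K′ (product 5F 3F) (product 5F 4F)

  -- Finite checks on entries

  -- Together with `sign`, this indexes the possible values of δ and w by finite types, over which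
  -- `Fin.all?` decides.
  bit : Fin 2 → ℤ
  bit 0F = 1ℤ
  bit 1F = 0ℤ

  sign : Fin 3 → ℤ
  sign 0F = 0ℤ
  sign 1F = 1ℤ
  sign 2F = - 1ℤ

  bit-Id : ∀ {v} (x y : Fin v) → ∃ λ e → Id v x y ≡ bit e
  bit-Id x y with x Fin.≟ y
  ... | yes _ = 0F , refl
  ... | no _  = 1F , refl

  sign-code : ∀ {w} → IsSign w → ∃ λ c → w ≡ sign c
  sign-code (inj₁ refl)        = 0F , refl
  sign-code (inj₂ (inj₁ refl)) = 1F , refl
  sign-code (inj₂ (inj₂ refl)) = 2F , refl

  -- The decision procedure runs through all cases during type checking; the coded statements below
  -- are proved in the same way.
  coded-01 : ∀ i b c s t e w → entry i b c s t (bit e) (sign w) ≡ 0ℤ ⊎ entry i b c s t (bit e) (sign w) ≡ 1ℤ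
  coded-01 = from-yes (Fin.all? λ i → Fin.all? λ b → Fin.all? λ c → Fin.all? λ s → Fin.all? λ t → Fin.all? λ e → Fin.all? λ w →
    (entry i b c s t (bit e) (sign w) ℤ.≟ 0ℤ) ⊎-dec (entry i b c s t (bit e) (sign w) ℤ.≟ 1ℤ))

  coded-sum : ∀ b c s t e w → ∑ℤ 6 (λ i → entry i b c s t (bit e) (sign w)) ≡ 1ℤ
  coded-sum = from-yes (Fin.all? λ b → Fin.all? λ c → Fin.all? λ s → Fin.all? λ t → Fin.all? λ e → Fin.all? λ w →
    ∑ℤ 6 (λ i → entry i b c s t (bit e) (sign w)) ℤ.≟ 1ℤ)

  coded-same-sym : ∀ i s t e → sameHalf i s t (bit e) ≡ sameHalf i t s (bit e)
  coded-same-sym = from-yes (Fin.all? λ i → Fin.all? λ s → Fin.all? λ t → Fin.all? λ e →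
    sameHalf i s t (bit e) ℤ.≟ sameHalf i t s (bit e))

  coded-other-sym : ∀ i s t w → otherHalf i s t (sign w) ≡ otherHalf i t s (sign w)
  coded-other-sym = from-yes (Fin.all? λ i → Fin.all? λ s → Fin.all? λ t → Fin.all? λ w →
    otherHalf i s t (sign w) ℤ.≟ otherHalf i t s (sign w))

  -- Replacing s by 1 - s exchanges I₂ with S and fixes J₂, which on the classes is `σ`.
  coded-flip : ∀ i b c s t e w → entry i b c (opposite s) t (bit e) (sign w) ≡ entry (σ i) b c s t (bit e) (sign w)
  coded-flip = from-yes (Fin.all? λ i → Fin.all? λ b → Fin.all? λ c → Fin.all? λ s → Fin.all? λ t → Fin.all? λ e → Fin.all? λ w →
    entry i b c (opposite s) t (bit e) (sign w) ℤ.≟ entry (σ i) b c s t (bit e) (sign w))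

  coded-A₀ : ∀ b c s t e w → entry 0F b c s t (bit e) (sign w) ≡ Id 2 b c * (Id 2 s t * bit e)
  coded-A₀ = from-yes (Fin.all? λ b → Fin.all? λ c → Fin.all? λ s → Fin.all? λ t → Fin.all? λ e → Fin.all? λ w →
    entry 0F b c s t (bit e) (sign w) ℤ.≟ Id 2 b c * (Id 2 s t * bit e))

  coded-K : ∀ b c s t e w →
    entry 0F b c s t (bit e) (sign w) + entry 1F b c s t (bit e) (sign w) + entry 2F b c s t (bit e) (sign w) ≡ Id 2 b c
  coded-K = from-yes (Fin.all? λ b → Fin.all? λ c → Fin.all? λ s → Fin.all? λ t → Fin.all? λ e → Fin.all? λ w →
    entry 0F b c s t (bit e) (sign w) + entry 1F b c s t (bit e) (sign w) + entry 2F b c s t (bit e) (sign w) ℤ.≟ Id 2 b c)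

  coded-K′ : ∀ b c s t e w →
    entry 3F b c s t (bit e) (sign w) + entry 4F b c s t (bit e) (sign w) + entry 5F b c s t (bit e) (sign w) ≡ S b c
  coded-K′ = from-yes (Fin.all? λ b → Fin.all? λ c → Fin.all? λ s → Fin.all? λ t → Fin.all? λ e → Fin.all? λ w →
    entry 3F b c s t (bit e) (sign w) + entry 4F b c s t (bit e) (sign w) + entry 5F b c s t (bit e) (sign w) ℤ.≟ S b c)

  Id-combine : ∀ {m n} (i i′ : Fin m) (j j′ : Fin n) → Id (m ℕ.* n) (combine i j) (combine i′ j′) ≡ Id m i i′ * Id n j j′
  Id-combine {m} {n} i i′ j j′ with i Fin.≟ i′ | j Fin.≟ j′
  ... | yes refl | yes refl = Id-diag (m ℕ.* n) (combine i j)
  ... | yes refl | no j≢j′  = Id-off (m ℕ.* n) (λ eq → j≢j′ (Fin.combine-injectiveʳ i j i j′ eq))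
  ... | no i≢i′  | _        = trans (Id-off (m ℕ.* n) (λ eq → i≢i′ (Fin.combine-injectiveˡ i j i′ j′ eq))) (sym (ℤ.*-zeroˡ 0ℤ))

  -- The shape of a product whose factors have constant sums over each half: the 2 by 2 patterns
  -- multiply and the common value x, here 2v or k, factors out.
  ∑-pair : ∀ (M L : Mat ℤ 2 2) b c x → ∑ℤ 2 (λ d → M b d * x * L d c) ≡ x * (M · L) b c
  ∑-pair M L b c x = arrange (M b 0F) (L 0F c) (M b 1F) (L 1F c) x
    where
    arrange : ∀ p q r s x → p * x * q + (r * x * s + 0ℤ) ≡ x * (p * q + (r * s + 0ℤ))
    arrange = solve-∀

  Id·Id : ∀ b c x → ∑ℤ 2 (λ d → Id 2 b d * x * Id 2 d c) ≡ x * Id 2 b c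
  Id·Id b c x = trans (∑-pair (Id 2) (Id 2) b c x) (cong (x *_) (M·L≡R b c))
    where
    M·L≡R : ∀ b c → ((Id 2) · (Id 2)) b c ≡ Id 2 b c
    M·L≡R = from-yes (Fin.all? λ b → Fin.all? λ c → ((Id 2) · (Id 2)) b c ℤ.≟ Id 2 b c)

  S·Id : ∀ b c x → ∑ℤ 2 (λ d → S b d * x * Id 2 d c) ≡ x * S b c
  S·Id b c x = trans (∑-pair S (Id 2) b c x) (cong (x *_) (M·L≡R b c))
    where
    M·L≡R : ∀ b c → (S · (Id 2)) b c ≡ S b c
    M·L≡R = from-yes (Fin.all? λ b → Fin.all? λ c → (S · (Id 2)) b c ℤ.≟ S b c)

  Id·S : ∀ b c x → ∑ℤ 2 (λ d → Id 2 b d * x * S d c) ≡ x * S b c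
  Id·S b c x = trans (∑-pair (Id 2) S b c x) (cong (x *_) (M·L≡R b c))
    where
    M·L≡R : ∀ b c → ((Id 2) · S) b c ≡ S b c
    M·L≡R = from-yes (Fin.all? λ b → Fin.all? λ c → ((Id 2) · S) b c ℤ.≟ S b c)

  S·S : ∀ b c x → ∑ℤ 2 (λ d → S b d * x * S d c) ≡ x * Id 2 b c
  S·S b c x = trans (∑-pair S S b c x) (cong (x *_) (M·L≡R b c))
    where
    M·L≡R : ∀ b c → (S · S) b c ≡ Id 2 b c
    M·L≡R = from-yes (Fin.all? λ b → Fin.all? λ c → (S · S) b c ℤ.≟ Id 2 b c)

  -- Verification of the multiplication relations

  module Entrywise {v : ℕ} {W : Mat ℤ v v} {k μ : ℤ} (G : SignedGram k μ W) where
    open Entries W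
    open SignedGram
    open ≡-Reasoning

    oriented : ∀ b → SignedGram k μ (orient b)
    oriented 0F = G
    oriented 1F = transpose G

    -- The codes are chosen before i, c, s and t: a single pair must serve all six matrices, for the
    -- sum over i, and both copies of a vertex, for the exchange of s.
    A-coded : ∀ b x y → ∃₂ λ e w → ∀ i c s t → A i (vertex b s x) (vertex c t y) ≡ entry i b c s t (bit e) (sign w)
    A-coded b x y with bit-Id x y | sign-code (entries (oriented b) x y)
    ... | e , δ≡ | w , V≡ = e , w , λ i c s t →
      trans (A-entry i b c s t x y) (cong₂ (entry i b c s t) δ≡ V≡)

    A-01 : ∀ i y z → A i y z ≡ 0ℤ ⊎ A i y z ≡ 1ℤ
    A-01 i = ∀-vertex λ b s x → ∀-vertex λ c t y → go b s x c t y
      where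
      go : ∀ b s x c t y → A i (vertex b s x) (vertex c t y) ≡ 0ℤ ⊎ A i (vertex b s x) (vertex c t y) ≡ 1ℤ
      go b s x c t y with A-coded b x y
      ... | e , w , A≡ = subst (λ a → a ≡ 0ℤ ⊎ a ≡ 1ℤ) (sym (A≡ i c s t)) (coded-01 i b c s t e w)

    A-sum : ∀ y z → ∑ℤ 6 (λ i → A i y z) ≡ 1ℤ
    A-sum = ∀-vertex λ b s x → ∀-vertex λ c t y → go b s x c t y
      where
      go : ∀ b s x c t y → ∑ℤ 6 (λ i → A i (vertex b s x) (vertex c t y)) ≡ 1ℤ
      go b s x c t y with A-coded b x y
      ... | e , w , A≡ = trans (∑-cong 6 (λ i → A≡ i c s t)) (coded-sum b c s t e w)

    A-sym : ∀ i y z → A i y z ≡ A i z y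
    A-sym i = ∀-vertex λ b s x → ∀-vertex λ c t y →
      trans (A-entry i b c s t x y) (trans (go b s x c t y) (sym (A-entry i c b t s y x)))
      where
      same : ∀ s t x y → sameHalf i s t (Id v x y) ≡ sameHalf i t s (Id v y x)
      same s t x y with bit-Id x y
      ... | e , δ≡ = trans (cong (sameHalf i s t) δ≡) (trans (coded-same-sym i s t e)
                       (cong (sameHalf i t s) (trans (sym δ≡) (Id-sym v x y))))
      -- Exchanging two vertices in different halves replaces W by Wᵀ and swaps x with y, hence
      -- meets the same entry of W; only the symmetry in s and t is left.
      other : ∀ s t x y → otherHalf i s t (W x y) ≡ otherHalf i t s (W x y)
      other s t x y with sign-code (entries G x y)
      ... | w , W≡ = trans (cong (otherHalf i s t) W≡) (trans (coded-other-sym i s t w) (cong (otherHalf i t s) (sym W≡)))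
      go : ∀ b s x c t y → entry i b c s t (Id v x y) (orient b x y) ≡ entry i c b t s (Id v y x) (orient c y x)
      go 0F s x 0F t y = same s t x y
      go 0F s x 1F t y = other s t x y
      go 1F s x 0F t y = other s t y x
      go 1F s x 1F t y = same s t x y

    A₀-entry : ∀ b c s t x y → A 0F (vertex b s x) (vertex c t y) ≡ Id 2 b c * (Id 2 s t * Id v x y)
    A₀-entry b c s t x y with bit-Id x y | sign-code (entries (oriented b) x y)
    ... | e , δ≡ | w , V≡ = begin
      A 0F (vertex b s x) (vertex c t y)              ≡⟨ A-entry 0F b c s t x y ⟩
      entry 0F b c s t (Id v x y) (orient b x y)      ≡⟨ cong₂ (entry 0F b c s t) δ≡ V≡ ⟩
      entry 0F b c s t (bit e) (sign w)               ≡⟨ coded-A₀ b c s t e w ⟩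
      Id 2 b c * (Id 2 s t * bit e)                   ≡⟨ cong (λ δ → Id 2 b c * (Id 2 s t * δ)) δ≡ ⟨
      Id 2 b c * (Id 2 s t * Id v x y)                ∎

    A₀≡Id : ∀ y z → A 0F y z ≡ Id N y z
    A₀≡Id = ∀-vertex λ b s x → ∀-vertex λ c t y → trans (A₀-entry b c s t x y) (sym (begin
      Id N (vertex b s x) (vertex c t y)                            ≡⟨ Id-combine b c (combine {2} s x) (combine {2} t y) ⟩
      Id 2 b c * Id (2 ℕ.* v) (combine {2} s x) (combine {2} t y)   ≡⟨ cong (Id 2 b c *_) (Id-combine s t x y) ⟩
      Id 2 b c * (Id 2 s t * Id v x y)                              ∎))

    A-flip : ∀ i b s x z → A i (vertex b (opposite s) x) z ≡ A (σ i) (vertex b s x) z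
    A-flip i b s x = ∀-vertex λ c t y → go c t y
      where
      go : ∀ c t y → A i (vertex b (opposite s) x) (vertex c t y) ≡ A (σ i) (vertex b s x) (vertex c t y)
      go c t y with A-coded b x y
      ... | e , w , A≡ = trans (A≡ i c (opposite s) t) (trans (coded-flip i b c s t e w) (sym (A≡ (σ i) c s t)))

    -- A₁ = A_σ(0) is the identity with the rows s and 1 − s exchanged.
    A₁· : ∀ (M : Mat ℤ N N) b s x z → (A 1F · M) (vertex b s x) z ≡ M (vertex b (opposite s) x) z
    A₁· M b s x z = trans (∑-cong N (λ l → cong (_* M l z) (sym (A-flip 0F b s x l)))) (identity-· A₀≡Id M (vertex b (opposite s) x) z)

    A₁·A : ∀ i y z → (A 1F · A i) y z ≡ A (σ i) y z
    A₁·A i y z = ∀-vertex {P = λ y → (A 1F · A i) y z ≡ A (σ i) y z}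
      (λ b s x → trans (A₁· (A i) b s x z) (A-flip i b s x z)) y

    K K′ : Mat ℤ N N
    K  = within A
    K′ = across A

    K-entry : ∀ b c s t x y → K (vertex b s x) (vertex c t y) ≡ Id 2 b c
    K-entry b c s t x y with A-coded b x y
    ... | e , w , A≡ = trans (cong₂ _+_ (cong₂ _+_ (A≡ 0F c s t) (A≡ 1F c s t)) (A≡ 2F c s t)) (coded-K b c s t e w)

    K′-entry : ∀ b c s t x y → K′ (vertex b s x) (vertex c t y) ≡ S b c
    K′-entry b c s t x y with A-coded b x y
    ... | e , w , A≡ = trans (cong₂ _+_ (cong₂ _+_ (A≡ 3F c s t) (A≡ 4F c s t)) (A≡ 5F c s t)) (coded-K′ b c s t e w)

    halfSum : Mat ℤ N N → Fin N → Fin 2 → ℤ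
    halfSum M z d = ∑ℤ 2 (λ u → ∑ℤ v (λ l → M z (vertex d u l)))

    -- The columns of `K` and `K′` are constant on each half, so a product with them depends on a
    -- row of `M` only through its two half sums.
    ·-halves : ∀ (M L : Mat ℤ N N) z y (f : Fin 2 → ℤ) → (∀ d u l → L (vertex d u l) y ≡ f d) →
               (M · L) z y ≡ ∑ℤ 2 (λ d → halfSum M z d * f d)
    ·-halves M L z y f L≡ = trans (∑-vertex (λ l → M z l * L l y)) (∑-cong 2 (λ d → begin
      ∑ℤ 2 (λ u → ∑ℤ v (λ l → M z (vertex d u l) * L (vertex d u l) y))
        ≡⟨ ∑-cong 2 (λ u → ∑-cong v (λ l → cong (M z (vertex d u l) *_) (L≡ d u l))) ⟩
      ∑ℤ 2 (λ u → ∑ℤ v (λ l → M z (vertex d u l) * f d))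
        ≡⟨ ∑-cong 2 (λ u → ∑-*ʳ v (f d) (λ l → M z (vertex d u l))) ⟨
      ∑ℤ 2 (λ u → ∑ℤ v (λ l → M z (vertex d u l)) * f d)
        ≡⟨ ∑-*ʳ 2 (f d) (λ u → ∑ℤ v (λ l → M z (vertex d u l))) ⟨
      halfSum M z d * f d ∎))

    halfSum-const : ∀ (M : Mat ℤ N N) z d x → (∀ u l → M z (vertex d u l) ≡ x) → halfSum M z d ≡ x * (+ 2 * + v)
    halfSum-const M z d x M≡ = begin
      halfSum M z d               ≡⟨ ∑-cong 2 (λ u → ∑-cong v (M≡ u)) ⟩
      ∑ℤ 2 (λ u → ∑ℤ v (λ _ → x)) ≡⟨ ∑-cong 2 (λ u → ∑-const v x) ⟩
      ∑ℤ 2 (λ u → + v * x)        ≡⟨ ∑-const 2 (+ v * x) ⟩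
      + 2 * (+ v * x)             ≡⟨ arrange (+ v) x ⟩
      x * (+ 2 * + v)             ∎
      where
      arrange : ∀ v x → + 2 * (v * x) ≡ x * (+ 2 * v)
      arrange = solve-∀

    A₃-same : ∀ b s t x y → A 3F (vertex b s x) (vertex b t y) ≡ 0ℤ
    A₃-same 0F = A-entry 3F 0F 0F
    A₃-same 1F = A-entry 3F 1F 1F

    A₃-other : ∀ b s t x y → A 3F (vertex b s x) (vertex (opposite b) t y) ≡ otherHalf 3F s t (orient b x y)
    A₃-other 0F = A-entry 3F 0F 1F
    A₃-other 1F = A-entry 3F 1F 0F

    -- A₃ meets exactly one of the two copies of l when V x l is nonzero (copy s for 1, the other
    -- one for -1) and neither when it is 0. The half sum is therefore the row sum of the support.
    halfSum-A₃-other : ∀ b s x → halfSum (A 3F) (vertex b s x) (opposite b) ≡ 1ℤ * k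
    halfSum-A₃-other b s x = begin
      halfSum (A 3F) (vertex b s x) (opposite b)                ≡⟨ ∑-cong 2 (λ u → ∑-cong v (λ l → A₃-other b s u x l)) ⟩
      ∑ℤ 2 (λ u → ∑ℤ v (λ l → otherHalf 3F s u (V x l)))        ≡⟨ split s ⟩
      ∑ℤ v X + ∑ℤ v Y                                           ≡⟨ ∑-+ v X Y ⟨
      ∑ℤ v (∣ V ∣ₘ x)                                           ≡⟨ rowSum (oriented b) x ⟩
      k                                                         ≡⟨ ℤ.*-identityˡ k ⟨
      1ℤ * k                                                    ∎
      where
      V = orient b
      X Y : Fin v → ℤ
      X l = pos (V x l)
      Y l = neg (V x l)
      1p+0q : ∀ p q → 1ℤ * p + 0ℤ * q ≡ p
      1p+0q = solve-∀
      0p+1q : ∀ p q → 0ℤ * p + 1ℤ * q ≡ q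
      0p+1q = solve-∀
      p+q : ∀ p q → p + (q + 0ℤ) ≡ p + q
      p+q = solve-∀
      q+p : ∀ p q → q + (p + 0ℤ) ≡ p + q
      q+p = solve-∀
      split : ∀ s → ∑ℤ 2 (λ u → ∑ℤ v (λ l → otherHalf 3F s u (V x l))) ≡ ∑ℤ v X + ∑ℤ v Y
      split 0F = trans (cong₂ (λ p q → p + (q + 0ℤ)) (∑-cong v (λ l → 1p+0q (X l) (Y l))) (∑-cong v (λ l → 0p+1q (X l) (Y l))))
                       (p+q (∑ℤ v X) (∑ℤ v Y))
      split 1F = trans (cong₂ (λ q p → q + (p + 0ℤ)) (∑-cong v (λ l → 0p+1q (X l) (Y l))) (∑-cong v (λ l → 1p+0q (X l) (Y l))))
                       (q+p (∑ℤ v X) (∑ℤ v Y))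

    halfSum-A₃-same : ∀ b s x → halfSum (A 3F) (vertex b s x) b ≡ 0ℤ * k
    halfSum-A₃-same b s x = ∑-zero 2 (λ u → ∑-zero v (λ l → A₃-same b s u x l))

    halfSum-A₃ : ∀ b s x d → halfSum (A 3F) (vertex b s x) d ≡ S b d * k
    halfSum-A₃ 0F s x 0F = halfSum-A₃-same 0F s x
    halfSum-A₃ 0F s x 1F = halfSum-A₃-other 0F s x
    halfSum-A₃ 1F s x 0F = halfSum-A₃-other 1F s x
    halfSum-A₃ 1F s x 1F = halfSum-A₃-same 1F s x

    K·K : ∀ y z → (K · K) y z ≡ + 2 * + v * K y z
    K·K = ∀-vertex λ b s x → ∀-vertex λ c t y → begin
      (K · K) (vertex b s x) (vertex c t y)
        ≡⟨ ·-halves K K _ _ (λ d → Id 2 d c) (λ d u l → K-entry d c u t l y) ⟩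
      ∑ℤ 2 (λ d → halfSum K (vertex b s x) d * Id 2 d c)
        ≡⟨ ∑-cong 2 (λ d → cong (_* Id 2 d c) (halfSum-const K _ d (Id 2 b d) (λ u l → K-entry b d s u x l))) ⟩
      ∑ℤ 2 (λ d → Id 2 b d * (+ 2 * + v) * Id 2 d c)
        ≡⟨ Id·Id b c (+ 2 * + v) ⟩
      + 2 * + v * Id 2 b c
        ≡⟨ cong (+ 2 * + v *_) (K-entry b c s t x y) ⟨
      + 2 * + v * K (vertex b s x) (vertex c t y) ∎

    K·K′ : ∀ y z → (K · K′) y z ≡ + 2 * + v * K′ y z
    K·K′ = ∀-vertex λ b s x → ∀-vertex λ c t y → begin
      (K · K′) (vertex b s x) (vertex c t y)
        ≡⟨ ·-halves K K′ _ _ (λ d → S d c) (λ d u l → K′-entry d c u t l y) ⟩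
      ∑ℤ 2 (λ d → halfSum K (vertex b s x) d * S d c)
        ≡⟨ ∑-cong 2 (λ d → cong (_* S d c) (halfSum-const K _ d (Id 2 b d) (λ u l → K-entry b d s u x l))) ⟩
      ∑ℤ 2 (λ d → Id 2 b d * (+ 2 * + v) * S d c)
        ≡⟨ Id·S b c (+ 2 * + v) ⟩
      + 2 * + v * S b c
        ≡⟨ cong (+ 2 * + v *_) (K′-entry b c s t x y) ⟨
      + 2 * + v * K′ (vertex b s x) (vertex c t y) ∎

    K′·K′ : ∀ y z → (K′ · K′) y z ≡ + 2 * + v * K y z
    K′·K′ = ∀-vertex λ b s x → ∀-vertex λ c t y → begin
      (K′ · K′) (vertex b s x) (vertex c t y)
        ≡⟨ ·-halves K′ K′ _ _ (λ d → S d c) (λ d u l → K′-entry d c u t l y) ⟩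
      ∑ℤ 2 (λ d → halfSum K′ (vertex b s x) d * S d c)
        ≡⟨ ∑-cong 2 (λ d → cong (_* S d c) (halfSum-const K′ _ d (S b d) (λ u l → K′-entry b d s u x l))) ⟩
      ∑ℤ 2 (λ d → S b d * (+ 2 * + v) * S d c)
        ≡⟨ S·S b c (+ 2 * + v) ⟩
      + 2 * + v * Id 2 b c
        ≡⟨ cong (+ 2 * + v *_) (K-entry b c s t x y) ⟨
      + 2 * + v * K (vertex b s x) (vertex c t y) ∎

    A₃·K : ∀ y z → (A 3F · K) y z ≡ k * K′ y z
    A₃·K = ∀-vertex λ b s x → ∀-vertex λ c t y → begin
      (A 3F · K) (vertex b s x) (vertex c t y)
        ≡⟨ ·-halves (A 3F) K _ _ (λ d → Id 2 d c) (λ d u l → K-entry d c u t l y) ⟩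
      ∑ℤ 2 (λ d → halfSum (A 3F) (vertex b s x) d * Id 2 d c)
        ≡⟨ ∑-cong 2 (λ d → cong (_* Id 2 d c) (halfSum-A₃ b s x d)) ⟩
      ∑ℤ 2 (λ d → S b d * k * Id 2 d c)
        ≡⟨ S·Id b c k ⟩
      k * S b c
        ≡⟨ cong (k *_) (K′-entry b c s t x y) ⟨
      k * K′ (vertex b s x) (vertex c t y) ∎

    A₃·K′ : ∀ y z → (A 3F · K′) y z ≡ k * K y z
    A₃·K′ = ∀-vertex λ b s x → ∀-vertex λ c t y → begin
      (A 3F · K′) (vertex b s x) (vertex c t y)
        ≡⟨ ·-halves (A 3F) K′ _ _ (λ d → S d c) (λ d u l → K′-entry d c u t l y) ⟩
      ∑ℤ 2 (λ d → halfSum (A 3F) (vertex b s x) d * S d c)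
        ≡⟨ ∑-cong 2 (λ d → cong (_* S d c) (halfSum-A₃ b s x d)) ⟩
      ∑ℤ 2 (λ d → S b d * k * S d c)
        ≡⟨ S·S b c k ⟩
      k * Id 2 b c
        ≡⟨ cong (k *_) (K-entry b c s t x y) ⟨
      k * K (vertex b s x) (vertex c t y) ∎

    halfProduct : Fin N → Fin N → Fin 2 → ℤ
    halfProduct y z d = ∑ℤ 2 (λ u → ∑ℤ v (λ l → A 3F y (vertex d u l) * A 3F z (vertex d u l)))

    A₃·A₃≡halves : ∀ y z → (A 3F · A 3F) y z ≡ ∑ℤ 2 (halfProduct y z)
    A₃·A₃≡halves y z = trans (∑-cong N (λ l → cong (A 3F y l *_) (A-sym 3F l z))) (∑-vertex (λ l → A 3F y l * A 3F z l))

    halfProduct-zeroˡ : ∀ b s x z → halfProduct (vertex b s x) z b ≡ 0ℤ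
    halfProduct-zeroˡ b s x z = ∑-zero 2 (λ u → ∑-zero v (λ l →
      trans (cong (_* A 3F z (vertex b u l)) (A₃-same b s u x l)) (ℤ.*-zeroˡ (A 3F z (vertex b u l)))))

    halfProduct-zeroʳ : ∀ c t y z → halfProduct z (vertex c t y) c ≡ 0ℤ
    halfProduct-zeroʳ c t y z = ∑-zero 2 (λ u → ∑-zero v (λ l →
      trans (cong (A 3F z (vertex c u l) *_) (A₃-same c t u y l)) (ℤ.*-zeroʳ (A 3F z (vertex c u l)))))

    -- For s = t the two copies contribute XXᵀ and YYᵀ, for s ≠ t they contribute XYᵀ and YXᵀ: the
    -- two relations of `SignedGram`. The half b = 1 is where the relations between columns are
    -- used.
    halfProduct-other : ∀ b s x t y → halfProduct (vertex b s x) (vertex b t y) (opposite b)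
                        ≡ k * (Id 2 s t * Id v x y) + μ * (1ℤ * (1ℤ - Id v x y))
    halfProduct-other b s x t y = trans
      (∑-cong 2 (λ u → ∑-cong v (λ l → cong₂ _*_ (A₃-other b s u x l) (A₃-other b t u y l)))) (go s t)
      where
      V = orient b
      X Y : Fin v → Fin v → ℤ
      X i l = pos (V i l)
      Y i l = neg (V i l)
      00-0 : ∀ p q p′ q′ → (1ℤ * p + 0ℤ * q) * (1ℤ * p′ + 0ℤ * q′) ≡ p * p′
      00-0 = solve-∀
      00-1 : ∀ p q p′ q′ → (0ℤ * p + 1ℤ * q) * (0ℤ * p′ + 1ℤ * q′) ≡ q * q′
      00-1 = solve-∀
      01-0 : ∀ p q p′ q′ → (1ℤ * p + 0ℤ * q) * (0ℤ * p′ + 1ℤ * q′) ≡ p * q′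
      01-0 = solve-∀
      01-1 : ∀ p q p′ q′ → (0ℤ * p + 1ℤ * q) * (1ℤ * p′ + 0ℤ * q′) ≡ q * p′
      01-1 = solve-∀
      p+q : ∀ p q → p + (q + 0ℤ) ≡ p + q
      p+q = solve-∀
      q+p : ∀ p q → q + (p + 0ℤ) ≡ p + q
      q+p = solve-∀
      same : ∀ k μ δ → (k - μ) * δ + μ ≡ k * (1ℤ * δ) + μ * (1ℤ * (1ℤ - δ))
      same = solve-∀
      opp : ∀ k μ δ → - μ * δ + μ ≡ k * (0ℤ * δ) + μ * (1ℤ * (1ℤ - δ))
      opp = solve-∀
      combineHalves : ∀ {f g : Fin v → ℤ} {f′ g′ : Fin v → ℤ} → (∀ l → f l ≡ f′ l) → (∀ l → g l ≡ g′ l) →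
                ∑ℤ v f + (∑ℤ v g + 0ℤ) ≡ ∑ℤ v f′ + (∑ℤ v g′ + 0ℤ)
      combineHalves f≡ g≡ = cong₂ (λ p q → p + (q + 0ℤ)) (∑-cong v f≡) (∑-cong v g≡)
      XX = ∑ℤ v (λ l → X x l * X y l)
      YY = ∑ℤ v (λ l → Y x l * Y y l)
      XY = ∑ℤ v (λ l → X x l * Y y l)
      YX = ∑ℤ v (λ l → Y x l * X y l)
      go : ∀ s t → ∑ℤ 2 (λ u → ∑ℤ v (λ l → otherHalf 3F s u (V x l) * otherHalf 3F t u (V y l)))
           ≡ k * (Id 2 s t * Id v x y) + μ * (1ℤ * (1ℤ - Id v x y))
      go 0F 0F = trans (combineHalves (λ l → 00-0 (X x l) (Y x l) (X y l) (Y y l)) (λ l → 00-1 (X x l) (Y x l) (X y l) (Y y l)))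
        (trans (p+q XX YY) (trans (sameSigns (oriented b) x y) (same k μ (Id v x y))))
      go 1F 1F = trans (combineHalves (λ l → 00-1 (X x l) (Y x l) (X y l) (Y y l)) (λ l → 00-0 (X x l) (Y x l) (X y l) (Y y l)))
        (trans (q+p XX YY) (trans (sameSigns (oriented b) x y) (same k μ (Id v x y))))
      go 0F 1F = trans (combineHalves (λ l → 01-0 (X x l) (Y x l) (X y l) (Y y l)) (λ l → 01-1 (X x l) (Y x l) (X y l) (Y y l)))
        (trans (p+q XY YX) (trans (oppositeSigns (oriented b) x y) (opp k μ (Id v x y))))
      go 1F 0F = trans (combineHalves (λ l → 01-1 (X x l) (Y x l) (X y l) (Y y l)) (λ l → 01-0 (X x l) (Y x l) (X y l) (Y y l)))
        (trans (q+p XY YX) (trans (oppositeSigns (oriented b) x y) (opp k μ (Id v x y))))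

    A₃·A₃ : ∀ y z → (A 3F · A 3F) y z ≡ k * A 0F y z + μ * A 2F y z
    A₃·A₃ = ∀-vertex λ b s x → ∀-vertex λ c t y → trans (A₃·A₃≡halves (vertex b s x) (vertex c t y))
      (trans (go b s x c t y) (sym (cong₂ (λ p q → k * p + μ * q) (A-entry 0F b c s t x y) (A-entry 2F b c s t x y))))
      where
      0+p : ∀ p → 0ℤ + (p + 0ℤ) ≡ p
      0+p = solve-∀
      p+0 : ∀ p → p + (0ℤ + 0ℤ) ≡ p
      p+0 = solve-∀
      zeros : ∀ k μ → 0ℤ + (0ℤ + 0ℤ) ≡ k * 0ℤ + μ * 0ℤ
      zeros = solve-∀
      go : ∀ b s x c t y → ∑ℤ 2 (halfProduct (vertex b s x) (vertex c t y))
           ≡ k * entry 0F b c s t (Id v x y) (orient b x y) + μ * entry 2F b c s t (Id v x y) (orient b x y)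
      go 0F s x 0F t y = trans (cong₂ (λ p q → p + (q + 0ℤ)) (halfProduct-zeroˡ 0F s x (vertex 0F t y)) (halfProduct-other 0F s x t y))
                               (0+p _)
      go 1F s x 1F t y = trans (cong₂ (λ p q → p + (q + 0ℤ)) (halfProduct-other 1F s x t y) (halfProduct-zeroˡ 1F s x (vertex 1F t y)))
                               (p+0 _)
      -- A₃ joins opposite halves only, so vertices in different halves have no common neighbour and
      -- A₃² vanishes there.
      go 0F s x 1F t y = trans (cong₂ (λ p q → p + (q + 0ℤ)) (halfProduct-zeroˡ 0F s x (vertex 1F t y)) (halfProduct-zeroʳ 1F t y (vertex 0F s x)))
                               (zeros k μ)
      go 1F s x 0F t y = trans (cong₂ (λ p q → p + (q + 0ℤ)) (halfProduct-zeroʳ 0F t y (vertex 1F s x)) (halfProduct-zeroˡ 1F s x (vertex 0F t y)))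
                               (zeros k μ)

    relations : Relations A (+ v) k μ
    relations = record
      { A-sym = A-sym ; A₀≡Id = A₀≡Id ; A₁·A = A₁·A ; K·K = K·K ; K·K′ = K·K′ ; K′·K′ = K′·K′
      ; A₃·K = A₃·K ; A₃·K′ = A₃·K′ ; A₃·A₃ = A₃·A₃ }

  -- The association scheme

  module Scheme {v k : ℕ} {W : Mat ℤ v v} (0<k : 0 ℕ.< k) (k<v : k ℕ.< v) {μ : ℤ} (G : SignedGram (+ k) μ W) where
    open Entries W
    open Entrywise G
    open Closure relations
    open SignedGram G

    1<v : 1 ℕ.< v
    1<v = ℕ.≤-<-trans 0<k k<v

    x₀ x₁ : Fin v
    x₀ = Fin.fromℕ< (ℕ.<-trans ℕ.z<s 1<v)
    x₁ = Fin.fromℕ< 1<v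

    x₀≢x₁ : x₀ ≢ x₁
    x₀≢x₁ eq with trans (sym (Fin.toℕ-fromℕ< (ℕ.<-trans ℕ.z<s 1<v))) (trans (cong Fin.toℕ eq) (Fin.toℕ-fromℕ< 1<v))
    ... | ()

    ∃-nonzero : ∃ λ l → W x₀ l ≢ 0ℤ
    ∃-nonzero with Fin.any? (λ l → ¬? (W x₀ l ℤ.≟ 0ℤ))
    ... | yes found = found
    ... | no none = ⊥-elim (ℕ.<⇒≢ 0<k (sym (ℤ.+-injective (trans (sym (rowSum x₀)) (∑-zero v zeros)))))
      where
      zeros : ∀ l → ∣ W ∣ₘ x₀ l ≡ 0ℤ
      zeros l with W x₀ l ℤ.≟ 0ℤ
      ... | yes eq = cong (λ w → pos w + neg w) eq
      ... | no neq = ⊥-elim (none (l , neq))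

    -- A row without zeros would have weight v, against k < v. The zero is what makes A₅ nonzero, as
    -- `∃-nonzero` does for A₃ and A₄.
    ∃-zero : ∃ λ l → W x₀ l ≡ 0ℤ
    ∃-zero with Fin.any? (λ l → W x₀ l ℤ.≟ 0ℤ)
    ... | yes found = found
    ... | no none = ⊥-elim (ℕ.<⇒≢ k<v (ℤ.+-injective (trans (sym (rowSum x₀))
        (trans (∑-cong v ones) (trans (∑-const v 1ℤ) (ℤ.*-identityʳ (+ v)))))))
      where
      ones : ∀ l → ∣ W ∣ₘ x₀ l ≡ 1ℤ
      ones l with entries x₀ l
      ... | inj₁ eq        = ⊥-elim (none (l , eq))
      ... | inj₂ (inj₁ eq) = cong (λ w → pos w + neg w) eq
      ... | inj₂ (inj₂ eq) = cong (λ w → pos w + neg w) eq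

    A-nonzero : ∀ i → ∃₂ λ y z → A i y z ≢ 0ℤ
    A-nonzero i = go i
      where
      ≡1⇒≢0 : ∀ {a} → a ≡ 1ℤ → a ≢ 0ℤ
      ≡1⇒≢0 refl ()
      same : ∀ i t x δ → Id v x₀ x ≡ δ → sameHalf i 0F t δ ≡ 1ℤ → ∃₂ λ y z → A i y z ≢ 0ℤ
      same i t x δ refl eq = vertex 0F 0F x₀ , vertex 0F t x , ≡1⇒≢0 (trans (A-entry i 0F 0F 0F t x₀ x) eq)
      other : ∀ i t x w → W x₀ x ≡ w → otherHalf i 0F t w ≡ 1ℤ → ∃₂ λ y z → A i y z ≢ 0ℤ
      other i t x w refl eq = vertex 0F 0F x₀ , vertex 1F t x , ≡1⇒≢0 (trans (A-entry i 0F 1F 0F t x₀ x) eq)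
      go : ∀ i → ∃₂ λ y z → A i y z ≢ 0ℤ
      go 0F = same 0F 0F x₀ 1ℤ (Id-diag v x₀) refl
      go 1F = same 1F 1F x₀ 1ℤ (Id-diag v x₀) refl
      go 2F = same 2F 0F x₁ 0ℤ (Id-off v x₀≢x₁) refl
      go 3F with ∃-nonzero
      ... | l , neq with entries x₀ l
      ... | inj₁ eq        = ⊥-elim (neq eq)
      ... | inj₂ (inj₁ eq) = other 3F 0F l 1ℤ eq refl
      -- An entry -1 of W enters A₃ through the summand with S, hence the column in copy 1.
      ... | inj₂ (inj₂ eq) = other 3F 1F l (- 1ℤ) eq refl
      go 4F with ∃-nonzero
      ... | l , neq with entries x₀ l
      ... | inj₁ eq        = ⊥-elim (neq eq)
      ... | inj₂ (inj₁ eq) = other 4F 1F l 1ℤ eq refl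
      ... | inj₂ (inj₂ eq) = other 4F 0F l (- 1ℤ) eq refl
      go 5F with ∃-zero
      ... | l , eq = other 5F 0F l 0ℤ eq refl

    isSymAssocScheme : IsSymAssocScheme N 5 (schemeA v W)
    isSymAssocScheme = record
      { zeroOne   = A-01
      ; nonzero   = A-nonzero
      ; A₀≡I      = A₀≡Id
      ; sum≡J     = A-sum
      ; symmetric = A-sym
      ; closed    = (λ i j → Span.coeffs (product i j)) , λ i j → Span.expand (product i j)
      }

    vertex₀ : Fin N
    vertex₀ = vertex 0F 0F x₀

    A-diag : ∀ i → A (suc i) vertex₀ vertex₀ ≡ 0ℤ
    A-diag i = trans (A-entry (suc i) 0F 0F 0F 0F x₀ x₀) (trans (cong (sameHalf (suc i) 0F 0F) (Id-diag v x₀)) (off i))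
      where
      off : ∀ i → sameHalf (suc i) 0F 0F 1ℤ ≡ 0ℤ
      off 0F = refl
      off 1F = refl
      off 2F = refl
      off 3F = refl
      off 4F = refl

-- Arithmetic in an ordered field with square roots

module FieldArithmetic {c ℓ ℓ′} (F : OrderedFieldWithSqrt c ℓ ℓ′) where
  open OrderedFieldWithSqrt F
  open OverField F
  open CommutativeRing commRing using (setoid; ring; refl; sym; trans; reflexive;
    +-cong; +-congˡ; +-congʳ; +-assoc; +-comm; +-identityˡ; +-identityʳ; -‿inverseʳ; -‿cong;
    *-cong; *-congˡ; *-congʳ; *-assoc; *-identityˡ; *-identityʳ; zeroˡ; distribʳ)
  open RingProperties ring using (-‿distribˡ-*; -‿distribʳ-*; -‿involutive; -‿+-comm; -0#≈0#)
  open SetoidReasoning setoid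

  natF-+ : ∀ m n → natF (m ℕ.+ n) ≈ natF m + natF n
  natF-+ ℕ.zero    n = sym (+-identityˡ _)
  natF-+ (ℕ.suc m) n = trans (+-congˡ (natF-+ m n)) (sym (+-assoc 1# _ _))

  natF-* : ∀ m n → natF (m ℕ.* n) ≈ natF m * natF n
  natF-* ℕ.zero    n = sym (zeroˡ _)
  natF-* (ℕ.suc m) n = begin
    natF (n ℕ.+ m ℕ.* n)          ≈⟨ natF-+ n (m ℕ.* n) ⟩
    natF n + natF (m ℕ.* n)       ≈⟨ +-cong (sym (*-identityˡ _)) (natF-* m n) ⟩
    1# * natF n + natF m * natF n ≈⟨ distribʳ _ _ _ ⟨
    (1# + natF m) * natF n        ∎

  intF-neg : ∀ i → intF (ℤ.- i) ≈ - intF i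
  intF-neg (+ ℕ.zero)    = sym -0#≈0#
  intF-neg (+ ℕ.suc n)   = refl
  intF-neg -[1+ n ]      = sym (-‿involutive _)

  -- Integer addition of mixed signs computes through `⊖`, so this is the only nontrivial case of
  -- `intF-+`.
  intF-⊖ : ∀ m n → intF (m ℤ.⊖ n) ≈ natF m + - natF n
  intF-⊖ m         ℕ.zero    = sym (trans (+-congˡ -0#≈0#) (+-identityʳ _))
  intF-⊖ ℕ.zero    (ℕ.suc n) = sym (+-identityˡ _)
  intF-⊖ (ℕ.suc m) (ℕ.suc n) = begin
    intF (ℕ.suc m ℤ.⊖ ℕ.suc n)             ≡⟨ ≡.cong intF (ℤ.[1+m]⊖[1+n]≡m⊖n m n) ⟩
    intF (m ℤ.⊖ n)                         ≈⟨ intF-⊖ m n ⟩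
    natF m + - natF n                      ≈⟨ +-congʳ (+-identityʳ _) ⟨
    natF m + 0# + - natF n                 ≈⟨ +-congʳ (+-congˡ (-‿inverseʳ 1#)) ⟨
    natF m + (1# + - 1#) + - natF n        ≈⟨ +-congʳ (+-assoc _ _ _) ⟨
    natF m + 1# + - 1# + - natF n          ≈⟨ +-assoc _ _ _ ⟩
    natF m + 1# + (- 1# + - natF n)        ≈⟨ +-cong (+-comm _ _) (-‿+-comm 1# _) ⟩
    (1# + natF m) + - (1# + natF n)        ∎

  intF-+ : ∀ i j → intF (i ℤ.+ j) ≈ intF i + intF j
  intF-+ (+ m)    (+ n)    = natF-+ m n
  intF-+ (+ m)    -[1+ n ] = intF-⊖ m (ℕ.suc n)
  intF-+ -[1+ m ] (+ n)    = trans (intF-⊖ n (ℕ.suc m)) (+-comm _ _)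
  intF-+ -[1+ m ] -[1+ n ] = begin
    - natF (ℕ.suc (ℕ.suc (m ℕ.+ n)))        ≡⟨ ≡.cong (λ x → - natF x) (≡.cong ℕ.suc (ℕ.+-suc m n)) ⟨
    - natF (ℕ.suc m ℕ.+ ℕ.suc n)            ≈⟨ -‿cong (natF-+ (ℕ.suc m) (ℕ.suc n)) ⟩
    - (natF (ℕ.suc m) + natF (ℕ.suc n))     ≈⟨ -‿+-comm _ _ ⟨
    - natF (ℕ.suc m) + - natF (ℕ.suc n)     ∎

  intF-*-pos : ∀ m j → intF (+ m ℤ.* j) ≈ natF m * intF j
  intF-*-pos m (+ n) = trans (reflexive (≡.cong intF (≡.sym (ℤ.pos-* m n)))) (natF-* m n)
  intF-*-pos m -[1+ n ] = begin
    intF (+ m ℤ.* ℤ.- (+ ℕ.suc n))    ≡⟨ ≡.cong intF (≡.sym (ℤ.neg-distribʳ-* (+ m) (+ ℕ.suc n))) ⟩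
    intF (ℤ.- (+ m ℤ.* + ℕ.suc n))    ≈⟨ intF-neg (+ m ℤ.* + ℕ.suc n) ⟩
    - intF (+ m ℤ.* + ℕ.suc n)        ≈⟨ -‿cong (intF-*-pos m (+ ℕ.suc n)) ⟩
    - (natF m * natF (ℕ.suc n))       ≈⟨ -‿distribʳ-* _ _ ⟩
    natF m * - natF (ℕ.suc n)         ∎

  intF-* : ∀ i j → intF (i ℤ.* j) ≈ intF i * intF j
  intF-* (+ m)    j = intF-*-pos m j
  intF-* -[1+ m ] j = begin
    intF (ℤ.- (+ ℕ.suc m) ℤ.* j)      ≡⟨ ≡.cong intF (≡.sym (ℤ.neg-distribˡ-* (+ ℕ.suc m) j)) ⟩
    intF (ℤ.- (+ ℕ.suc m ℤ.* j))      ≈⟨ intF-neg (+ ℕ.suc m ℤ.* j) ⟩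
    - intF (+ ℕ.suc m ℤ.* j)          ≈⟨ -‿cong (intF-*-pos (ℕ.suc m) j) ⟩
    - (natF (ℕ.suc m) * intF j)       ≈⟨ -‿distribˡ-* _ _ ⟩
    - natF (ℕ.suc m) * intF j         ∎

  -- The image of ℤ in normal form, such that the coefficients 0, 1 and 2 of the
  -- ring solver denote 0#, 1# and 1# + 1# on the nose.
  coeffℕ : ℕ → Carrier
  coeffℕ 0                 = 0#
  coeffℕ 1                 = 1#
  coeffℕ (ℕ.suc (ℕ.suc n)) = 1# + coeffℕ (ℕ.suc n)

  coeff : ℤ → Carrier
  coeff (+ n)    = coeffℕ n
  coeff -[1+ n ] = - coeffℕ (ℕ.suc n)

  coeffℕ≈natF : ∀ n → coeffℕ n ≈ natF n
  coeffℕ≈natF 0                 = refl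
  coeffℕ≈natF 1                 = sym (+-identityʳ 1#)
  coeffℕ≈natF (ℕ.suc (ℕ.suc n)) = +-congˡ (coeffℕ≈natF (ℕ.suc n))

  coeff≈intF : ∀ i → coeff i ≈ intF i
  coeff≈intF (+ n)    = coeffℕ≈natF n
  coeff≈intF -[1+ n ] = -‿cong (coeffℕ≈natF (ℕ.suc n))

  ℤ⟶F : CommutativeRing.rawRing ℤ.+-*-commutativeRing -Raw-AlmostCommutative⟶ fromCommutativeRing commRing
  ℤ⟶F = record
    { ⟦_⟧    = coeff
    ; +-homo = λ i j → trans (coeff≈intF (i ℤ.+ j)) (trans (intF-+ i j) (+-cong (sym (coeff≈intF i)) (sym (coeff≈intF j))))
    ; *-homo = λ i j → trans (coeff≈intF (i ℤ.* j)) (trans (intF-* i j) (*-cong (sym (coeff≈intF i)) (sym (coeff≈intF j))))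
    ; -‿homo = λ i → trans (coeff≈intF (ℤ.- i)) (trans (intF-neg i) (-‿cong (sym (coeff≈intF i))))
    ; 0-homo = refl
    ; 1-homo = refl
    }

  -- The solver compares integer coefficients, because equality in F need not be decidable.
  coeff≟ : ∀ i j → Maybe (coeff i ≈ coeff j)
  coeff≟ i j with i ℤ.≟ j
  ... | yes i≡j = just (reflexive (≡.cong coeff i≡j))
  ... | no _    = nothing

  open RingSolver (CommutativeRing.rawRing ℤ.+-*-commutativeRing) (fromCommutativeRing commRing) ℤ⟶F coeff≟
    public using (solve; _:=_; _:+_; _:*_; :-_; _:-_; con)

  open IsTotalOrder isTotalOrder using (total; antisym) renaming (trans to ≤-trans; reflexive to ≤-reflexive)

  +-nonneg : ∀ {x y} → 0# ≤ x → 0# ≤ y → 0# ≤ (x + y)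
  +-nonneg {x} {y} 0≤x 0≤y = ≤-trans 0≤y (≤-trans (≤-reflexive (sym (+-identityˡ y))) (+-mono-≤ y 0≤x))

  square-nonneg : ∀ x → 0# ≤ (x * x)
  square-nonneg x with total 0# x
  ... | inj₁ 0≤x = *-nonneg 0≤x 0≤x
  ... | inj₂ x≤0 = ≤-trans (*-nonneg 0≤-x 0≤-x) (≤-reflexive (solve 1 (λ x → (:- x) :* (:- x) := x :* x) refl x))
    where
    0≤-x : 0# ≤ (- x)
    0≤-x = ≤-trans (≤-reflexive (sym (-‿inverseʳ x))) (≤-trans (+-mono-≤ (- x) x≤0) (≤-reflexive (+-identityˡ _)))

  0≤1 : 0# ≤ 1#
  0≤1 = ≤-trans (square-nonneg 1#) (≤-reflexive (*-identityˡ 1#))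

  natF-nonneg : ∀ n → 0# ≤ natF n
  natF-nonneg ℕ.zero    = ≤-reflexive refl
  natF-nonneg (ℕ.suc n) = +-nonneg 0≤1 (natF-nonneg n)

  nonneg-+≈0 : ∀ {x y} → 0# ≤ x → 0# ≤ y → x + y ≈ 0# → y ≈ 0#
  nonneg-+≈0 {x} {y} 0≤x 0≤y x+y≈0 = antisym
    (≤-trans (≤-reflexive (sym (+-identityˡ y))) (≤-trans (+-mono-≤ y 0≤x) (≤-reflexive x+y≈0))) 0≤y

  -- The order forces characteristic 0: in a vanishing sum of nonnegative terms 1 and n, the term 1
  -- would be 0.
  natF-≉0 : ∀ {n} → 0 ℕ.< n → ¬ (natF n ≈ 0#)
  natF-≉0 {ℕ.suc n} _ eq = 0≉1 (sym (nonneg-+≈0 (natF-nonneg n) 0≤1 (trans (+-comm _ _) eq)))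

  *-cancelʳ-≈0 : ∀ {x y} → ¬ (y ≈ 0#) → x * y ≈ 0# → x ≈ 0#
  *-cancelʳ-≈0 {x} {y} y≉0 xy≈0 = begin
    x              ≈⟨ *-identityʳ x ⟨
    x * 1#         ≈⟨ *-congˡ (⁻¹-inverse y y≉0) ⟨
    x * (y * y ⁻¹) ≈⟨ *-assoc x y _ ⟨
    x * y * y ⁻¹   ≈⟨ *-congʳ xy≈0 ⟩
    0# * y ⁻¹      ≈⟨ zeroˡ _ ⟩
    0#             ∎

  *-cancelʳ : ∀ {x y} z → ¬ (z ≈ 0#) → x * z ≈ y * z → x ≈ y
  *-cancelʳ {x} {y} z z≉0 xz≈yz = begin
    x             ≈⟨ solve 2 (λ x y → x := (x :- y) :+ y) refl x y ⟩
    (x + - y) + y ≈⟨ +-congʳ (*-cancelʳ-≈0 z≉0 difference) ⟩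
    0# + y        ≈⟨ +-identityˡ y ⟩
    y             ∎
    where
    difference : (x + - y) * z ≈ 0#
    difference = begin
      (x + - y) * z    ≈⟨ solve 3 (λ x y z → (x :- y) :* z := x :* z :- y :* z) refl x y z ⟩
      x * z + - (y * z) ≈⟨ +-congʳ xz≈yz ⟩
      y * z + - (y * z) ≈⟨ -‿inverseʳ _ ⟩
      0#               ∎

  *-≉0 : ∀ {x y} → ¬ (x ≈ 0#) → ¬ (y ≈ 0#) → ¬ (x * y ≈ 0#)
  *-≉0 x≉0 y≉0 xy≈0 = x≉0 (*-cancelʳ-≈0 y≉0 xy≈0)

  -- The inverse equals x(x⁻¹)², a product of nonnegative factors.
  ⁻¹-nonneg : ∀ {x} → 0# ≤ x → ¬ (x ≈ 0#) → 0# ≤ (x ⁻¹)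
  ⁻¹-nonneg {x} 0≤x x≉0 = ≤-trans (*-nonneg 0≤x (square-nonneg (x ⁻¹))) (≤-reflexive (begin
    x * (x ⁻¹ * x ⁻¹) ≈⟨ *-assoc x _ _ ⟨
    x * x ⁻¹ * x ⁻¹   ≈⟨ *-congʳ (⁻¹-inverse x x≉0) ⟩
    1# * x ⁻¹         ≈⟨ *-identityˡ _ ⟩
    x ⁻¹              ∎))

  -- x(x + y) = y(x + y), and x + y may be cancelled: if it were 0, nonnegativity would force y to
  -- be 0.
  square-injective : ∀ {x y} → 0# ≤ x → 0# ≤ y → ¬ (y ≈ 0#) → x * x ≈ y * y → x ≈ y
  square-injective {x} {y} 0≤x 0≤y y≉0 x²≈y² = *-cancelʳ (x + y) (λ eq → y≉0 (nonneg-+≈0 0≤x 0≤y eq)) (begin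
    x * (x + y)   ≈⟨ solve 2 (λ x y → x :* (x :+ y) := x :* x :+ x :* y) refl x y ⟩
    x * x + x * y ≈⟨ +-congʳ x²≈y² ⟩
    y * y + x * y ≈⟨ solve 2 (λ x y → y :* y :+ x :* y := y :* (x :+ y)) refl x y ⟩
    y * (x + y)   ∎)

  /ₙ-nonneg : ∀ a {b} → 0 ℕ.< b → 0# ≤ (a /ₙ b)
  /ₙ-nonneg a {b} 0<b = *-nonneg (natF-nonneg a) (⁻¹-nonneg (natF-nonneg b) (natF-≉0 0<b))

  /ₙ-* : ∀ a {b} → 0 ℕ.< b → (a /ₙ b) * natF b ≈ natF a
  /ₙ-* a {b} 0<b = begin
    natF a * natF b ⁻¹ * natF b   ≈⟨ solve 3 (λ a b i → a :* i :* b := a :* (b :* i)) refl (natF a) (natF b) (natF b ⁻¹) ⟩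
    natF a * (natF b * natF b ⁻¹) ≈⟨ *-congˡ (⁻¹-inverse _ (natF-≉0 0<b)) ⟩
    natF a * 1#                   ≈⟨ *-identityʳ _ ⟩
    natF a                        ∎

  -- Whether x is 0 cannot be tested, but x and 1 - x can be compared. The larger of them is not 0,
  -- for otherwise 1 ≤ 0, and it can be cancelled from x(1 - x) = 0 or from x² = x.
  idempotent⇒0∨1 : ∀ {x} → x * x ≈ x → x ≈ 0# ⊎ x ≈ 1#
  idempotent⇒0∨1 {x} x²≈x with total x (1# + - x)
  ... | inj₁ x≤1-x = inj₁ (*-cancelʳ-≈0 1-x≉0 x[1-x]≈0)
    where
    x[1-x]≈0 : x * (1# + - x) ≈ 0#
    x[1-x]≈0 = begin
      x * (1# + - x)  ≈⟨ solve 1 (λ x → x :* (con 1ℤ :- x) := x :- x :* x) refl x ⟩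
      x + - (x * x)   ≈⟨ +-congˡ (-‿cong x²≈x) ⟩
      x + - x         ≈⟨ -‿inverseʳ x ⟩
      0#              ∎
    1-x≉0 : ¬ (1# + - x ≈ 0#)
    1-x≉0 eq = 0≉1 (antisym 0≤1 (≤-trans (≤-reflexive 1≈x) (≤-trans x≤1-x (≤-reflexive eq))))
      where
      1≈x : 1# ≈ x
      1≈x = trans (solve 1 (λ x → con 1ℤ := (con 1ℤ :- x) :+ x) refl x) (trans (+-congʳ eq) (+-identityˡ x))
  ... | inj₂ 1-x≤x = inj₂ (*-cancelʳ x x≉0 (trans x²≈x (sym (*-identityˡ x))))
    where
    x≉0 : ¬ (x ≈ 0#)
    x≉0 eq = 0≉1 (antisym 0≤1 (≤-trans (≤-reflexive 1≈1-x) (≤-trans 1-x≤x (≤-reflexive eq))))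
      where
      1≈1-x : 1# ≈ 1# + - x
      1≈1-x = trans (sym (+-identityʳ 1#)) (+-congˡ (trans (sym -0#≈0#) (-‿cong (sym eq))))

open IntegerMatrices using (Relations; within; across; σ; Id-diag; module Closure)

-- Common eigenvectors in the Bose-Mesner algebra

module Eigenspaces {c ℓ ℓ′} (F : OrderedFieldWithSqrt c ℓ ℓ′)
  {N : ℕ} {A : Fin 6 → Mat ℤ N N} {v k μ : ℤ} (R : Relations A v k μ) where
  open OrderedFieldWithSqrt F
  open OverField F
  open FieldArithmetic F
  open CommutativeRing commRing using (setoid; refl; sym; trans; reflexive;
    +-cong; +-congˡ; +-congʳ; +-identityʳ; -‿cong;
    *-cong; *-congˡ; *-congʳ; *-assoc; *-comm; *-identityˡ; zeroˡ; zeroʳ)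
  open SetoidReasoning setoid
  private module M = Matrices commRing
  module R = Relations R

  intF-∑ : ∀ n (f : Fin n → ℤ) → intF (∑ℤ n f) ≈ M.∑ᵣ n (λ i → intF (f i))
  intF-∑ ℕ.zero    f = refl
  intF-∑ (ℕ.suc n) f = trans (intF-+ (f zero) _) (+-congˡ (intF-∑ n (λ i → f (suc i))))

  lift-· : ∀ (M L : Mat ℤ N N) → (liftₘ M ×ₘ liftₘ L) ≋ liftₘ (M · L)
  lift-· M L x y = sym (trans (intF-∑ N _) (M.∑-cong N (λ l → intF-* (M x l) (L l y))))

  lift-≡ : ∀ {M L : Mat ℤ N N} → (∀ x y → M x y ≡ L x y) → liftₘ M ≋ liftₘ L
  lift-≡ M≡L x y = reflexive (≡.cong intF (M≡L x y))

  lift-product : ∀ (M L P : Mat ℤ N N) → (∀ x y → (M · L) x y ≡ P x y) → (liftₘ M ×ₘ liftₘ L) ≋ liftₘ P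
  lift-product M L P ML≡P x y = trans (lift-· M L x y) (lift-≡ {M · L} {P} ML≡P x y)

  lift-sum₃ : ∀ (P Q S : Mat ℤ N N) x y → intF (P x y ℤ.+ Q x y ℤ.+ S x y) ≈ liftₘ P x y + liftₘ Q x y + liftₘ S x y
  lift-sum₃ P Q S x y = trans (intF-+ (P x y ℤ.+ Q x y) (S x y)) (+-congʳ (intF-+ (P x y) (Q x y)))

  B : Fin 6 → MatF N
  B i = liftₘ (A i)

  K K′ : MatF N
  K  = liftₘ (within A)
  K′ = liftₘ (across A)

  vF kF mF : Carrier
  vF = intF v
  kF = intF k
  mF = intF μ

  K≈ : ∀ x y → K x y ≈ B 0F x y + B 1F x y + B 2F x y
  K≈ = lift-sum₃ (A 0F) (A 1F) (A 2F)

  K′≈ : ∀ x y → K′ x y ≈ B 3F x y + B 4F x y + B 5F x y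
  K′≈ = lift-sum₃ (A 3F) (A 4F) (A 5F)

  B₀B : ∀ i → (B 0F ×ₘ B i) ≋ B i
  B₀B i = lift-product (A 0F) (A i) (A i) (Closure.A₀· R (A i))

  B₁B : ∀ i → (B 1F ×ₘ B i) ≋ B (σ i)
  B₁B i = lift-product (A 1F) (A i) (A (σ i)) (R.A₁·A i)

  Sym : MatF N → Set ℓ
  Sym M = ∀ x y → M x y ≈ M y x

  B-sym : ∀ i → Sym (B i)
  B-sym i x y = reflexive (≡.cong intF (R.A-sym i x y))

  ×-swap : ∀ M L → Sym M → Sym L → ∀ x y → (L ×ₘ M) x y ≈ (M ×ₘ L) y x
  ×-swap M L sM sL x y = trans (M.⊡-ᵀ L M x y) (M.∑-cong N (λ l → *-cong (sM l y) (sL x l)))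

  ×-sum₃ : ∀ (L P Q S : MatF N) x y →
           ((λ x y → P x y + Q x y + S x y) ×ₘ L) x y ≈ (P ×ₘ L) x y + (Q ×ₘ L) x y + (S ×ₘ L) x y
  ×-sum₃ L P Q S x y = begin
    M.∑ᵣ N (λ l → (P x l + Q x l + S x l) * L l y)
      ≈⟨ M.∑-cong N (λ l → solve 4 (λ p q s m → (p :+ q :+ s) :* m := p :* m :+ q :* m :+ s :* m) refl (P x l) (Q x l) (S x l) (L l y)) ⟩
    M.∑ᵣ N (λ l → P x l * L l y + Q x l * L l y + S x l * L l y)
      ≈⟨ M.∑-+ N _ _ ⟩
    M.∑ᵣ N (λ l → P x l * L l y + Q x l * L l y) + (S ×ₘ L) x y
      ≈⟨ +-congʳ (M.∑-+ N _ _) ⟩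
    (P ×ₘ L) x y + (Q ×ₘ L) x y + (S ×ₘ L) x y ∎

  K× : ∀ L x y → (K ×ₘ L) x y ≈ (B 0F ×ₘ L) x y + (B 1F ×ₘ L) x y + (B 2F ×ₘ L) x y
  K× L x y = trans (M.⊡-congʳ L K≈ x y) (×-sum₃ L (B 0F) (B 1F) (B 2F) x y)

  K′× : ∀ L x y → (K′ ×ₘ L) x y ≈ (B 3F ×ₘ L) x y + (B 4F ×ₘ L) x y + (B 5F ×ₘ L) x y
  K′× L x y = trans (M.⊡-congʳ L K′≈ x y) (×-sum₃ L (B 3F) (B 4F) (B 5F) x y)

  B₄× : ∀ L x y → (B 4F ×ₘ L) x y ≈ (B 1F ×ₘ (B 3F ×ₘ L)) x y
  B₄× L x y = trans (M.⊡-congʳ L (λ x y → sym (B₁B 3F x y)) x y) (M.⊡-assoc (B 1F) (B 3F) L x y)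

  -- Left multiplication by A₁, A₃, K and K′ is most transparent in this basis.
  basis : Fin 6 → MatF N
  basis 0F = B 0F
  basis 1F = B 1F
  basis 2F = B 3F
  basis 3F = B 4F
  basis 4F = K
  basis 5F = K′

  ⟦_⟧ : (Fin 6 → Carrier) → MatF N
  ⟦ c ⟧ x y = M.∑ᵣ 6 (λ g → c g * basis g x y)

  -- Left multiplication by A₁, A₃, K and K′ on coefficient vectors. The terms of `L₃` with `mF`
  -- stem from A₃² = kA₀ + μA₂ after A₂ is replaced by K - A₀ - A₁.
  L₁ L₃ Lᴷ Lᴷ′ : (Fin 6 → Carrier) → Fin 6 → Carrier
  L₁ c 0F = c 1F
  L₁ c 1F = c 0F
  L₁ c 2F = c 3F
  L₁ c 3F = c 2F
  L₁ c 4F = c 4F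
  L₁ c 5F = c 5F
  L₃ c 0F = (kF + - mF) * c 2F + - (mF * c 3F)
  L₃ c 1F = (kF + - mF) * c 3F + - (mF * c 2F)
  L₃ c 2F = c 0F
  L₃ c 3F = c 1F
  L₃ c 4F = mF * (c 2F + c 3F) + kF * c 5F
  L₃ c 5F = kF * c 4F
  Lᴷ c 4F = c 0F + c 1F + (1# + 1#) * vF * c 4F
  Lᴷ c 5F = kF * (c 2F + c 3F) + (1# + 1#) * vF * c 5F
  Lᴷ c _  = 0#
  Lᴷ′ c 4F = kF * (c 2F + c 3F) + (1# + 1#) * vF * c 5F
  Lᴷ′ c 5F = c 0F + c 1F + (1# + 1#) * vF * c 4F
  Lᴷ′ c _  = 0#

  scaled : ∀ (M L P : Mat ℤ N N) z → (∀ x y → (M · L) x y ≡ z ℤ.* P x y) → ∀ x y → (liftₘ M ×ₘ liftₘ L) x y ≈ intF z * liftₘ P x y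
  scaled M L P z eq x y = trans (lift-product M L (λ x y → z ℤ.* P x y) eq x y) (intF-* z (P x y))

  doubled : ∀ (M L P : Mat ℤ N N) → (∀ x y → (M · L) x y ≡ + 2 ℤ.* v ℤ.* P x y) → ∀ x y → (liftₘ M ×ₘ liftₘ L) x y ≈ (1# + 1#) * vF * liftₘ P x y
  doubled M L P eq x y = trans (scaled M L P (+ 2 ℤ.* v) eq x y)
    (*-congʳ (trans (intF-* (+ 2) v) (*-congʳ (+-congˡ (+-identityʳ 1#)))))

  K-sym : Sym K
  K-sym x y = reflexive (≡.cong intF (Closure.K-sym R x y))

  K′-sym : Sym K′
  K′-sym x y = reflexive (≡.cong intF (Closure.K′-sym R x y))

  ×-comm : ∀ (M L P : MatF N) z → Sym M → Sym L → Sym P →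
           (∀ x y → (M ×ₘ L) x y ≈ z * P x y) → ∀ x y → (L ×ₘ M) x y ≈ z * P x y
  ×-comm M L P z sM sL sP eq x y = trans (×-swap M L sM sL x y) (trans (eq y x) (*-congˡ (sP y x)))

  ×1 : ∀ {x y} → x ≈ y → x ≈ 1# * y
  ×1 x≈y = trans x≈y (sym (*-identityˡ _))

  B₀K : ∀ x y → (B 0F ×ₘ K) x y ≈ 1# * K x y
  B₀K x y = ×1 (lift-product (A 0F) (within A) (within A) (Closure.A₀· R (within A)) x y)

  B₀K′ : ∀ x y → (B 0F ×ₘ K′) x y ≈ 1# * K′ x y
  B₀K′ x y = ×1 (lift-product (A 0F) (across A) (across A) (Closure.A₀· R (across A)) x y)

  B₁K : ∀ x y → (B 1F ×ₘ K) x y ≈ 1# * K x y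
  B₁K x y = ×1 (begin
    (B 1F ×ₘ K) x y
      ≈⟨ lift-· (A 1F) (within A) x y ⟩
    intF ((A 1F · within A) x y)
      ≡⟨ ≡.cong intF (≡.trans (Closure.·-sum₃ R (A 1F) (A 0F) (A 1F) (A 2F) x y)
           (≡.cong₂ ℤ._+_ (≡.cong₂ ℤ._+_ (R.A₁·A 0F x y) (R.A₁·A 1F x y)) (R.A₁·A 2F x y))) ⟩
    intF (A 1F x y ℤ.+ A 0F x y ℤ.+ A 2F x y)
      ≡⟨ ≡.cong (λ s → intF (s ℤ.+ A 2F x y)) (ℤ.+-comm (A 1F x y) (A 0F x y)) ⟩
    K x y ∎)

  B₁K′ : ∀ x y → (B 1F ×ₘ K′) x y ≈ 1# * K′ x y
  B₁K′ x y = ×1 (begin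
    (B 1F ×ₘ K′) x y
      ≈⟨ lift-· (A 1F) (across A) x y ⟩
    intF ((A 1F · across A) x y)
      ≡⟨ ≡.cong intF (≡.trans (Closure.·-sum₃ R (A 1F) (A 3F) (A 4F) (A 5F) x y)
           (≡.cong₂ ℤ._+_ (≡.cong₂ ℤ._+_ (R.A₁·A 3F x y) (R.A₁·A 4F x y)) (R.A₁·A 5F x y))) ⟩
    intF (A 4F x y ℤ.+ A 3F x y ℤ.+ A 5F x y)
      ≡⟨ ≡.cong (λ s → intF (s ℤ.+ A 5F x y)) (ℤ.+-comm (A 4F x y) (A 3F x y)) ⟩
    K′ x y ∎)

  B₃K : ∀ x y → (B 3F ×ₘ K) x y ≈ kF * K′ x y
  B₃K = scaled (A 3F) (within A) (across A) k R.A₃·K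

  B₃K′ : ∀ x y → (B 3F ×ₘ K′) x y ≈ kF * K x y
  B₃K′ = scaled (A 3F) (across A) (within A) k R.A₃·K′

  B₄K : ∀ x y → (B 4F ×ₘ K) x y ≈ kF * K′ x y
  B₄K x y = trans (B₄× K x y) (trans (M.⊡-congˡ (B 1F) B₃K x y) (trans (pull x y) (*-congˡ (trans (B₁K′ x y) (*-identityˡ _)))))
    where
    pull : ∀ x y → (B 1F ×ₘ (λ a b → kF * K′ a b)) x y ≈ kF * (B 1F ×ₘ K′) x y
    pull x y = trans (M.∑-cong N (λ l → solve 3 (λ b k e → b :* (k :* e) := k :* (b :* e)) refl (B 1F x l) kF (K′ l y))) (sym (M.∑-*ˡ N kF _))

  B₄K′ : ∀ x y → (B 4F ×ₘ K′) x y ≈ kF * K x y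
  B₄K′ x y = trans (B₄× K′ x y) (trans (M.⊡-congˡ (B 1F) B₃K′ x y) (trans (pull x y) (*-congˡ (trans (B₁K x y) (*-identityˡ _)))))
    where
    pull : ∀ x y → (B 1F ×ₘ (λ a b → kF * K a b)) x y ≈ kF * (B 1F ×ₘ K) x y
    pull x y = trans (M.∑-cong N (λ l → solve 3 (λ b k e → b :* (k :* e) := k :* (b :* e)) refl (B 1F x l) kF (K l y))) (sym (M.∑-*ˡ N kF _))

  B₃B₃ : ∀ x y → (B 3F ×ₘ B 3F) x y ≈ kF * B 0F x y + mF * B 2F x y
  B₃B₃ x y = trans (lift-product (A 3F) (A 3F) (λ x y → k ℤ.* A 0F x y ℤ.+ μ ℤ.* A 2F x y) R.A₃·A₃ x y)
    (trans (intF-+ (k ℤ.* A 0F x y) _) (+-cong (intF-* k (A 0F x y)) (intF-* μ (A 2F x y))))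

  -- A₃A₄ is the transpose of A₄A₃ = A₁A₃², and multiplication by A₁ exchanges A₀ with A₁ and fixes
  -- A₂.
  B₃B₄ : ∀ x y → (B 3F ×ₘ B 4F) x y ≈ kF * B 1F x y + mF * B 2F x y
  B₃B₄ x y = begin
    (B 3F ×ₘ B 4F) x y
      ≈⟨ ×-swap (B 4F) (B 3F) (B-sym 4F) (B-sym 3F) x y ⟩
    (B 4F ×ₘ B 3F) y x
      ≈⟨ B₄× (B 3F) y x ⟩
    (B 1F ×ₘ (B 3F ×ₘ B 3F)) y x
      ≈⟨ M.⊡-congˡ (B 1F) B₃B₃ y x ⟩
    (B 1F ×ₘ (λ a b → kF * B 0F a b + mF * B 2F a b)) y x
      ≈⟨ M.⊡-linʳ (B 1F) (B 0F) (B 2F) kF mF y x ⟩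
    kF * (B 1F ×ₘ B 0F) y x + mF * (B 1F ×ₘ B 2F) y x
      ≈⟨ +-cong (*-congˡ (trans (B₁B 0F y x) (B-sym 1F y x))) (*-congˡ (trans (B₁B 2F y x) (B-sym 2F y x))) ⟩
    kF * B 1F x y + mF * B 2F x y ∎

  BB₀ : ∀ i x y → (B i ×ₘ B 0F) x y ≈ B i x y
  BB₀ i x y = trans (×-swap (B 0F) (B i) (B-sym 0F) (B-sym i) x y) (trans (B₀B i y x) (B-sym i y x))

  BB₁ : ∀ i x y → (B i ×ₘ B 1F) x y ≈ B (σ i) x y
  BB₁ i x y = trans (×-swap (B 1F) (B i) (B-sym 1F) (B-sym i) x y) (trans (B₁B i y x) (B-sym (σ i) y x))

  action₁ : ∀ c → (B 1F ×ₘ ⟦ c ⟧) ≋ ⟦ L₁ c ⟧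
  action₁ c x y = begin
    (B 1F ×ₘ ⟦ c ⟧) x y
      ≈⟨ M.⊡-∑ʳ 6 (B 1F) c basis x y ⟩
    M.∑ᵣ 6 (λ g → c g * (B 1F ×ₘ basis g) x y)
      ≈⟨ M.∑-cong 6 (λ g → *-congˡ {c g} (table g)) ⟩
    M.∑ᵣ 6 (λ g → c g * row g)
      ≈⟨ solve 12 (λ c0 c1 c2 c3 c4 c5 g0 g1 g2 g3 g4 g5 →
           c0 :* g1 :+ (c1 :* g0 :+ (c2 :* g3 :+ (c3 :* g2 :+ (c4 :* (con 1ℤ :* g4) :+ (c5 :* (con 1ℤ :* g5) :+ con 0ℤ)))))
           := c1 :* g0 :+ (c0 :* g1 :+ (c3 :* g2 :+ (c2 :* g3 :+ (c4 :* g4 :+ (c5 :* g5 :+ con 0ℤ))))))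
         refl (c 0F) (c 1F) (c 2F) (c 3F) (c 4F) (c 5F) (B 0F x y) (B 1F x y) (B 3F x y) (B 4F x y) (K x y) (K′ x y) ⟩
    ⟦ L₁ c ⟧ x y ∎
    where
    row : Fin 6 → Carrier
    row 0F = B 1F x y
    row 1F = B 0F x y
    row 2F = B 4F x y
    row 3F = B 3F x y
    row 4F = 1# * K x y
    row 5F = 1# * K′ x y
    table : ∀ g → (B 1F ×ₘ basis g) x y ≈ row g
    table 0F = B₁B 0F x y
    table 1F = B₁B 1F x y
    table 2F = B₁B 3F x y
    table 3F = B₁B 4F x y
    table 4F = B₁K x y
    table 5F = B₁K′ x y

  action₃ : ∀ c → (B 3F ×ₘ ⟦ c ⟧) ≋ ⟦ L₃ c ⟧
  action₃ c x y = begin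
    (B 3F ×ₘ ⟦ c ⟧) x y
      ≈⟨ M.⊡-∑ʳ 6 (B 3F) c basis x y ⟩
    M.∑ᵣ 6 (λ g → c g * (B 3F ×ₘ basis g) x y)
      ≈⟨ M.∑-cong 6 (λ g → *-congˡ {c g} (table g)) ⟩
    M.∑ᵣ 6 (λ g → c g * row g)
      ≈⟨ solve 14 (λ k m c0 c1 c2 c3 c4 c5 g0 g1 g2 g3 g4 g5 →
           c0 :* g2 :+ (c1 :* g3 :+ (c2 :* (k :* g0 :+ m :* (g4 :- g0 :- g1)) :+ (c3 :* (k :* g1 :+ m :* (g4 :- g0 :- g1))
             :+ (c4 :* (k :* g5) :+ (c5 :* (k :* g4) :+ con 0ℤ)))))
           := ((k :- m) :* c2 :- m :* c3) :* g0 :+ (((k :- m) :* c3 :- m :* c2) :* g1 :+ (c0 :* g2 :+ (c1 :* g3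
             :+ ((m :* (c2 :+ c3) :+ k :* c5) :* g4 :+ (k :* c4 :* g5 :+ con 0ℤ))))))
         refl kF mF (c 0F) (c 1F) (c 2F) (c 3F) (c 4F) (c 5F) (B 0F x y) (B 1F x y) (B 3F x y) (B 4F x y) (K x y) (K′ x y) ⟩
    ⟦ L₃ c ⟧ x y ∎
    where
    B₂≈ : B 2F x y ≈ K x y + - B 0F x y + - B 1F x y
    B₂≈ = begin
      B 2F x y
        ≈⟨ solve 3 (λ a b e → e := a :+ b :+ e :- a :- b) refl (B 0F x y) (B 1F x y) (B 2F x y) ⟩
      B 0F x y + B 1F x y + B 2F x y + - B 0F x y + - B 1F x y
        ≈⟨ +-congʳ (+-congʳ (K≈ x y)) ⟨
      K x y + - B 0F x y + - B 1F x y ∎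
    row : Fin 6 → Carrier
    row 0F = B 3F x y
    row 1F = B 4F x y
    row 2F = kF * B 0F x y + mF * (K x y + - B 0F x y + - B 1F x y)
    row 3F = kF * B 1F x y + mF * (K x y + - B 0F x y + - B 1F x y)
    row 4F = kF * K′ x y
    row 5F = kF * K x y
    table : ∀ g → (B 3F ×ₘ basis g) x y ≈ row g
    table 0F = BB₀ 3F x y
    table 1F = BB₁ 3F x y
    table 2F = trans (B₃B₃ x y) (+-congˡ (*-congˡ B₂≈))
    table 3F = trans (B₃B₄ x y) (+-congˡ (*-congˡ B₂≈))
    table 4F = B₃K x y
    table 5F = B₃K′ x y

  actionᴷ : ∀ c → (K ×ₘ ⟦ c ⟧) ≋ ⟦ Lᴷ c ⟧
  actionᴷ c x y = begin
    (K ×ₘ ⟦ c ⟧) x y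
      ≈⟨ M.⊡-∑ʳ 6 K c basis x y ⟩
    M.∑ᵣ 6 (λ g → c g * (K ×ₘ basis g) x y)
      ≈⟨ M.∑-cong 6 (λ g → *-congˡ {c g} (table g)) ⟩
    M.∑ᵣ 6 (λ g → c g * row g)
      ≈⟨ solve 14 (λ k v c0 c1 c2 c3 c4 c5 g0 g1 g2 g3 g4 g5 →
           c0 :* (con 1ℤ :* g4) :+ (c1 :* (con 1ℤ :* g4) :+ (c2 :* (k :* g5) :+ (c3 :* (k :* g5)
             :+ (c4 :* ((con 1ℤ :+ con 1ℤ) :* v :* g4) :+ (c5 :* ((con 1ℤ :+ con 1ℤ) :* v :* g5) :+ con 0ℤ)))))
           := con 0ℤ :* g0 :+ (con 0ℤ :* g1 :+ (con 0ℤ :* g2 :+ (con 0ℤ :* g3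
             :+ ((c0 :+ c1 :+ (con 1ℤ :+ con 1ℤ) :* v :* c4) :* g4 :+ ((k :* (c2 :+ c3) :+ (con 1ℤ :+ con 1ℤ) :* v :* c5) :* g5 :+ con 0ℤ))))))
         refl kF vF (c 0F) (c 1F) (c 2F) (c 3F) (c 4F) (c 5F) (B 0F x y) (B 1F x y) (B 3F x y) (B 4F x y) (K x y) (K′ x y) ⟩
    ⟦ Lᴷ c ⟧ x y ∎
    where
    row : Fin 6 → Carrier
    row 0F = 1# * K x y
    row 1F = 1# * K x y
    row 2F = kF * K′ x y
    row 3F = kF * K′ x y
    row 4F = (1# + 1#) * vF * K x y
    row 5F = (1# + 1#) * vF * K′ x y
    table : ∀ g → (K ×ₘ basis g) x y ≈ row g
    table 0F = ×-comm (B 0F) K K 1# (B-sym 0F) K-sym K-sym B₀K x y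
    table 1F = ×-comm (B 1F) K K 1# (B-sym 1F) K-sym K-sym B₁K x y
    table 2F = ×-comm (B 3F) K K′ kF (B-sym 3F) K-sym K′-sym B₃K x y
    table 3F = ×-comm (B 4F) K K′ kF (B-sym 4F) K-sym K′-sym B₄K x y
    table 4F = doubled (within A) (within A) (within A) R.K·K x y
    table 5F = doubled (within A) (across A) (across A) R.K·K′ x y

  actionᴷ′ : ∀ c → (K′ ×ₘ ⟦ c ⟧) ≋ ⟦ Lᴷ′ c ⟧
  actionᴷ′ c x y = begin
    (K′ ×ₘ ⟦ c ⟧) x y
      ≈⟨ M.⊡-∑ʳ 6 K′ c basis x y ⟩
    M.∑ᵣ 6 (λ g → c g * (K′ ×ₘ basis g) x y)
      ≈⟨ M.∑-cong 6 (λ g → *-congˡ {c g} (table g)) ⟩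
    M.∑ᵣ 6 (λ g → c g * row g)
      ≈⟨ solve 14 (λ k v c0 c1 c2 c3 c4 c5 g0 g1 g2 g3 g4 g5 →
           c0 :* (con 1ℤ :* g5) :+ (c1 :* (con 1ℤ :* g5) :+ (c2 :* (k :* g4) :+ (c3 :* (k :* g4)
             :+ (c4 :* ((con 1ℤ :+ con 1ℤ) :* v :* g5) :+ (c5 :* ((con 1ℤ :+ con 1ℤ) :* v :* g4) :+ con 0ℤ)))))
           := con 0ℤ :* g0 :+ (con 0ℤ :* g1 :+ (con 0ℤ :* g2 :+ (con 0ℤ :* g3
             :+ ((k :* (c2 :+ c3) :+ (con 1ℤ :+ con 1ℤ) :* v :* c5) :* g4 :+ ((c0 :+ c1 :+ (con 1ℤ :+ con 1ℤ) :* v :* c4) :* g5 :+ con 0ℤ))))))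
         refl kF vF (c 0F) (c 1F) (c 2F) (c 3F) (c 4F) (c 5F) (B 0F x y) (B 1F x y) (B 3F x y) (B 4F x y) (K x y) (K′ x y) ⟩
    ⟦ Lᴷ′ c ⟧ x y ∎
    where
    row : Fin 6 → Carrier
    row 0F = 1# * K′ x y
    row 1F = 1# * K′ x y
    row 2F = kF * K x y
    row 3F = kF * K x y
    row 4F = (1# + 1#) * vF * K′ x y
    row 5F = (1# + 1#) * vF * K x y
    table : ∀ g → (K′ ×ₘ basis g) x y ≈ row g
    table 0F = ×-comm (B 0F) K′ K′ 1# (B-sym 0F) K′-sym K′-sym B₀K′ x y
    table 1F = ×-comm (B 1F) K′ K′ 1# (B-sym 1F) K′-sym K′-sym B₁K′ x y
    table 2F = ×-comm (B 3F) K′ K kF (B-sym 3F) K′-sym K-sym B₃K′ x y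
    table 3F = ×-comm (B 4F) K′ K kF (B-sym 4F) K′-sym K-sym B₄K′ x y
    table 4F = ×-comm K K′ K′ ((1# + 1#) * vF) K-sym K′-sym K′-sym (doubled (within A) (across A) (across A) R.K·K′) x y
    table 5F = doubled (across A) (across A) (within A) R.K′·K′ x y

  -- χ, κ, κ′ and θ belong to A₁, K, K′ and A₃. The remaining values follow from A₂ = K - A₀ - A₁,
  -- A₄ = A₁A₃ and A₅ = K′ - A₃ - A₄.
  eigenvalue : (χ κ κ′ θ : Carrier) → Fin 6 → Carrier
  eigenvalue χ κ κ′ θ 0F = 1#
  eigenvalue χ κ κ′ θ 1F = χ
  eigenvalue χ κ κ′ θ 2F = κ + - 1# + - χ
  eigenvalue χ κ κ′ θ 3F = θ
  eigenvalue χ κ κ′ θ 4F = χ * θ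
  eigenvalue χ κ κ′ θ 5F = κ′ + - θ + - (χ * θ)

  ⟦⟧-scale : ∀ θ {c d} → (∀ g → d g ≈ θ * c g) → ⟦ d ⟧ ≋ (θ • ⟦ c ⟧)
  ⟦⟧-scale θ {c} {d} d≈ x y = begin
    M.∑ᵣ 6 (λ g → d g * basis g x y)       ≈⟨ M.∑-cong 6 (λ g → trans (*-congʳ (d≈ g)) (*-assoc θ (c g) (basis g x y))) ⟩
    M.∑ᵣ 6 (λ g → θ * (c g * basis g x y)) ≈⟨ M.∑-*ˡ 6 θ (λ g → c g * basis g x y) ⟨
    θ * ⟦ c ⟧ x y                          ∎

  ×-scale : ∀ (L M : MatF N) a → (L ×ₘ (a • M)) ≋ (a • (L ×ₘ M))
  ×-scale L M a x y = trans (M.∑-cong N (λ l → solve 3 (λ b k e → b :* (k :* e) := k :* (b :* e)) refl (L x l) a (M l y)))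
    (sym (M.∑-*ˡ N a (λ l → L x l * M l y)))

  action₀ : ∀ c → (B 0F ×ₘ ⟦ c ⟧) ≋ ⟦ c ⟧
  action₀ c x y = trans (M.⊡-∑ʳ 6 (B 0F) c basis x y) (M.∑-cong 6 (λ g → *-congˡ {c g} (table g)))
    where
    table : ∀ g → (B 0F ×ₘ basis g) x y ≈ basis g x y
    table 0F = B₀B 0F x y
    table 1F = B₀B 1F x y
    table 2F = B₀B 3F x y
    table 3F = B₀B 4F x y
    table 4F = trans (B₀K x y) (*-identityˡ _)
    table 5F = trans (B₀K′ x y) (*-identityˡ _)

  eigenvector : ∀ c χ κ κ′ θ → (∀ g → L₁ c g ≈ χ * c g) → (∀ g → L₃ c g ≈ θ * c g) →
    (∀ g → Lᴷ c g ≈ κ * c g) → (∀ g → Lᴷ′ c g ≈ κ′ * c g) →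
    ∀ j → (B j ×ₘ ⟦ c ⟧) ≋ (eigenvalue χ κ κ′ θ j • ⟦ c ⟧)
  eigenvector c χ κ κ′ θ L₁≈ L₃≈ Lᴷ≈ Lᴷ′≈ = go
    where
    e₀ : ∀ x y → (B 0F ×ₘ ⟦ c ⟧) x y ≈ 1# * ⟦ c ⟧ x y
    e₀ x y = ×1 (action₀ c x y)
    e₁ : ∀ x y → (B 1F ×ₘ ⟦ c ⟧) x y ≈ χ * ⟦ c ⟧ x y
    e₁ x y = trans (action₁ c x y) (⟦⟧-scale χ L₁≈ x y)
    e₃ : ∀ x y → (B 3F ×ₘ ⟦ c ⟧) x y ≈ θ * ⟦ c ⟧ x y
    e₃ x y = trans (action₃ c x y) (⟦⟧-scale θ L₃≈ x y)
    eᴷ : ∀ x y → (K ×ₘ ⟦ c ⟧) x y ≈ κ * ⟦ c ⟧ x y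
    eᴷ x y = trans (actionᴷ c x y) (⟦⟧-scale κ Lᴷ≈ x y)
    eᴷ′ : ∀ x y → (K′ ×ₘ ⟦ c ⟧) x y ≈ κ′ * ⟦ c ⟧ x y
    eᴷ′ x y = trans (actionᴷ′ c x y) (⟦⟧-scale κ′ Lᴷ′≈ x y)
    e₄ : ∀ x y → (B 4F ×ₘ ⟦ c ⟧) x y ≈ χ * θ * ⟦ c ⟧ x y
    e₄ x y = begin
      (B 4F ×ₘ ⟦ c ⟧) x y              ≈⟨ B₄× ⟦ c ⟧ x y ⟩
      (B 1F ×ₘ (B 3F ×ₘ ⟦ c ⟧)) x y    ≈⟨ M.⊡-congˡ (B 1F) e₃ x y ⟩
      (B 1F ×ₘ (θ • ⟦ c ⟧)) x y        ≈⟨ ×-scale (B 1F) ⟦ c ⟧ θ x y ⟩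
      θ * (B 1F ×ₘ ⟦ c ⟧) x y          ≈⟨ *-congˡ (e₁ x y) ⟩
      θ * (χ * ⟦ c ⟧ x y)              ≈⟨ solve 3 (λ t x m → t :* (x :* m) := x :* t :* m) refl θ χ (⟦ c ⟧ x y) ⟩
      χ * θ * ⟦ c ⟧ x y                ∎
    last : ∀ {a b d s α β κ m} → s ≈ a + b + d → s ≈ κ * m → a ≈ α * m → b ≈ β * m → d ≈ (κ + - α + - β) * m
    last {a} {b} {d} {s} {α} {β} {κ} {m} s≈ s≈κm a≈ b≈ = begin
      d                                     ≈⟨ solve 3 (λ a b d → d := a :+ b :+ d :- a :- b) refl a b d ⟩
      a + b + d + - a + - b                 ≈⟨ +-cong (+-cong (trans (sym s≈) s≈κm) (-‿cong a≈)) (-‿cong b≈) ⟩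
      κ * m + - (α * m) + - (β * m)         ≈⟨ solve 4 (λ k a b m → k :* m :- a :* m :- b :* m := (k :- a :- b) :* m) refl κ α β m ⟩
      (κ + - α + - β) * m                   ∎
    go : ∀ j → (B j ×ₘ ⟦ c ⟧) ≋ (eigenvalue χ κ κ′ θ j • ⟦ c ⟧)
    go 0F = e₀
    go 1F = e₁
    go 2F x y = last (K× ⟦ c ⟧ x y) (eᴷ x y) (e₀ x y) (e₁ x y)
    go 3F = e₃
    go 4F = e₄
    go 5F x y = last (K′× ⟦ c ⟧ x y) (eᴷ′ x y) (e₃ x y) (e₄ x y)

  -- K + εK′, A₀ − A₁ + (w/v)(A₃ − A₄) and v(A₀ + A₁) − K + u(v(A₃ + A₄) − kK′).
  constantCoeffs : Carrier → Fin 6 → Carrier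
  constantCoeffs ε 0F = 0#
  constantCoeffs ε 1F = 0#
  constantCoeffs ε 2F = 0#
  constantCoeffs ε 3F = 0#
  constantCoeffs ε 4F = 1#
  constantCoeffs ε 5F = ε

  signedCoeffs : Carrier → Fin 6 → Carrier
  signedCoeffs w 0F = vF
  signedCoeffs w 1F = - vF
  signedCoeffs w 2F = w
  signedCoeffs w 3F = - w
  signedCoeffs w 4F = 0#
  signedCoeffs w 5F = 0#

  designCoeffs : Carrier → Fin 6 → Carrier
  designCoeffs u 0F = vF
  designCoeffs u 1F = vF
  designCoeffs u 2F = u * vF
  designCoeffs u 3F = u * vF
  designCoeffs u 4F = - 1#
  designCoeffs u 5F = - (u * kF)

  -- A₃ exchanges K and K′ up to the factor k, so a sign ε yields the eigenvalue εk.
  constant-eigenvector : ∀ ε → ε * ε ≈ 1# → ∀ j →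
    (B j ×ₘ ⟦ constantCoeffs ε ⟧) ≋ (eigenvalue 1# ((1# + 1#) * vF) (ε * ((1# + 1#) * vF)) (ε * kF) j • ⟦ constantCoeffs ε ⟧)
  constant-eigenvector ε ε²≈1 = eigenvector (constantCoeffs ε) 1# ((1# + 1#) * vF) (ε * ((1# + 1#) * vF)) (ε * kF)
    (λ { 0F → 0≈ 1# ; 1F → 0≈ 1# ; 2F → 0≈ 1# ; 3F → 0≈ 1# ; 4F → ×1 refl ; 5F → ×1 refl })
    (λ { 0F → solve 3 (λ k m e → (k :- m) :* con 0ℤ :- m :* con 0ℤ := e :* k :* con 0ℤ) refl kF mF ε
       ; 1F → solve 3 (λ k m e → (k :- m) :* con 0ℤ :- m :* con 0ℤ := e :* k :* con 0ℤ) refl kF mF ε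
       ; 2F → 0≈ (ε * kF) ; 3F → 0≈ (ε * kF)
       ; 4F → solve 3 (λ k m e → m :* (con 0ℤ :+ con 0ℤ) :+ k :* e := e :* k :* con 1ℤ) refl kF mF ε
       ; 5F → trans (*-congˡ (sym ε²≈1)) (solve 2 (λ k e → k :* (e :* e) := e :* k :* e) refl kF ε) })
    (λ { 0F → 0≈ _ ; 1F → 0≈ _ ; 2F → 0≈ _ ; 3F → 0≈ _
       ; 4F → solve 1 (λ v → con 0ℤ :+ con 0ℤ :+ (con 1ℤ :+ con 1ℤ) :* v :* con 1ℤ := (con 1ℤ :+ con 1ℤ) :* v :* con 1ℤ) refl vF
       ; 5F → solve 3 (λ k v e → k :* (con 0ℤ :+ con 0ℤ) :+ (con 1ℤ :+ con 1ℤ) :* v :* e := (con 1ℤ :+ con 1ℤ) :* v :* e) refl kF vF ε })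
    (λ { 0F → 0≈ _ ; 1F → 0≈ _ ; 2F → 0≈ _ ; 3F → 0≈ _
       ; 4F → solve 3 (λ k v e → k :* (con 0ℤ :+ con 0ℤ) :+ (con 1ℤ :+ con 1ℤ) :* v :* e := e :* ((con 1ℤ :+ con 1ℤ) :* v) :* con 1ℤ) refl kF vF ε
       ; 5F → trans (solve 1 (λ v → con 0ℤ :+ con 0ℤ :+ (con 1ℤ :+ con 1ℤ) :* v :* con 1ℤ := (con 1ℤ :+ con 1ℤ) :* v :* con 1ℤ) refl vF)
                (trans (*-congˡ (sym ε²≈1)) (solve 2 (λ v e → (con 1ℤ :+ con 1ℤ) :* v :* (e :* e) := e :* ((con 1ℤ :+ con 1ℤ) :* v) :* e) refl vF ε)) })
    where
    0≈ : ∀ x → 0# ≈ x * 0#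
    0≈ x = sym (zeroʳ x)

  -- A₃ sends A₀ - A₁ to A₃ - A₄ and the latter to k(A₀ - A₁), as the terms with A₂ cancel; the
  -- eigenvalue is thus a root s of k, with w = v/s. Both K and K′ annihilate the differences.
  signed-eigenvector : ∀ s w → s * s ≈ kF → w * s ≈ vF → ∀ j →
    (B j ×ₘ ⟦ signedCoeffs w ⟧) ≋ (eigenvalue (- 1#) 0# 0# s j • ⟦ signedCoeffs w ⟧)
  signed-eigenvector s w s²≈k ws≈v = eigenvector (signedCoeffs w) (- 1#) 0# 0# s
    (λ { 0F → solve 1 (λ v → :- v := (:- con 1ℤ) :* v) refl vF
       ; 1F → solve 1 (λ v → v := (:- con 1ℤ) :* (:- v)) refl vF
       ; 2F → solve 1 (λ v → :- v := (:- con 1ℤ) :* v) refl w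
       ; 3F → solve 1 (λ v → v := (:- con 1ℤ) :* (:- v)) refl w
       ; 4F → sym (zeroʳ _) ; 5F → sym (zeroʳ _) })
    (λ { 0F → begin
           (kF + - mF) * w + - (mF * - w)  ≈⟨ solve 3 (λ k m w → (k :- m) :* w :- m :* (:- w) := k :* w) refl kF mF w ⟩
           kF * w                          ≈⟨ kw≈sv ⟩
           s * vF                          ∎
       ; 1F → begin
           (kF + - mF) * - w + - (mF * w)  ≈⟨ solve 3 (λ k m w → (k :- m) :* (:- w) :- m :* w := :- (k :* w)) refl kF mF w ⟩
           - (kF * w)                      ≈⟨ -‿cong kw≈sv ⟩
           - (s * vF)                      ≈⟨ solve 2 (λ s v → :- (s :* v) := s :* (:- v)) refl s vF ⟩
           s * - vF                        ∎
       ; 2F → trans (sym ws≈v) (*-comm w s)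
       ; 3F → trans (-‿cong (sym ws≈v)) (solve 2 (λ w s → :- (w :* s) := s :* (:- w)) refl w s)
       ; 4F → solve 4 (λ k m w s → m :* (w :- w) :+ k :* con 0ℤ := s :* con 0ℤ) refl kF mF w s
       ; 5F → solve 2 (λ k s → k :* con 0ℤ := s :* con 0ℤ) refl kF s })
    (λ { 0F → 0≈ _ ; 1F → 0≈ _ ; 2F → 0≈ _ ; 3F → 0≈ _
       ; 4F → solve 1 (λ v → v :- v :+ (con 1ℤ :+ con 1ℤ) :* v :* con 0ℤ := con 0ℤ :* con 0ℤ) refl vF
       ; 5F → solve 3 (λ k w v → k :* (w :- w) :+ (con 1ℤ :+ con 1ℤ) :* v :* con 0ℤ := con 0ℤ :* con 0ℤ) refl kF w vF })
    (λ { 0F → 0≈ _ ; 1F → 0≈ _ ; 2F → 0≈ _ ; 3F → 0≈ _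
       ; 4F → solve 3 (λ k w v → k :* (w :- w) :+ (con 1ℤ :+ con 1ℤ) :* v :* con 0ℤ := con 0ℤ :* con 0ℤ) refl kF w vF
       ; 5F → solve 1 (λ v → v :- v :+ (con 1ℤ :+ con 1ℤ) :* v :* con 0ℤ := con 0ℤ :* con 0ℤ) refl vF })
    where
    0≈ : ∀ x → 0# ≈ 0# * x
    0≈ x = sym (zeroˡ x)
    kw≈sv : kF * w ≈ s * vF
    kw≈sv = begin
      kF * w       ≈⟨ *-congʳ s²≈k ⟨
      s * s * w    ≈⟨ solve 2 (λ s w → s :* s :* w := s :* (w :* s)) refl s w ⟩
      s * (w * s)  ≈⟨ *-congˡ ws≈v ⟩
      s * vF       ∎

  -- K and K′ annihilate this vector because its row sums vanish in each half: 2v - 2v from the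
  -- first part, 2kv - 2kv from the second. On such vectors A₃ has square k - λ, so `r` is a root of
  -- it and `u` its inverse.
  design-eigenvector : ∀ r u → r * r ≈ kF + - ((1# + 1#) * mF) → u * r ≈ 1# →
    kF * kF ≈ kF + - ((1# + 1#) * mF) + vF * ((1# + 1#) * mF) → ∀ j →
    (B j ×ₘ ⟦ designCoeffs u ⟧) ≋ (eigenvalue 1# 0# 0# r j • ⟦ designCoeffs u ⟧)
  design-eigenvector r u r²≈a ur≈1 k²≈ = eigenvector (designCoeffs u) 1# 0# 0# r
    (λ { 0F → ×1 refl ; 1F → ×1 refl ; 2F → ×1 refl ; 3F → ×1 refl ; 4F → ×1 refl ; 5F → ×1 refl })
    (λ { 0F → uav≈rv ; 1F → uav≈rv ; 2F → v≈ruv ; 3F → v≈ruv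
       -- The coefficient of K is the only place that needs k² = (k - λ) + vλ.
       ; 4F → begin
           mF * (u * vF + u * vF) + kF * - (u * kF)
             ≈⟨ solve 4 (λ k m u v → m :* (u :* v :+ u :* v) :+ k :* (:- (u :* k)) := u :* (v :* ((con 1ℤ :+ con 1ℤ) :* m)) :- u :* (k :* k)) refl kF mF u vF ⟩
           u * (vF * ((1# + 1#) * mF)) + - (u * (kF * kF))
             ≈⟨ +-congˡ (-‿cong (*-congˡ k²≈)) ⟩
           u * (vF * ((1# + 1#) * mF)) + - (u * (kF + - ((1# + 1#) * mF) + vF * ((1# + 1#) * mF)))
             ≈⟨ solve 4 (λ a m u v → u :* (v :* ((con 1ℤ :+ con 1ℤ) :* m)) :- u :* (a :+ v :* ((con 1ℤ :+ con 1ℤ) :* m)) := (u :* a) :* (:- con 1ℤ)) refl (kF + - ((1# + 1#) * mF)) mF u vF ⟩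
           u * (kF + - ((1# + 1#) * mF)) * - 1#
             ≈⟨ *-congʳ ua≈r ⟩
           r * - 1# ∎
       ; 5F → begin
           kF * - 1#                ≈⟨ solve 1 (λ k → k :* (:- con 1ℤ) := :- (con 1ℤ :* k)) refl kF ⟩
           - (1# * kF)              ≈⟨ -‿cong (*-congʳ (sym ur≈1)) ⟩
           - (u * r * kF)           ≈⟨ solve 3 (λ u r k → :- (u :* r :* k) := r :* (:- (u :* k))) refl u r kF ⟩
           r * - (u * kF)           ∎ })
    (λ { 0F → 0≈ _ ; 1F → 0≈ _ ; 2F → 0≈ _ ; 3F → 0≈ _
       ; 4F → solve 1 (λ v → v :+ v :+ (con 1ℤ :+ con 1ℤ) :* v :* (:- con 1ℤ) := con 0ℤ :* (:- con 1ℤ)) refl vF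
       ; 5F → solve 3 (λ k u v → k :* (u :* v :+ u :* v) :+ (con 1ℤ :+ con 1ℤ) :* v :* (:- (u :* k)) := con 0ℤ :* (:- (u :* k))) refl kF u vF })
    (λ { 0F → 0≈ _ ; 1F → 0≈ _ ; 2F → 0≈ _ ; 3F → 0≈ _
       ; 4F → solve 3 (λ k u v → k :* (u :* v :+ u :* v) :+ (con 1ℤ :+ con 1ℤ) :* v :* (:- (u :* k)) := con 0ℤ :* (:- con 1ℤ)) refl kF u vF
       ; 5F → solve 3 (λ v u k → v :+ v :+ (con 1ℤ :+ con 1ℤ) :* v :* (:- con 1ℤ) := con 0ℤ :* (:- (u :* k))) refl vF u kF })
    where
    0≈ : ∀ x → 0# ≈ 0# * x
    0≈ x = sym (zeroˡ x)
    ua≈r : u * (kF + - ((1# + 1#) * mF)) ≈ r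
    ua≈r = begin
      u * (kF + - ((1# + 1#) * mF))   ≈⟨ *-congˡ r²≈a ⟨
      u * (r * r)                     ≈⟨ *-assoc u r r ⟨
      u * r * r                       ≈⟨ *-congʳ ur≈1 ⟩
      1# * r                          ≈⟨ *-identityˡ r ⟩
      r                               ∎
    uav≈rv : (kF + - mF) * (u * vF) + - (mF * (u * vF)) ≈ r * vF
    uav≈rv = trans (solve 4 (λ k m u v → (k :- m) :* (u :* v) :- m :* (u :* v) := u :* (k :- (con 1ℤ :+ con 1ℤ) :* m) :* v) refl kF mF u vF)
                   (*-congʳ ua≈r)
    v≈ruv : vF ≈ r * (u * vF)
    v≈ruv = begin
      vF             ≈⟨ *-identityˡ vF ⟨
      1# * vF        ≈⟨ *-congʳ ur≈1 ⟨
      u * r * vF     ≈⟨ solve 3 (λ u r v → u :* r :* v := r :* (u :* v)) refl u r vF ⟩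
      r * (u * vF)   ∎

-- Primitive idempotents and eigenmatrices

module IdempotentBasis {c ℓ ℓ′} (F : OrderedFieldWithSqrt c ℓ ℓ′) {v k : ℕ} {μ : ℤ}
  {A : Fin 6 → Mat ℤ (2 ℕ.* (2 ℕ.* v)) (2 ℕ.* (2 ℕ.* v))} (R : Relations A (+ v) (+ k) μ)
  (0<k : 0 ℕ.< k) (k<v : k ℕ.< v)
  (k²≡ : + k ℤ.* + k ≡ (+ k ℤ.- + 2 ℤ.* μ) ℤ.+ + v ℤ.* (+ 2 ℤ.* μ))
  (x₀ : Fin (2 ℕ.* (2 ℕ.* v))) (A-diag : ∀ i → A (suc i) x₀ x₀ ≡ 0ℤ) where
  open OrderedFieldWithSqrt F
  open OverField F
  open FieldArithmetic F
  open Eigenspaces F R hiding (module R)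
  open CommutativeRing commRing using (setoid; refl; sym; trans; reflexive;
    +-cong; +-congˡ; +-congʳ; +-identityˡ; +-identityʳ; -‿cong;
    *-cong; *-congˡ; *-congʳ; *-assoc; *-comm; *-identityˡ; *-identityʳ; zeroˡ; zeroʳ)
  open SetoidReasoning setoid
  private module M = Matrices commRing

  N : ℕ
  N = 2 ℕ.* (2 ℕ.* v)

  P Q : Mat Carrier 6 6
  P = Pmat v k
  Q = Qmat v k

  0<v : 0 ℕ.< v
  0<v = ℕ.<-trans 0<k k<v

  0<v-1 : 0 ℕ.< v ∸ 1
  0<v-1 = ℕ.m<n⇒0<n∸m (ℕ.≤-<-trans 0<k k<v)

  0<v-k : 0 ℕ.< v ∸ k
  0<v-k = ℕ.m<n⇒0<n∸m k<v

  -- `a` is k - λ, the square of A₃ on the design part.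
  p q a : Carrier
  p = natF (v ∸ 1)
  q = natF (v ∸ k)
  a = kF + - ((1# + 1#) * mF)

  2≉0 : ¬ (1# + 1# ≈ 0#)
  2≉0 eq = natF-≉0 {2} ℕ.z<s (trans (+-congˡ (+-identityʳ 1#)) eq)

  v≉0 : ¬ (vF ≈ 0#)
  v≉0 = natF-≉0 0<v

  k≉0 : ¬ (kF ≈ 0#)
  k≉0 = natF-≉0 0<k

  p≉0 : ¬ (p ≈ 0#)
  p≉0 = natF-≉0 0<v-1

  q≉0 : ¬ (q ≈ 0#)
  q≉0 = natF-≉0 0<v-k

  v≈1+p : vF ≈ 1# + p
  v≈1+p = reflexive (≡.cong natF (≡.sym (ℕ.m+[n∸m]≡n 0<v)))

  v≈k+q : vF ≈ kF + q
  v≈k+q = trans (reflexive (≡.cong natF (≡.sym (ℕ.m+[n∸m]≡n (ℕ.<⇒≤ k<v))))) (natF-+ k (v ∸ k))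

  natF-double : ∀ n → natF (2 ℕ.* n) ≈ (1# + 1#) * natF n
  natF-double n = trans (natF-* 2 n) (*-congʳ (+-congˡ (+-identityʳ 1#)))

  natF-N : natF N ≈ (1# + 1#) * ((1# + 1#) * vF)
  natF-N = trans (natF-double (2 ℕ.* v)) (*-congˡ (natF-double v))

  k²≈ : kF * kF ≈ a + vF * ((1# + 1#) * mF)
  k²≈ = begin
    kF * kF                          ≈⟨ intF-* (+ k) (+ k) ⟨
    intF (+ k ℤ.* + k)               ≡⟨ ≡.cong intF k²≡ ⟩
    intF (+ k ℤ.- + 2 ℤ.* μ ℤ.+ + v ℤ.* (+ 2 ℤ.* μ))
      ≈⟨ intF-+ (+ k ℤ.- + 2 ℤ.* μ) _ ⟩
    intF (+ k ℤ.- + 2 ℤ.* μ) + intF (+ v ℤ.* (+ 2 ℤ.* μ))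
      ≈⟨ +-cong (intF-+ (+ k) (ℤ.- (+ 2 ℤ.* μ))) (intF-* (+ v) (+ 2 ℤ.* μ)) ⟩
    kF + intF (ℤ.- (+ 2 ℤ.* μ)) + vF * intF (+ 2 ℤ.* μ)
      ≈⟨ +-cong (+-congˡ (trans (intF-neg (+ 2 ℤ.* μ)) (-‿cong 2μ≈))) (*-congˡ 2μ≈) ⟩
    a + vF * ((1# + 1#) * mF)        ∎
    where
    2μ≈ : intF (+ 2 ℤ.* μ) ≈ (1# + 1#) * mF
    2μ≈ = trans (intF-* (+ 2) μ) (*-congʳ (+-congˡ (+-identityʳ 1#)))

  -- The counting identity in the form (k - λ)(v - 1) = (v - k)k. It identifies the radicand of `r₁`
  -- with k - λ and links the radicals of P with those of Q.
  ap≈qk : a * p ≈ q * kF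
  ap≈qk = begin
    a * p
      ≈⟨ solve 2 (λ a p → a :* p := (con 1ℤ :+ p) :* a :- a) refl a p ⟩
    (1# + p) * a + - a
      ≈⟨ +-congʳ (*-congʳ v≈1+p) ⟨
    vF * a + - a
      ≈⟨ solve 3 (λ v k m → v :* (k :- (con 1ℤ :+ con 1ℤ) :* m) :- (k :- (con 1ℤ :+ con 1ℤ) :* m)
           := v :* k :- (k :- (con 1ℤ :+ con 1ℤ) :* m :+ v :* ((con 1ℤ :+ con 1ℤ) :* m))) refl vF kF mF ⟩
    vF * kF + - (a + vF * ((1# + 1#) * mF))
      ≈⟨ +-cong (*-congʳ v≈k+q) (-‿cong (sym k²≈)) ⟩
    (kF + q) * kF + - (kF * kF)
      ≈⟨ solve 2 (λ k q → (k :+ q) :* k :- k :* k := q :* k) refl kF q ⟩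
    q * kF ∎

  s w r₁ r₂ r₃ u : Carrier
  s  = √ kF
  w  = vF * s ⁻¹
  r₁ = √ (((v ∸ k) ℕ.* k) /ₙ (v ∸ 1))
  r₂ = √ (((v ∸ 1) ℕ.* (v ∸ k)) /ₙ k)
  r₃ = √ (((v ∸ 1) ℕ.* k) /ₙ (v ∸ k))
  u  = r₁ ⁻¹

  square≉0 : ∀ {x} → ¬ (x * x ≈ 0#) → ¬ (x ≈ 0#)
  square≉0 {x} x²≉0 x≈0 = x²≉0 (trans (*-congʳ x≈0) (zeroˡ x))

  s²≈k : s * s ≈ kF
  s²≈k = √-square kF (natF-nonneg k)

  s≉0 : ¬ (s ≈ 0#)
  s≉0 = square≉0 (λ eq → k≉0 (trans (sym s²≈k) eq))

  ws≈v : w * s ≈ vF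
  ws≈v = begin
    vF * s ⁻¹ * s     ≈⟨ solve 3 (λ v i s → v :* i :* s := v :* (s :* i)) refl vF (s ⁻¹) s ⟩
    vF * (s * s ⁻¹)   ≈⟨ *-congˡ (⁻¹-inverse s s≉0) ⟩
    vF * 1#           ≈⟨ *-identityʳ vF ⟩
    vF                ∎

  √/ₙ-square : ∀ m n l → 0 ℕ.< l → √ ((m ℕ.* n) /ₙ l) * √ ((m ℕ.* n) /ₙ l) * natF l ≈ natF m * natF n
  √/ₙ-square m n l 0<l = begin
    √ ((m ℕ.* n) /ₙ l) * √ ((m ℕ.* n) /ₙ l) * natF l ≈⟨ *-congʳ (√-square _ (/ₙ-nonneg (m ℕ.* n) 0<l)) ⟩
    ((m ℕ.* n) /ₙ l) * natF l                        ≈⟨ /ₙ-* (m ℕ.* n) 0<l ⟩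
    natF (m ℕ.* n)                                   ≈⟨ natF-* m n ⟩
    natF m * natF n                                  ∎

  r₁²≈a : r₁ * r₁ ≈ a
  r₁²≈a = *-cancelʳ p p≉0 (trans (√/ₙ-square (v ∸ k) k (v ∸ 1) 0<v-1) (sym ap≈qk))

  a≉0 : ¬ (a ≈ 0#)
  a≉0 a≈0 = *-≉0 q≉0 k≉0 (trans (sym ap≈qk) (trans (*-congʳ a≈0) (zeroˡ p)))

  r₁≉0 : ¬ (r₁ ≈ 0#)
  r₁≉0 = square≉0 (λ eq → a≉0 (trans (sym r₁²≈a) eq))

  ur₁≈1 : u * r₁ ≈ 1#
  ur₁≈1 = trans (*-comm u r₁) (⁻¹-inverse r₁ r₁≉0)

  u-nonneg : 0# ≤ u
  u-nonneg = ⁻¹-nonneg (√-nonneg _) r₁≉0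

  u≉0 : ¬ (u ≈ 0#)
  u≉0 u≈0 = 0≉1 (trans (sym (trans (*-congʳ u≈0) (zeroˡ r₁))) ur₁≈1)

  u²a≈1 : u * u * a ≈ 1#
  u²a≈1 = begin
    u * u * a              ≈⟨ *-congˡ r₁²≈a ⟨
    u * u * (r₁ * r₁)      ≈⟨ solve 2 (λ u r → u :* u :* (r :* r) := u :* r :* (u :* r)) refl u r₁ ⟩
    u * r₁ * (u * r₁)      ≈⟨ *-cong ur₁≈1 ur₁≈1 ⟩
    1# * 1#                ≈⟨ *-identityˡ 1# ⟩
    1#                     ∎

  -- If r² y = p x and a p = x y, then r² = x²/a, hence r = x/√a.
  root≈ : ∀ {r x y} → 0# ≤ r → 0# ≤ x → ¬ (x ≈ 0#) → ¬ (y ≈ 0#) → r * r * y ≈ p * x → a * p ≈ x * y → r ≈ u * x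
  root≈ {r} {x} {y} 0≤r 0≤x x≉0 y≉0 r²y≈ ap≈ = square-injective 0≤r (*-nonneg u-nonneg 0≤x) (*-≉0 u≉0 x≉0)
    (*-cancelʳ (y * a) (*-≉0 y≉0 a≉0) (begin
      r * r * (y * a)              ≈⟨ *-assoc (r * r) y a ⟨
      r * r * y * a                ≈⟨ *-congʳ r²y≈ ⟩
      p * x * a                    ≈⟨ solve 3 (λ p x a → p :* x :* a := a :* p :* x) refl p x a ⟩
      a * p * x                    ≈⟨ *-congʳ ap≈ ⟩
      x * y * x                    ≈⟨ *-identityˡ _ ⟨
      1# * (x * y * x)             ≈⟨ *-congʳ u²a≈1 ⟨
      u * u * a * (x * y * x)      ≈⟨ solve 4 (λ u a x y → u :* u :* a :* (x :* y :* x) := u :* x :* (u :* x) :* (y :* a)) refl u a x y ⟩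
      u * x * (u * x) * (y * a)    ∎))

  r₂≈uq : r₂ ≈ u * q
  r₂≈uq = root≈ (√-nonneg _) (natF-nonneg (v ∸ k)) q≉0 k≉0 (√/ₙ-square (v ∸ 1) (v ∸ k) k 0<k) ap≈qk

  r₃≈uk : r₃ ≈ u * kF
  r₃≈uk = root≈ (√-nonneg _) (natF-nonneg k) k≉0 q≉0 (√/ₙ-square (v ∸ 1) k (v ∸ k) 0<v-k) (trans ap≈qk (*-comm q kF))

  -- The order and the signs are those of the columns of Q; for instance -u precedes u because -r₂
  -- precedes r₂.
  coeffs : Fin 6 → Fin 6 → Carrier
  coeffs 0F = constantCoeffs 1#
  coeffs 1F = signedCoeffs w
  coeffs 2F = signedCoeffs (- w)
  coeffs 3F = constantCoeffs (- 1#)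
  coeffs 4F = designCoeffs (- u)
  coeffs 5F = designCoeffs u

  -- Defined through Q, so that the equation of the second eigenmatrix holds by `refl` and the
  -- burden falls on idempotency.
  E : Fin 6 → MatF N
  E j = (1 /ₙ N) • ∑ₘ 6 (λ i → Q i j • B i)

  -- The change from `basis` to A₀, ..., A₅, with K and K′ expanded.
  schemeCoeffs : (Fin 6 → Carrier) → Fin 6 → Carrier
  schemeCoeffs c 0F = c 0F + c 4F
  schemeCoeffs c 1F = c 1F + c 4F
  schemeCoeffs c 2F = c 4F
  schemeCoeffs c 3F = c 2F + c 5F
  schemeCoeffs c 4F = c 3F + c 5F
  schemeCoeffs c 5F = c 5F

  ⟦⟧≈schemeCoeffs : ∀ c x y → ⟦ c ⟧ x y ≈ M.∑ᵣ 6 (λ i → schemeCoeffs c i * B i x y)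
  ⟦⟧≈schemeCoeffs c x y = begin
    ⟦ c ⟧ x y
      ≈⟨ +-congˡ (+-congˡ (+-congˡ (+-congˡ (+-cong (*-congˡ (K≈ x y)) (+-congʳ (*-congˡ (K′≈ x y))))))) ⟩
    _ ≈⟨ solve 12 (λ c0 c1 c2 c3 c4 c5 b0 b1 b2 b3 b4 b5 →
           c0 :* b0 :+ (c1 :* b1 :+ (c2 :* b3 :+ (c3 :* b4 :+ (c4 :* (b0 :+ b1 :+ b2) :+ (c5 :* (b3 :+ b4 :+ b5) :+ con 0ℤ)))))
           := (c0 :+ c4) :* b0 :+ ((c1 :+ c4) :* b1 :+ (c4 :* b2 :+ ((c2 :+ c5) :* b3 :+ ((c3 :+ c5) :* b4 :+ (c5 :* b5 :+ con 0ℤ))))))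
         refl (c 0F) (c 1F) (c 2F) (c 3F) (c 4F) (c 5F) (B 0F x y) (B 1F x y) (B 2F x y) (B 3F x y) (B 4F x y) (B 5F x y) ⟩
    M.∑ᵣ 6 (λ i → schemeCoeffs c i * B i x y) ∎

  private
    x≈0+x : ∀ x → x ≈ 0# + x
    x≈0+x x = sym (+-identityˡ x)
    x≈x+0 : ∀ x → x ≈ x + 0#
    x≈x+0 x = sym (+-identityʳ x)
    p≈v-1 : p ≈ vF + - 1#
    p≈v-1 = trans (solve 1 (λ p → p := con 1ℤ :+ p :- con 1ℤ) refl p) (+-congʳ (sym v≈1+p))
    uq≈uv-uk : u * q ≈ u * vF + - (u * kF)
    uq≈uv-uk = trans (solve 3 (λ u k q → u :* q := u :* (k :+ q) :- u :* k) refl u kF q) (+-congʳ (*-congˡ (sym v≈k+q)))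
    r₂≈ : r₂ ≈ u * vF + - (u * kF)
    r₂≈ = trans r₂≈uq uq≈uv-uk
    -r₂≈ : - r₂ ≈ - u * vF + - (- u * kF)
    -r₂≈ = trans (-‿cong r₂≈) (solve 3 (λ u v k → :- (u :* v :- u :* k) := (:- u) :* v :- (:- u) :* k) refl u vF kF)

  -- In columns 4 and 5 the entries ±r₂ split as ±(uv - uk): uv is the coefficient of A₃ and A₄, and
  -- -uk that of K′, which alone remains in the row of A₅ and gives r₃ = uk.
  Q≈ : ∀ j i → Q i j ≈ schemeCoeffs (coeffs j) i
  Q≈ 0F = λ { 0F → x≈0+x _ ; 1F → x≈0+x _ ; 2F → refl ; 3F → x≈0+x _ ; 4F → x≈0+x _ ; 5F → refl }
  Q≈ 1F = λ { 0F → x≈x+0 _ ; 1F → x≈x+0 _ ; 2F → refl ; 3F → x≈x+0 _ ; 4F → x≈x+0 _ ; 5F → refl }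
  Q≈ 2F = λ { 0F → x≈x+0 _ ; 1F → x≈x+0 _ ; 2F → refl ; 3F → x≈x+0 _
            ; 4F → solve 1 (λ w → w := (:- (:- w)) :+ con 0ℤ) refl w ; 5F → refl }
  Q≈ 3F = λ { 0F → x≈0+x _ ; 1F → x≈0+x _ ; 2F → refl ; 3F → x≈0+x _ ; 4F → x≈0+x _ ; 5F → refl }
  Q≈ 4F = λ { 0F → p≈v-1 ; 1F → p≈v-1 ; 2F → refl ; 3F → -r₂≈ ; 4F → -r₂≈
            ; 5F → trans r₃≈uk (solve 2 (λ u k → u :* k := :- ((:- u) :* k)) refl u kF) }
  Q≈ 5F = λ { 0F → p≈v-1 ; 1F → p≈v-1 ; 2F → refl ; 3F → r₂≈ ; 4F → r₂≈ ; 5F → -‿cong r₃≈uk }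

  E≈ : ∀ j → E j ≋ ((1 /ₙ N) • ⟦ coeffs j ⟧)
  E≈ j x y = *-congˡ (trans (M.∑-cong 6 (λ i → *-congʳ {B i x y} (Q≈ j i))) (sym (⟦⟧≈schemeCoeffs (coeffs j) x y)))

  eigenvalues : Fin 6 → Fin 6 → Carrier
  eigenvalues 0F = eigenvalue 1# ((1# + 1#) * vF) (1# * ((1# + 1#) * vF)) (1# * kF)
  eigenvalues 1F = eigenvalue (- 1#) 0# 0# s
  eigenvalues 2F = eigenvalue (- 1#) 0# 0# (- s)
  eigenvalues 3F = eigenvalue 1# ((1# + 1#) * vF) (- 1# * ((1# + 1#) * vF)) (- 1# * kF)
  eigenvalues 4F = eigenvalue 1# 0# 0# (- r₁)
  eigenvalues 5F = eigenvalue 1# 0# 0# r₁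

  private
    neg-product : ∀ x y → - x * - y ≈ x * y
    neg-product x y = solve 2 (λ x y → (:- x) :* (:- y) := x :* y) refl x y

  ⟦coeffs⟧-eigen : ∀ i j → (B j ×ₘ ⟦ coeffs i ⟧) ≋ (eigenvalues i j • ⟦ coeffs i ⟧)
  ⟦coeffs⟧-eigen 0F = constant-eigenvector 1# (*-identityˡ 1#)
  ⟦coeffs⟧-eigen 1F = signed-eigenvector s w s²≈k ws≈v
  ⟦coeffs⟧-eigen 2F = signed-eigenvector (- s) (- w) (trans (neg-product s s) s²≈k) (trans (neg-product w s) ws≈v)
  ⟦coeffs⟧-eigen 3F = constant-eigenvector (- 1#) (trans (neg-product 1# 1#) (*-identityˡ 1#))
  ⟦coeffs⟧-eigen 4F = design-eigenvector (- r₁) (- u) (trans (neg-product r₁ r₁) r₁²≈a) (trans (neg-product u r₁) ur₁≈1) k²≈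
  ⟦coeffs⟧-eigen 5F = design-eigenvector r₁ u r₁²≈a ur₁≈1 k²≈

  private
    2p≈ : natF (2 ℕ.* (v ∸ 1)) ≈ (1# + 1#) * vF + - 1# + - 1#
    2p≈ = trans (natF-double (v ∸ 1)) (trans (solve 1 (λ p → (con 1ℤ :+ con 1ℤ) :* p := (con 1ℤ :+ con 1ℤ) :* (con 1ℤ :+ p) :- con 1ℤ :- con 1ℤ) refl p)
      (+-congʳ (+-congʳ (*-congˡ (sym v≈1+p)))))
    2q≈ : natF (2 ℕ.* (v ∸ k)) ≈ (1# + 1#) * vF + - kF + - kF
    2q≈ = trans (natF-double (v ∸ k)) (trans (solve 2 (λ k q → (con 1ℤ :+ con 1ℤ) :* q := (con 1ℤ :+ con 1ℤ) :* (k :+ q) :- k :- k) refl kF q)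
      (+-congʳ (+-congʳ (*-congˡ (sym v≈k+q)))))
    0≈0+1-1 : 0# ≈ 0# + - 1# + - - 1#
    0≈0+1-1 = solve 0 (con 0ℤ := con 0ℤ :- con 1ℤ :- (:- con 1ℤ)) refl
    -1* : ∀ x → - x ≈ - 1# * x
    -1* x = solve 1 (λ x → :- x := (:- con 1ℤ) :* x) refl x
    -2≈ : - (1# + 1#) ≈ 0# + - 1# + - 1#
    -2≈ = solve 0 (:- (con 1ℤ :+ con 1ℤ) := con 0ℤ :- con 1ℤ :- con 1ℤ) refl

  P≈ : ∀ i j → P i j ≈ eigenvalues i j
  P≈ 0F = λ { 0F → refl ; 1F → refl ; 2F → 2p≈
            ; 3F → sym (*-identityˡ kF)
            ; 4F → solve 1 (λ k → k := con 1ℤ :* (con 1ℤ :* k)) refl kF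
            ; 5F → trans 2q≈ (solve 2 (λ v k → (con 1ℤ :+ con 1ℤ) :* v :- k :- k
                := con 1ℤ :* ((con 1ℤ :+ con 1ℤ) :* v) :- con 1ℤ :* k :- con 1ℤ :* (con 1ℤ :* k)) refl vF kF) }
  P≈ 1F = λ { 0F → refl ; 1F → refl ; 2F → 0≈0+1-1 ; 3F → refl ; 4F → -1* s
            ; 5F → solve 1 (λ s → con 0ℤ := con 0ℤ :- s :- (:- con 1ℤ) :* s) refl s }
  P≈ 2F = λ { 0F → refl ; 1F → refl ; 2F → 0≈0+1-1 ; 3F → refl
            ; 4F → solve 1 (λ s → s := (:- con 1ℤ) :* (:- s)) refl s
            ; 5F → solve 1 (λ s → con 0ℤ := con 0ℤ :- (:- s) :- (:- con 1ℤ) :* (:- s)) refl s }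
  P≈ 3F = λ { 0F → refl ; 1F → refl ; 2F → 2p≈ ; 3F → -1* kF
            ; 4F → solve 1 (λ k → :- k := con 1ℤ :* ((:- con 1ℤ) :* k)) refl kF
            ; 5F → trans (-‿cong 2q≈) (solve 2 (λ v k → :- ((con 1ℤ :+ con 1ℤ) :* v :- k :- k)
                := (:- con 1ℤ) :* ((con 1ℤ :+ con 1ℤ) :* v) :- (:- con 1ℤ) :* k :- con 1ℤ :* ((:- con 1ℤ) :* k)) refl vF kF) }
  P≈ 4F = λ { 0F → refl ; 1F → refl ; 2F → -2≈ ; 3F → refl ; 4F → sym (*-identityˡ _)
            ; 5F → solve 1 (λ r → (con 1ℤ :+ con 1ℤ) :* r := con 0ℤ :- (:- r) :- con 1ℤ :* (:- r)) refl r₁ }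
  P≈ 5F = λ { 0F → refl ; 1F → refl ; 2F → -2≈ ; 3F → refl ; 4F → sym (*-identityˡ _)
            ; 5F → solve 1 (λ r → :- ((con 1ℤ :+ con 1ℤ) :* r) := con 0ℤ :- r :- con 1ℤ :* r) refl r₁ }

  BE : ∀ i j → (B j ×ₘ E i) ≋ (P i j • E i)
  BE i j x y = begin
    (B j ×ₘ E i) x y                                ≈⟨ M.⊡-congˡ (B j) (E≈ i) x y ⟩
    (B j ×ₘ ((1 /ₙ N) • ⟦ coeffs i ⟧)) x y          ≈⟨ ×-scale (B j) ⟦ coeffs i ⟧ (1 /ₙ N) x y ⟩
    (1 /ₙ N) * (B j ×ₘ ⟦ coeffs i ⟧) x y            ≈⟨ *-congˡ (⟦coeffs⟧-eigen i j x y) ⟩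
    (1 /ₙ N) * (eigenvalues i j * ⟦ coeffs i ⟧ x y) ≈⟨ solve 3 (λ n e m → n :* (e :* m) := e :* (n :* m)) refl (1 /ₙ N) (eigenvalues i j) (⟦ coeffs i ⟧ x y) ⟩
    eigenvalues i j * ((1 /ₙ N) * ⟦ coeffs i ⟧ x y) ≈⟨ *-cong (P≈ i j) (E≈ i x y) ⟨
    P i j * E i x y                                 ∎

  E-inBM : ∀ j → InBM A (E j)
  E-inBM j = (λ i → (1 /ₙ N) * Q i j) , λ x y → trans (M.∑-*ˡ 6 (1 /ₙ N) (λ i → Q i j * B i x y))
    (M.∑-cong 6 (λ i → sym (*-assoc (1 /ₙ N) (Q i j) (B i x y))))

  E-sym : ∀ j → Sym (E j)
  E-sym j x y = *-congˡ (M.∑-cong 6 (λ i → *-congˡ {Q i j} (B-sym i x y)))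

  EB : ∀ i j → (E i ×ₘ B j) ≋ (P i j • E i)
  EB i j = ×-comm (B j) (E i) (E i) (P i j) (B-sym j) (E-sym i) (E-sym i) (BE i j)

  -- The product of `E i`, `B j` and `E h` is evaluated from the left and from the right; this
  -- yields `E i ×ₘ E h` with two different factors.
  distinct⇒orthogonal : ∀ i h j → ¬ (P i j + - P h j ≈ 0#) → (E i ×ₘ E h) ≋ 0ₘ
  distinct⇒orthogonal i h j distinct x y = *-cancelʳ-≈0 distinct (begin
    (E i ×ₘ E h) x y * (P i j + - P h j)
      ≈⟨ solve 3 (λ e p q → e :* (p :- q) := p :* e :- q :* e) refl ((E i ×ₘ E h) x y) (P i j) (P h j) ⟩
    P i j * (E i ×ₘ E h) x y + - (P h j * (E i ×ₘ E h) x y)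
      ≈⟨ +-congʳ P*EE≈ ⟩
    P h j * (E i ×ₘ E h) x y + - (P h j * (E i ×ₘ E h) x y)
      ≈⟨ solve 1 (λ e → e :- e := con 0ℤ) refl (P h j * (E i ×ₘ E h) x y) ⟩
    0# ∎)
    where
    P*EE≈ : P i j * (E i ×ₘ E h) x y ≈ P h j * (E i ×ₘ E h) x y
    P*EE≈ = begin
      P i j * (E i ×ₘ E h) x y      ≈⟨ M.∑-*ˡ N (P i j) (λ l → E i x l * E h l y) ⟩
      M.∑ᵣ N (λ l → P i j * (E i x l * E h l y)) ≈⟨ M.∑-cong N (λ l → *-assoc (P i j) (E i x l) (E h l y)) ⟨
      ((P i j • E i) ×ₘ E h) x y    ≈⟨ M.⊡-congʳ (E h) (EB i j) x y ⟨
      ((E i ×ₘ B j) ×ₘ E h) x y     ≈⟨ M.⊡-assoc (E i) (B j) (E h) x y ⟩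
      (E i ×ₘ (B j ×ₘ E h)) x y     ≈⟨ M.⊡-congˡ (E i) (BE h j) x y ⟩
      (E i ×ₘ (P h j • E h)) x y    ≈⟨ ×-scale (E i) (E h) (P h j) x y ⟩
      P h j * (E i ×ₘ E h) x y      ∎

  private
    ≉0-cong : ∀ {x y} → x ≈ y → ¬ (y ≈ 0#) → ¬ (x ≈ 0#)
    ≉0-cong x≈y y≉0 x≈0 = y≉0 (trans (sym x≈y) x≈0)

    ≉0-neg : ∀ {x y} → ¬ (x + - y ≈ 0#) → ¬ (y + - x ≈ 0#)
    ≉0-neg {x} {y} x-y≉0 y-x≈0 = x-y≉0 (trans (solve 2 (λ x y → x :- y := (y :- x) :* (:- con 1ℤ)) refl x y)
      (trans (*-congʳ y-x≈0) (zeroˡ _)))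

    1--1≉0 : ¬ (1# + - - 1# ≈ 0#)
    1--1≉0 = ≉0-cong (solve 0 (con 1ℤ :- (:- con 1ℤ) := con 1ℤ :+ con 1ℤ) refl) 2≉0

    x--x≉0 : ∀ {x} → ¬ (x ≈ 0#) → ¬ (x + - - x ≈ 0#)
    x--x≉0 {x} x≉0 = ≉0-cong (solve 1 (λ x → x :- (:- x) := (con 1ℤ :+ con 1ℤ) :* x) refl x) (*-≉0 2≉0 x≉0)

    2p+2≉0 : ¬ (natF (2 ℕ.* (v ∸ 1)) + - - (1# + 1#) ≈ 0#)
    2p+2≉0 = ≉0-cong (trans (+-congʳ 2p≈) (solve 1 (λ v → (con 1ℤ :+ con 1ℤ) :* v :- con 1ℤ :- con 1ℤ :- (:- (con 1ℤ :+ con 1ℤ))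
      := (con 1ℤ :+ con 1ℤ) :* v) refl vF)) (*-≉0 2≉0 v≉0)

  -- A₁ separates the signed part from the rest, A₂ the constant part from the design part, and A₃
  -- the two members of each part.
  distinct : ∀ i h → i ≢ h → ∃ λ j → ¬ (P i j + - P h j ≈ 0#)
  distinct 0F 0F i≢h = ⊥-elim (i≢h ≡.refl)
  distinct 0F 1F _   = 1F , 1--1≉0
  distinct 0F 2F _   = 1F , 1--1≉0
  distinct 0F 3F _   = 3F , x--x≉0 k≉0
  distinct 0F 4F _   = 2F , 2p+2≉0
  distinct 0F 5F _   = 2F , 2p+2≉0
  distinct 1F 0F _   = 1F , ≉0-neg 1--1≉0
  distinct 1F 1F i≢h = ⊥-elim (i≢h ≡.refl)
  distinct 1F 2F _   = 3F , x--x≉0 s≉0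
  distinct 1F 3F _   = 1F , ≉0-neg 1--1≉0
  distinct 1F 4F _   = 1F , ≉0-neg 1--1≉0
  distinct 1F 5F _   = 1F , ≉0-neg 1--1≉0
  distinct 2F 0F _   = 1F , ≉0-neg 1--1≉0
  distinct 2F 1F _   = 3F , ≉0-neg (x--x≉0 s≉0)
  distinct 2F 2F i≢h = ⊥-elim (i≢h ≡.refl)
  distinct 2F 3F _   = 1F , ≉0-neg 1--1≉0
  distinct 2F 4F _   = 1F , ≉0-neg 1--1≉0
  distinct 2F 5F _   = 1F , ≉0-neg 1--1≉0
  distinct 3F 0F _   = 3F , ≉0-neg (x--x≉0 k≉0)
  distinct 3F 1F _   = 1F , 1--1≉0
  distinct 3F 2F _   = 1F , 1--1≉0
  distinct 3F 3F i≢h = ⊥-elim (i≢h ≡.refl)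
  distinct 3F 4F _   = 2F , 2p+2≉0
  distinct 3F 5F _   = 2F , 2p+2≉0
  distinct 4F 0F _   = 2F , ≉0-neg 2p+2≉0
  distinct 4F 1F _   = 1F , 1--1≉0
  distinct 4F 2F _   = 1F , 1--1≉0
  distinct 4F 3F _   = 2F , ≉0-neg 2p+2≉0
  distinct 4F 4F i≢h = ⊥-elim (i≢h ≡.refl)
  distinct 4F 5F _   = 3F , ≉0-neg (x--x≉0 r₁≉0)
  distinct 5F 0F _   = 2F , ≉0-neg 2p+2≉0
  distinct 5F 1F _   = 1F , 1--1≉0
  distinct 5F 2F _   = 1F , 1--1≉0
  distinct 5F 3F _   = 2F , ≉0-neg 2p+2≉0
  distinct 5F 4F _   = 3F , x--x≉0 r₁≉0
  distinct 5F 5F i≢h = ⊥-elim (i≢h ≡.refl)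

  E-orthogonal : ∀ i h → i ≢ h → (E i ×ₘ E h) ≋ 0ₘ
  E-orthogonal i h i≢h = let j , P≉ = distinct i h i≢h in distinct⇒orthogonal i h j P≉

  N≉0 : ¬ (natF N ≈ 0#)
  N≉0 = ≉0-cong natF-N (*-≉0 2≉0 (*-≉0 2≉0 v≉0))

  1/N*N : (1 /ₙ N) * natF N ≈ 1#
  1/N*N = trans (*-assoc _ _ _) (trans (*-cong (+-identityʳ 1#) (trans (*-comm _ _) (⁻¹-inverse _ N≉0))) (*-identityˡ 1#))

  -- Summing the E j adds up the rows of Q, so this is the identity ΣE j = A₀; row 0 gives v + v + v
  -- + v = N.
  Q-rowSum : ∀ i → M.∑ᵣ 6 (λ j → Q i j) ≈ natF N * (if ⌊ i Fin.≟ 0F ⌋ then 1# else 0#)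
  Q-rowSum 0F = begin
    1# + (vF + (vF + (1# + (p + (p + 0#)))))
      ≈⟨ solve 2 (λ v p → con 1ℤ :+ (v :+ (v :+ (con 1ℤ :+ (p :+ (p :+ con 0ℤ))))) := v :+ v :+ (con 1ℤ :+ p) :+ (con 1ℤ :+ p)) refl vF p ⟩
    vF + vF + (1# + p) + (1# + p)
      ≈⟨ +-cong (+-congˡ (sym v≈1+p)) (sym v≈1+p) ⟩
    vF + vF + vF + vF
      ≈⟨ solve 1 (λ v → v :+ v :+ v :+ v := (con 1ℤ :+ con 1ℤ) :* ((con 1ℤ :+ con 1ℤ) :* v) :* con 1ℤ) refl vF ⟩
    (1# + 1#) * ((1# + 1#) * vF) * 1#
      ≈⟨ *-congʳ natF-N ⟨
    natF N * 1# ∎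
  Q-rowSum 1F = begin
    1# + (- vF + (- vF + (1# + (p + (p + 0#)))))
      ≈⟨ solve 2 (λ v p → con 1ℤ :+ ((:- v) :+ ((:- v) :+ (con 1ℤ :+ (p :+ (p :+ con 0ℤ))))) := (con 1ℤ :+ p) :+ (con 1ℤ :+ p) :- v :- v) refl vF p ⟩
    (1# + p) + (1# + p) + - vF + - vF
      ≈⟨ +-congʳ (+-congʳ (+-cong (sym v≈1+p) (sym v≈1+p))) ⟩
    vF + vF + - vF + - vF
      ≈⟨ solve 2 (λ v n → v :+ v :- v :- v := n :* con 0ℤ) refl vF (natF N) ⟩
    natF N * 0# ∎
  Q-rowSum 2F = solve 1 (λ n → con 1ℤ :+ (con 0ℤ :+ (con 0ℤ :+ (con 1ℤ :+ ((:- con 1ℤ) :+ ((:- con 1ℤ) :+ con 0ℤ))))) := n :* con 0ℤ) refl (natF N)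
  Q-rowSum 3F = solve 3 (λ n w r → con 1ℤ :+ (w :+ ((:- w) :+ ((:- con 1ℤ) :+ ((:- r) :+ (r :+ con 0ℤ))))) := n :* con 0ℤ) refl (natF N) w r₂
  Q-rowSum 4F = solve 3 (λ n w r → con 1ℤ :+ ((:- w) :+ (w :+ ((:- con 1ℤ) :+ ((:- r) :+ (r :+ con 0ℤ))))) := n :* con 0ℤ) refl (natF N) w r₂
  Q-rowSum 5F = solve 2 (λ n r → con 1ℤ :+ (con 0ℤ :+ (con 0ℤ :+ ((:- con 1ℤ) :+ (r :+ ((:- r) :+ con 0ℤ))))) := n :* con 0ℤ) refl (natF N) r₃

  E-sum : ∑ₘ 6 E ≋ B 0F
  E-sum x y = begin
    M.∑ᵣ 6 (λ j → (1 /ₙ N) * M.∑ᵣ 6 (λ i → Q i j * B i x y))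
      ≈⟨ M.∑-*ˡ 6 (1 /ₙ N) (λ j → M.∑ᵣ 6 (λ i → Q i j * B i x y)) ⟨
    (1 /ₙ N) * M.∑ᵣ 6 (λ j → M.∑ᵣ 6 (λ i → Q i j * B i x y))
      ≈⟨ *-congˡ (M.∑-swap 6 6 (λ j i → Q i j * B i x y)) ⟩
    (1 /ₙ N) * M.∑ᵣ 6 (λ i → M.∑ᵣ 6 (λ j → Q i j * B i x y))
      ≈⟨ *-congˡ (M.∑-cong 6 (λ i → trans (sym (M.∑-*ʳ 6 (B i x y) (λ j → Q i j))) (*-congʳ {B i x y} (Q-rowSum i)))) ⟩
    (1 /ₙ N) * M.∑ᵣ 6 (λ i → natF N * (if ⌊ i Fin.≟ 0F ⌋ then 1# else 0#) * B i x y)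
      ≈⟨ solve 8 (λ c n b0 b1 b2 b3 b4 b5 → c :* (n :* con 1ℤ :* b0 :+ (n :* con 0ℤ :* b1 :+ (n :* con 0ℤ :* b2
            :+ (n :* con 0ℤ :* b3 :+ (n :* con 0ℤ :* b4 :+ (n :* con 0ℤ :* b5 :+ con 0ℤ)))))) := c :* n :* b0)
          refl (1 /ₙ N) (natF N) (B 0F x y) (B 1F x y) (B 2F x y) (B 3F x y) (B 4F x y) (B 5F x y) ⟩
    (1 /ₙ N) * natF N * B 0F x y
      ≈⟨ *-congʳ 1/N*N ⟩
    1# * B 0F x y
      ≈⟨ *-identityˡ _ ⟩
    B 0F x y ∎

  -- Inserting A₀ = ΣE i serves twice: for `L` = `B j` it gives the first eigenmatrix, for `L` =
  -- `E i`, with orthogonality, idempotency.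
  ×-∑E : ∀ L → (L ×ₘ B 0F) ≋ ∑ₘ 6 (λ i → L ×ₘ E i)
  ×-∑E L x y = begin
    (L ×ₘ B 0F) x y
      ≈⟨ M.⊡-congˡ L (λ x y → trans (sym (E-sum x y)) (M.∑-cong 6 (λ i → sym (*-identityˡ (E i x y))))) x y ⟩
    (L ×ₘ (λ x y → M.∑ᵣ 6 (λ i → 1# * E i x y))) x y
      ≈⟨ M.⊡-∑ʳ 6 L (λ _ → 1#) E x y ⟩
    M.∑ᵣ 6 (λ i → 1# * (L ×ₘ E i) x y)
      ≈⟨ M.∑-cong 6 (λ i → *-identityˡ ((L ×ₘ E i) x y)) ⟩
    ∑ₘ 6 (λ i → L ×ₘ E i) x y ∎

  B≋∑PE : ∀ j → B j ≋ ∑ₘ 6 (λ i → P i j • E i)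
  B≋∑PE j x y = trans (sym (BB₀ j x y)) (trans (×-∑E (B j) x y) (M.∑-cong 6 (λ i → BE i j x y)))

  ∑-single : ∀ {n} (i : Fin n) {f : Fin n → Carrier} → (∀ h → i ≢ h → f h ≈ 0#) → M.∑ᵣ n f ≈ f i
  ∑-single {ℕ.suc n} 0F {f} f≈0 = trans (+-congˡ (M.∑-zero n (λ h → f≈0 (suc h) (λ ())))) (+-identityʳ _)
  ∑-single (suc i) {f} f≈0 = trans (+-cong (f≈0 0F (λ ())) (∑-single i (λ h i≢h → f≈0 (suc h) (λ eq → i≢h (Fin.suc-injective eq))))) (+-identityˡ _)

  EB₀ : ∀ i → (E i ×ₘ B 0F) ≋ E i
  EB₀ i x y = trans (EB i 0F x y) (trans (*-congʳ (P≈ i 0F)) (go i))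
    where
    go : ∀ i → eigenvalues i 0F * E i x y ≈ E i x y
    go 0F = *-identityˡ _
    go 1F = *-identityˡ _
    go 2F = *-identityˡ _
    go 3F = *-identityˡ _
    go 4F = *-identityˡ _
    go 5F = *-identityˡ _

  E-idempotent : ∀ i → (E i ×ₘ E i) ≋ E i
  E-idempotent i x y = begin
    (E i ×ₘ E i) x y                ≈⟨ ∑-single i (λ h i≢h → E-orthogonal i h i≢h x y) ⟨
    ∑ₘ 6 (λ h → E i ×ₘ E h) x y     ≈⟨ ×-∑E (E i) x y ⟨
    (E i ×ₘ B 0F) x y               ≈⟨ EB₀ i x y ⟩
    E i x y                         ∎

  Q₀≉0 : ∀ i → ¬ (Q 0F i ≈ 0#)
  Q₀≉0 0F = λ eq → 0≉1 (sym eq)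
  Q₀≉0 1F = v≉0
  Q₀≉0 2F = v≉0
  Q₀≉0 3F = λ eq → 0≉1 (sym eq)
  Q₀≉0 4F = p≉0
  Q₀≉0 5F = p≉0

  -- On the diagonal only A₀ contributes, so the entry is `Q 0F i` divided by N. This one explicit
  -- entry shows that `E i` is nonzero and later allows scalars in front of `E i` to be compared.
  E-x₀≉0 : ∀ i → ¬ (E i x₀ x₀ ≈ 0#)
  E-x₀≉0 i = *-≉0 1/N≉0 (≉0-cong only₀ (Q₀≉0 i))
    where
    1/N≉0 : ¬ (1 /ₙ N ≈ 0#)
    1/N≉0 eq = 0≉1 (trans (sym (trans (*-congʳ eq) (zeroˡ _))) 1/N*N)
    only₀ : M.∑ᵣ 6 (λ h → Q h i * B h x₀ x₀) ≈ Q 0F i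
    only₀ = begin
      M.∑ᵣ 6 (λ h → Q h i * B h x₀ x₀)
        ≈⟨ ∑-single 0F {λ h → Q h i * B h x₀ x₀} (λ { 0F 0≢0 → ⊥-elim (0≢0 ≡.refl) ; (suc h) _ → trans (*-congˡ (reflexive (≡.cong intF (A-diag h)))) (zeroʳ _) }) ⟩
      Q 0F i * B 0F x₀ x₀
        ≈⟨ *-congˡ (reflexive (≡.cong intF (≡.trans (Relations.A₀≡Id R x₀ x₀) (Id-diag N x₀)))) ⟩
      Q 0F i * intF 1ℤ
        ≈⟨ trans (*-congˡ (+-identityʳ 1#)) (*-identityʳ _) ⟩
      Q 0F i ∎

  -- Every element of the algebra acts on `E i` as a scalar z, the corresponding combination of row
  -- i of P. Then GE = G says G = zE, and G² = G read at the nonzero entry gives z² = z.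
  E-primitive : ∀ i G → InBM A G → (G ×ₘ G) ≋ G → (G ×ₘ E i) ≋ G → G ≋ 0ₘ ⊎ G ≋ E i
  E-primitive i G (γ , G≋) G²≋G GE≋G = cases (idempotent⇒0∨1 z²≈z)
    where
    z : Carrier
    z = M.∑ᵣ 6 (λ j → γ j * P i j)

    GE≋zE : (G ×ₘ E i) ≋ (z • E i)
    GE≋zE x y = begin
      (G ×ₘ E i) x y                                ≈⟨ M.⊡-congʳ (E i) G≋ x y ⟩
      ((λ x y → M.∑ᵣ 6 (λ j → γ j * B j x y)) ×ₘ E i) x y ≈⟨ M.⊡-∑ˡ 6 γ B (E i) x y ⟩
      M.∑ᵣ 6 (λ j → γ j * (B j ×ₘ E i) x y)         ≈⟨ M.∑-cong 6 (λ j → trans (*-congˡ {γ j} (BE i j x y)) (sym (*-assoc (γ j) (P i j) (E i x y)))) ⟩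
      M.∑ᵣ 6 (λ j → γ j * P i j * E i x y)          ≈⟨ M.∑-*ʳ 6 (E i x y) (λ j → γ j * P i j) ⟨
      z * E i x y                                   ∎

    G≋zE : G ≋ (z • E i)
    G≋zE x y = trans (sym (GE≋G x y)) (GE≋zE x y)

    z²≈z : z * z ≈ z
    z²≈z = *-cancelʳ (E i x₀ x₀) (E-x₀≉0 i) (begin
      z * z * E i x₀ x₀              ≈⟨ *-assoc z z _ ⟩
      z * (z * E i x₀ x₀)            ≈⟨ *-congˡ (GE≋zE x₀ x₀) ⟨
      z * (G ×ₘ E i) x₀ x₀           ≈⟨ ×-scale G (E i) z x₀ x₀ ⟨
      (G ×ₘ (z • E i)) x₀ x₀         ≈⟨ M.⊡-congˡ G G≋zE x₀ x₀ ⟨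
      (G ×ₘ G) x₀ x₀                 ≈⟨ G²≋G x₀ x₀ ⟩
      G x₀ x₀                        ≈⟨ G≋zE x₀ x₀ ⟩
      z * E i x₀ x₀                  ∎)

    cases : z ≈ 0# ⊎ z ≈ 1# → G ≋ 0ₘ ⊎ G ≋ E i
    cases (inj₁ z≈0) = inj₁ (λ x y → trans (G≋zE x y) (trans (*-congʳ z≈0) (zeroˡ _)))
    cases (inj₂ z≈1) = inj₂ (λ x y → trans (G≋zE x y) (trans (*-congʳ z≈1) (*-identityˡ _)))

  E₀≋J/N : (∀ x y → ∑ℤ 6 (λ i → A i x y) ≡ 1ℤ) → E 0F ≋ ((1 /ₙ N) • liftₘ (Jm N N))
  E₀≋J/N A-sum x y = *-congˡ (begin
    M.∑ᵣ 6 (λ i → Q i 0F * B i x y)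
      ≈⟨ M.∑-cong 6 (λ i → trans (*-congʳ {B i x y} (Qᵢ₀≈1 i)) (*-identityˡ (B i x y))) ⟩
    M.∑ᵣ 6 (λ i → B i x y)
      ≈⟨ intF-∑ 6 (λ i → A i x y) ⟨
    intF (∑ℤ 6 (λ i → A i x y))
      ≡⟨ ≡.cong intF (A-sum x y) ⟩
    intF 1ℤ ∎)
    where
    Qᵢ₀≈1 : ∀ i → Q i 0F ≈ 1#
    Qᵢ₀≈1 0F = refl
    Qᵢ₀≈1 1F = refl
    Qᵢ₀≈1 2F = refl
    Qᵢ₀≈1 3F = refl
    Qᵢ₀≈1 4F = refl
    Qᵢ₀≈1 5F = refl

  areEigenmatrices : (∀ x y → ∑ℤ 6 (λ i → A i x y) ≡ 1ℤ) → AreEigenmatrices A E P Q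
  areEigenmatrices A-sum = record
    { primitiveIdem = λ i → record
        { inBM        = E-inBM i
        ; idempotent  = E-idempotent i
        ; nonzero     = λ E≋0 → E-x₀≉0 i (E≋0 x₀ x₀)
        ; isPrimitive = E-primitive i
        }
    ; orthogonal  = E-orthogonal
    ; sum≡I       = λ x y → trans (E-sum x y) (reflexive (≡.cong intF (Relations.A₀≡Id R x y)))
    ; E₀≡J/N      = E₀≋J/N A-sum
    ; firstEigen  = B≋∑PE
    ; secondEigen = λ j x y → refl
    }

open import Data.Nat using (_<_; _*_)

mainTheorem4 : ∀ {c ℓ ℓ'} (F : OrderedFieldWithSqrt c ℓ ℓ') (v k lam : ℕ) (W : Mat ℤ v v) →
    0 < k → k < v → IsBalancedWeighing v k lam W →
    IsSymAssocScheme (2 * (2 * v)) 5 (schemeA v W)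
    × Σ (Fin 6 → OverField.MatF F (2 * (2 * v)))
    (λ E → OverField.AreEigenmatrices F (schemeA v W) E (OverField.Pmat F v k) (OverField.Qmat F v k))
mainTheorem4 F v k lam W 0<k k<v balanced =
  Scheme.isSymAssocScheme 0<k k<v G , Idempotents.E , Idempotents.areEigenmatrices (Entrywise.A-sum G)
  where
  open IntegerMatrices
  -- 0 < k < v gives 1 < v, which provides the two rows that determine λ/2.
  μ = proj₁ (balanced⇒signedGram (ℕ.≤-<-trans 0<k k<v) balanced)
  G = proj₂ (balanced⇒signedGram (ℕ.≤-<-trans 0<k k<v) balanced)
  module Idempotents = IdempotentBasis F (Entrywise.relations G) 0<k k<v (k²-relation G (Scheme.x₀ 0<k k<v G))
    (Scheme.vertex₀ 0<k k<v G) (Scheme.A-diag 0<k k<v G)
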